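{- Over $\mathsf{RCA}_0$, $\mathsf{EM}$ implies $\mathsf{RT}^2_2$ if and only if $\mathsf{EM}$ implies $\mathsf{ADS}$. That is, $\mathsf{RCA}_0+\mathsf{EM}\vdash\mathsf{RT}^2_2$ if and only if $\mathsf{RCA}_0+\mathsf{EM}\vdash\mathsf{ADS}$.
   Context: All principles are statements of second order arithmetic; infinite structures have domain $\mathbb{N}$. $\mathsf{RT}^2_2$: every $c:[\mathbb{N}]^2\to\{0,1\}$ has an infinite homogeneous set, i.e. an infinite $H$ with $c$ constant on $[H]^2$. $\mathsf{ADS}$: for every infinite linear order $L=(\mathbb{N},<_L)$ there is an $f:\mathbb{N}\to\mathbb{N}$ with either $f(n)<_L f(m)$ for all $n<m$, or $f(n)>_L f(m)$ for all $n<m$. An infinite tournament is an irreflexive binary relation $T$ on $\mathbb{N}$ such that for all $x\neq y$ exactly one of $T(x,y)$, $T(y,x)$ holds. $\mathsf{EM}$: every infinite tournament $T$ contains an infinite transitive subtournament, i.e. an infinite set $S$ on which the relation $T$ is transitive. -}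

module Defs where

open import Data.Fin.Base using (Fin; zero; suc; lift)
open import Data.List.Base using (List; []; _∷_; map)
open import Data.List.Membership.Propositional using (_∈_)
open import Data.Nat.Base using (ℕ; zero; suc)
open import Function.Base using (id; _∘_)
open import Level using (0ℓ)
open import Relation.Unary using (Pred)

infixl 20 _⊕_
infixl 21 _⊗_
infix  15 _≈_ _≺_ _∊_ _⟨_,_⟩
infix  14 ~_
infixr 13 _∧_
infixr 12 _∨_
infixr 11 _⇒_
infix  10 _⟺_
infix  9  ∀ᴺ_ ∃ᴺ_ ∀ˢ_ ∃ˢ_ ∃!ᴺ_
infix  4  _∣_⊢_ _+_⊢_

-- The two-sorted language L₂ of second order arithmetic, with de Bruijn
-- indices kept separately for the two sorts: `Formula m n` has m free set
-- variables and n free number variables.  As usual, equality is primitive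
-- only between numbers.

data Term (n : ℕ) : Set where
  var     : Fin n → Term n
  𝟎 𝟏     : Term n
  _⊕_ _⊗_ : Term n → Term n → Term n

data Formula (m n : ℕ) : Set where
  _≈_ _≺_     : Term n → Term n → Formula m n
  _∊_         : Term n → Fin m → Formula m n
  falsum      : Formula m n
  _∧_ _∨_ _⇒_ : Formula m n → Formula m n → Formula m n
  ∀ᴺ_ ∃ᴺ_     : Formula m (suc n) → Formula m n
  ∀ˢ_ ∃ˢ_     : Formula (suc m) n → Formula m n

Sentence : Set
Sentence = Formula 0 0

~_ : ∀ {m n} → Formula m n → Formula m n
~ φ = φ ⇒ falsum

_⟺_ : ∀ {m n} → Formula m n → Formula m n → Formula m n
φ ⟺ ψ = (φ ⇒ ψ) ∧ (ψ ⇒ φ)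

-- Simultaneous substitution.  The only set terms are set variables, so on the
-- set sort a substitution is a renaming.

substT : ∀ {n n′} → (Fin n → Term n′) → Term n → Term n′
substT σ (var i) = σ i
substT σ 𝟎       = 𝟎
substT σ 𝟏       = 𝟏
substT σ (s ⊕ t) = substT σ s ⊕ substT σ t
substT σ (s ⊗ t) = substT σ s ⊗ substT σ t

wkT : ∀ {n} → Term n → Term (suc n)
wkT = substT (var ∘ suc)

liftT : ∀ {n n′} → (Fin n → Term n′) → Fin (suc n) → Term (suc n′)
liftT σ zero    = var zero
liftT σ (suc i) = wkT (σ i)

subst : ∀ {m m′ n n′} → (Fin m → Fin m′) → (Fin n → Term n′) →
        Formula m n → Formula m′ n′
subst ρ σ (s ≈ t) = substT σ s ≈ substT σ t
subst ρ σ (s ≺ t) = substT σ s ≺ substT σ t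
subst ρ σ (t ∊ X) = substT σ t ∊ ρ X
subst ρ σ falsum  = falsum
subst ρ σ (φ ∧ ψ) = subst ρ σ φ ∧ subst ρ σ ψ
subst ρ σ (φ ∨ ψ) = subst ρ σ φ ∨ subst ρ σ ψ
subst ρ σ (φ ⇒ ψ) = subst ρ σ φ ⇒ subst ρ σ ψ
subst ρ σ (∀ᴺ φ)  = ∀ᴺ subst ρ (liftT σ) φ
subst ρ σ (∃ᴺ φ)  = ∃ᴺ subst ρ (liftT σ) φ
subst ρ σ (∀ˢ φ)  = ∀ˢ subst (lift 1 ρ) σ φ
subst ρ σ (∃ˢ φ)  = ∃ˢ subst (lift 1 ρ) σ φ

wkᴺ : ∀ {m n} → Formula m n → Formula m (suc n)
wkᴺ = subst id (var ∘ suc)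

wkˢ : ∀ {m n} → Formula m n → Formula (suc m) n
wkˢ = subst suc var

instᴺ : ∀ {n} → Term n → Fin (suc n) → Term n
instᴺ t zero    = t
instᴺ t (suc i) = var i

instˢ : ∀ {m} → Fin m → Fin (suc m) → Fin m
instˢ X zero    = X
instˢ X (suc i) = i

_[_]ᴺ : ∀ {m n} → Formula m (suc n) → Term n → Formula m n
φ [ t ]ᴺ = subst id (instᴺ t) φ

_[_]ˢ : ∀ {m n} → Formula (suc m) n → Fin m → Formula m n
φ [ X ]ˢ = subst (instˢ X) var φ

-- φ(x) ↦ φ(x + 1), where x is the variable with index 0.
succᴺ : ∀ {n} → Fin (suc n) → Term (suc n)
succᴺ zero    = var zero ⊕ 𝟏
succᴺ (suc i) = var (suc i)

_[+1] : ∀ {m n} → Formula m (suc n) → Formula m (suc n)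
φ [+1] = subst id succᴺ φ

∃!ᴺ_ : ∀ {m n} → Formula m (suc n) → Formula m n
∃!ᴺ φ = ∃ᴺ (φ ∧ (∀ᴺ (subst id (liftT (var ∘ suc)) φ ⇒ var zero ≈ var (suc zero))))

-- Set variables may occur free in Δ₀, Σ₁ and Π₁ formulas.  The bound of a
-- bounded quantifier is weakened, so it cannot mention the bound variable.

data Δ₀ {m n : ℕ} : Formula m n → Set where
  eq  : ∀ s t → Δ₀ (s ≈ t)
  lt  : ∀ s t → Δ₀ (s ≺ t)
  mem : ∀ t X → Δ₀ (t ∊ X)
  bot : Δ₀ falsum
  and : ∀ {φ ψ} → Δ₀ φ → Δ₀ ψ → Δ₀ (φ ∧ ψ)
  or  : ∀ {φ ψ} → Δ₀ φ → Δ₀ ψ → Δ₀ (φ ∨ ψ)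
  imp : ∀ {φ ψ} → Δ₀ φ → Δ₀ ψ → Δ₀ (φ ⇒ ψ)
  all : ∀ t {φ} → Δ₀ φ → Δ₀ (∀ᴺ (var zero ≺ wkT t ⇒ φ))
  ex  : ∀ t {φ} → Δ₀ φ → Δ₀ (∃ᴺ (var zero ≺ wkT t ∧ φ))

data Σ₁ {m n : ℕ} : Formula m n → Set where
  ex : ∀ {φ} → Δ₀ φ → Σ₁ (∃ᴺ φ)

data Π₁ {m n : ℕ} : Formula m n → Set where
  all : ∀ {φ} → Δ₀ φ → Π₁ (∀ᴺ φ)

-- A theory gives its axioms in every scope; free variables in an axiom are
-- parameters and stand for universal quantification.
Theory : Set₁
Theory = ∀ m n → Pred (Formula m n) 0ℓ

data RCA₀ (m n : ℕ) : Pred (Formula m n) 0ℓ where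
  suc≢0   : ∀ s     → RCA₀ m n (~ (s ⊕ 𝟏 ≈ 𝟎))
  suc-inj : ∀ s t   → RCA₀ m n (s ⊕ 𝟏 ≈ t ⊕ 𝟏 ⇒ s ≈ t)
  ⊕-zero  : ∀ s     → RCA₀ m n (s ⊕ 𝟎 ≈ s)
  ⊕-suc   : ∀ s t   → RCA₀ m n (s ⊕ (t ⊕ 𝟏) ≈ (s ⊕ t) ⊕ 𝟏)
  ⊗-zero  : ∀ s     → RCA₀ m n (s ⊗ 𝟎 ≈ 𝟎)
  ⊗-suc   : ∀ s t   → RCA₀ m n (s ⊗ (t ⊕ 𝟏) ≈ (s ⊗ t) ⊕ s)
  ≺-zero  : ∀ s     → RCA₀ m n (~ (s ≺ 𝟎))
  ≺-suc   : ∀ s t   → RCA₀ m n (s ≺ t ⊕ 𝟏 ⟺ s ≺ t ∨ s ≈ t)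
  Σ₁-ind  : ∀ {φ} → Σ₁ φ →
            RCA₀ m n (φ [ 𝟎 ]ᴺ ∧ (∀ᴺ (φ ⇒ φ [+1])) ⇒ (∀ᴺ φ))
  Δ₁-comp : ∀ {φ ψ} → Σ₁ φ → Π₁ ψ →
            RCA₀ m n ((∀ᴺ (φ ⟺ ψ)) ⇒ (∃ˢ ∀ᴺ (var zero ∊ zero ⟺ wkˢ φ)))

-- Classical natural deduction; Γ lists the open assumptions.
data _∣_⊢_ (T : Theory) {m n : ℕ} (Γ : List (Formula m n)) : Formula m n → Set where
  axiom  : ∀ {φ} → T m n φ → T ∣ Γ ⊢ φ
  assume : ∀ {φ} → φ ∈ Γ → T ∣ Γ ⊢ φ
  ⇒-I    : ∀ {φ ψ} → T ∣ φ ∷ Γ ⊢ ψ → T ∣ Γ ⊢ φ ⇒ ψ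
  ⇒-E    : ∀ {φ ψ} → T ∣ Γ ⊢ φ ⇒ ψ → T ∣ Γ ⊢ φ → T ∣ Γ ⊢ ψ
  ∧-I    : ∀ {φ ψ} → T ∣ Γ ⊢ φ → T ∣ Γ ⊢ ψ → T ∣ Γ ⊢ φ ∧ ψ
  ∧-E₁   : ∀ {φ ψ} → T ∣ Γ ⊢ φ ∧ ψ → T ∣ Γ ⊢ φ
  ∧-E₂   : ∀ {φ ψ} → T ∣ Γ ⊢ φ ∧ ψ → T ∣ Γ ⊢ ψ
  ∨-I₁   : ∀ {φ ψ} → T ∣ Γ ⊢ φ → T ∣ Γ ⊢ φ ∨ ψ
  ∨-I₂   : ∀ {φ ψ} → T ∣ Γ ⊢ ψ → T ∣ Γ ⊢ φ ∨ ψ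
  ∨-E    : ∀ {φ ψ χ} → T ∣ Γ ⊢ φ ∨ ψ → T ∣ φ ∷ Γ ⊢ χ → T ∣ ψ ∷ Γ ⊢ χ → T ∣ Γ ⊢ χ
  raa    : ∀ {φ} → T ∣ ~ φ ∷ Γ ⊢ falsum → T ∣ Γ ⊢ φ
  ∀ᴺ-I   : ∀ {φ} → T ∣ map wkᴺ Γ ⊢ φ → T ∣ Γ ⊢ ∀ᴺ φ
  ∀ᴺ-E   : ∀ {φ} → T ∣ Γ ⊢ ∀ᴺ φ → ∀ t → T ∣ Γ ⊢ φ [ t ]ᴺ
  ∃ᴺ-I   : ∀ {φ} t → T ∣ Γ ⊢ φ [ t ]ᴺ → T ∣ Γ ⊢ ∃ᴺ φ
  ∃ᴺ-E   : ∀ {φ ψ} → T ∣ Γ ⊢ ∃ᴺ φ → T ∣ φ ∷ map wkᴺ Γ ⊢ wkᴺ ψ → T ∣ Γ ⊢ ψ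
  ∀ˢ-I   : ∀ {φ} → T ∣ map wkˢ Γ ⊢ φ → T ∣ Γ ⊢ ∀ˢ φ
  ∀ˢ-E   : ∀ {φ} → T ∣ Γ ⊢ ∀ˢ φ → ∀ X → T ∣ Γ ⊢ φ [ X ]ˢ
  ∃ˢ-I   : ∀ {φ} X → T ∣ Γ ⊢ φ [ X ]ˢ → T ∣ Γ ⊢ ∃ˢ φ
  ∃ˢ-E   : ∀ {φ ψ} → T ∣ Γ ⊢ ∃ˢ φ → T ∣ φ ∷ map wkˢ Γ ⊢ wkˢ ψ → T ∣ Γ ⊢ ψ
  ≈-refl : ∀ t → T ∣ Γ ⊢ t ≈ t
  ≈-subst : ∀ φ {s t} → T ∣ Γ ⊢ s ≈ t → T ∣ Γ ⊢ φ [ s ]ᴺ → T ∣ Γ ⊢ φ [ t ]ᴺ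

-- Derivability from T with the sentence ψ as an additional axiom.
_+_⊢_ : Theory → Sentence → Sentence → Set
T + ψ ⊢ φ = T ∣ ψ ∷ [] ⊢ φ

-- The usual pairing code (s + t)² + s.
pair : ∀ {n} → Term n → Term n → Term n
pair s t = (s ⊕ t) ⊗ (s ⊕ t) ⊕ s

_⟨_,_⟩ : ∀ {m n} → Fin m → Term n → Term n → Formula m n
R ⟨ s , t ⟩ = pair s t ∊ R

private
  pattern #0 = zero
  pattern #1 = suc zero
  pattern v0 = var zero
  pattern v1 = var (suc zero)
  pattern v2 = var (suc (suc zero))
  pattern v3 = var (suc (suc (suc zero)))

module _ {m n : ℕ} where

  Infinite : Fin m → Formula m n
  Infinite X = ∀ᴺ ∃ᴺ (v1 ≺ v0 ∧ v0 ∊ X)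

  -- R ⊆ ℕ × ℕ
  IsRelation : Fin m → Formula m n
  IsRelation R = ∀ᴺ (v0 ∊ R ⇒ (∃ᴺ ∃ᴺ (v2 ≈ pair v1 v0)))

  Irreflexive : Fin m → Formula m n
  Irreflexive R = ∀ᴺ ~ (R ⟨ v0 , v0 ⟩)

  -- F : ℕ → ℕ, as a graph
  IsFunction : Fin m → Formula m n
  IsFunction F = IsRelation F ∧ (∀ᴺ ∃!ᴺ (F ⟨ v1 , v0 ⟩))

  -- C : [ℕ]² → {0, 1}, as a graph; {x < y} is represented by the code of (x , y)
  IsColouring : Fin m → Formula m n
  IsColouring C =
      (∀ᴺ (v0 ∊ C ⇒
        (∃ᴺ ∃ᴺ ∃ᴺ (v2 ≺ v1 ∧ (v0 ≈ 𝟎 ∨ v0 ≈ 𝟏) ∧ v3 ≈ pair (pair v2 v1) v0))))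
    ∧ (∀ᴺ ∀ᴺ (v1 ≺ v0 ⇒ (∃!ᴺ (C ⟨ pair v2 v1 , v0 ⟩))))

  Homogeneous : (C H : Fin m) → Formula m n
  Homogeneous C H =
    ∃ᴺ ∀ᴺ ∀ᴺ (v1 ∊ H ∧ v0 ∊ H ∧ v1 ≺ v0 ⇒ C ⟨ pair v1 v0 , v2 ⟩)

  TransitiveOn : (R S : Fin m) → Formula m n
  TransitiveOn R S =
    ∀ᴺ ∀ᴺ ∀ᴺ (v2 ∊ S ∧ v1 ∊ S ∧ v0 ∊ S ⇒
      R ⟨ v2 , v1 ⟩ ∧ R ⟨ v1 , v0 ⟩ ⇒ R ⟨ v2 , v0 ⟩)

  IsTournament : Fin m → Formula m n
  IsTournament T =
      IsRelation T ∧ Irreflexive T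
    ∧ (∀ᴺ ∀ᴺ (~ (v1 ≈ v0) ⇒
        (T ⟨ v1 , v0 ⟩ ∨ T ⟨ v0 , v1 ⟩) ∧ ~ (T ⟨ v1 , v0 ⟩ ∧ T ⟨ v0 , v1 ⟩)))

  IsLinearOrder : Fin m → Formula m n
  IsLinearOrder L =
      IsRelation L ∧ Irreflexive L
    ∧ (∀ᴺ ∀ᴺ ∀ᴺ (L ⟨ v2 , v1 ⟩ ∧ L ⟨ v1 , v0 ⟩ ⇒ L ⟨ v2 , v0 ⟩))
    ∧ (∀ᴺ ∀ᴺ (v1 ≈ v0 ∨ L ⟨ v1 , v0 ⟩ ∨ L ⟨ v0 , v1 ⟩))

  -- In the scope of the four quantifiers, v3 < v2 are arguments of F, with
  -- values v1 and v0.
  Ascending : (L F : Fin m) → Formula m n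
  Ascending L F =
    ∀ᴺ ∀ᴺ ∀ᴺ ∀ᴺ (v3 ≺ v2 ∧ F ⟨ v3 , v1 ⟩ ∧ F ⟨ v2 , v0 ⟩ ⇒ L ⟨ v1 , v0 ⟩)

  Descending : (L F : Fin m) → Formula m n
  Descending L F =
    ∀ᴺ ∀ᴺ ∀ᴺ ∀ᴺ (v3 ≺ v2 ∧ F ⟨ v3 , v1 ⟩ ∧ F ⟨ v2 , v0 ⟩ ⇒ L ⟨ v0 , v1 ⟩)

RT²₂ : Sentence
RT²₂ = ∀ˢ (IsColouring #0 ⇒ (∃ˢ (Infinite #0 ∧ Homogeneous #1 #0)))

ADS : Sentence
ADS = ∀ˢ (IsLinearOrder #0 ⇒
  (∃ˢ (IsFunction #0 ∧ (Ascending #1 #0 ∨ Descending #1 #0))))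

EM : Sentence
EM = ∀ˢ (IsTournament #0 ⇒ (∃ˢ (Infinite #0 ∧ TransitiveOn #1 #0)))

{-# OPTIONS --safe #-}
-- Both implications follow from derivations in RCA₀ of RT²₂ → ADS and of EM ∧ ADS → RT²₂.
-- These are obtained from a completeness theorem for structures in which falsum is an
-- arbitrary truth value A and ∨, ∃ are read through double negation (Krivine).  The Henkin
-- construction is constructive for such structures: A says that the theory is inconsistent,
-- and a formula is admitted when its refutability would imply A.
--
-- Inside a model, RT²₂ → ADS colours {x < y} by whether x <_L y and enumerates an infinite
-- homogeneous set; the enumeration is an iteration, for which finite sequences are coded by
-- divisibility.  For EM ∧ ADS → RT²₂, direct the edge {x < y} upwards or downwards according
-- to its colour, enumerate an infinite transitive set X in increasing order, and pull the
-- order on X back to ℕ.  ADS gives a monotone sequence f, which is injective, hence (by ADS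
-- once more) unbounded.  The values of f at its records are increasing both in ℕ and along
-- f, so they index a homogeneous set.
module Submission where

open import Defs
open import Function.Bundles using (_⇔_; mk⇔)
open import Algebra.Bundles using (CommutativeSemiring)
import Algebra.Solver.Ring.NaturalCoefficients.Default as NaturalSolver
open import Data.Empty using (⊥-elim)
open import Data.Fin.Base using (Fin; zero; suc; lift)
open import Data.List.Base using (List; []; _∷_; map; concat; cartesianProductWith; allFin; length)
open import Data.List.Membership.Propositional using (_∈_)
open import Data.List.Membership.Propositional.Properties
  using (∈-map⁺; ∈-concat⁺′; ∈-cartesianProductWith⁺; ∈-allFin)
open import Data.List.Properties using (map-∘; map-cong; length-map)
open import Data.List.Relation.Binary.Subset.Propositional using (_⊆_)
open import Data.List.Relation.Binary.Subset.Propositional.Properties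
  using (map⁺; ∷⁺ʳ; xs⊆xs++ys; xs⊆ys++xs)
open import Data.List.Relation.Unary.All using (All; []; _∷_; lookup) renaming (map to mapAll)
open import Data.List.Relation.Unary.All.Properties using (++⁺)
open import Data.List.Relation.Unary.Any using (here; there)
open import Data.Nat.Base using (ℕ; zero; suc; _≤′_; ≤′-reflexive; ≤′-step; _⊔_; s≤s; z≤n)
  renaming (_≤_ to _≤ⁿ_)
open import Data.Nat.Properties
  using (m≤n⇒m≤1+n; m⊔n≤o⇒m≤o; m⊔n≤o⇒n≤o; m≤m⊔n; m≤n⊔m; ≤⇒≤′; ≤′⇒≤)
  renaming (≤-refl to ≤ⁿ-refl; ≤-trans to ≤ⁿ-trans; ≤-reflexive to ≤ⁿ-reflexive; <⇒≢ to <ⁿ⇒≢; _≟_ to _≟ℕ_)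
open import Data.Product.Base using (Σ; Σ-syntax; _×_; _,_; proj₁; proj₂)
open import Data.Sum.Base using (_⊎_; inj₁; inj₂; [_,_]′)
open import Function.Base using (id; _∘_; case_of_)
open import Relation.Nullary using (yes; no)
open import Relation.Binary.PropositionalEquality as ≡
  using (_≡_; refl; sym; trans; cong; cong₂; _≗_) renaming (subst to transport; subst₂ to transport₂)

-- Writing natural deductions over de Bruijn syntax is impractical for arguments with enumerations
-- and coded sequences, hence the detour through models. The metatheory is constructive while the
-- object logic is classical: whether a formula is consistent with a theory cannot be decided, so
-- the completion cannot proceed by cases. The language has no spare constants, so Henkin constants
-- are free variables, and a name is a family of terms over all stages that eventually changes by
-- weakening only.
--
-- Passing from a monotone sequence to a homogeneous set is delicate because a colour belongs to a
-- pair in its numerical order. Monotonicity fixes the direction of the edge between an earlier and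
-- a later value, but not which of the two is the larger number. Records are values for which
-- position and size agree, and unboundedness of the sequence is what makes them infinite in number.

private variable
  m m′ n n′ : ℕ

-- The algebra of substitutions.

substT-cong : ∀ {n n′} {σ τ : Fin n → Term n′} → σ ≗ τ → substT σ ≗ substT τ
substT-cong e (var i) = e i
substT-cong e 𝟎       = refl
substT-cong e 𝟏       = refl
substT-cong e (s ⊕ t) = cong₂ _⊕_ (substT-cong e s) (substT-cong e t)
substT-cong e (s ⊗ t) = cong₂ _⊗_ (substT-cong e s) (substT-cong e t)

substT-var : ∀ {n} (t : Term n) → substT var t ≡ t
substT-var (var i) = refl
substT-var 𝟎       = refl
substT-var 𝟏       = refl
substT-var (s ⊕ t) = cong₂ _⊕_ (substT-var s) (substT-var t)
substT-var (s ⊗ t) = cong₂ _⊗_ (substT-var s) (substT-var t)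

substT-∘ : ∀ {n n′ n″} (τ : Fin n′ → Term n″) (σ : Fin n → Term n′) t →
           substT τ (substT σ t) ≡ substT (substT τ ∘ σ) t
substT-∘ τ σ (var i) = refl
substT-∘ τ σ 𝟎       = refl
substT-∘ τ σ 𝟏       = refl
substT-∘ τ σ (s ⊕ t) = cong₂ _⊕_ (substT-∘ τ σ s) (substT-∘ τ σ t)
substT-∘ τ σ (s ⊗ t) = cong₂ _⊗_ (substT-∘ τ σ s) (substT-∘ τ σ t)

liftT-cong : ∀ {n n′} {σ τ : Fin n → Term n′} → σ ≗ τ → liftT σ ≗ liftT τ
liftT-cong e zero    = refl
liftT-cong e (suc i) = cong wkT (e i)

lift-cong : ∀ {m m′} {ρ π : Fin m → Fin m′} → ρ ≗ π → lift 1 ρ ≗ lift 1 π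
lift-cong e zero    = refl
lift-cong e (suc i) = cong suc (e i)

liftT-wkT : ∀ {n n′} (σ : Fin n → Term n′) t → substT (liftT σ) (wkT t) ≡ wkT (substT σ t)
liftT-wkT σ t = trans (substT-∘ _ _ t) (sym (substT-∘ _ σ t))

liftT-∘ : ∀ {n n′ n″} (τ : Fin n′ → Term n″) (σ : Fin n → Term n′) →
          substT (liftT τ) ∘ liftT σ ≗ liftT (substT τ ∘ σ)
liftT-∘ τ σ zero    = refl
liftT-∘ τ σ (suc i) = liftT-wkT τ (σ i)

lift-∘ : ∀ {m m′ m″} (π : Fin m′ → Fin m″) (ρ : Fin m → Fin m′) →
         lift 1 π ∘ lift 1 ρ ≗ lift 1 (π ∘ ρ)
lift-∘ π ρ zero    = refl
lift-∘ π ρ (suc i) = refl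

subst-cong : ∀ {m m′ n n′} {ρ π : Fin m → Fin m′} {σ τ : Fin n → Term n′} →
             ρ ≗ π → σ ≗ τ → subst ρ σ ≗ subst π τ
subst-cong e f (s ≈ t) = cong₂ _≈_ (substT-cong f s) (substT-cong f t)
subst-cong e f (s ≺ t) = cong₂ _≺_ (substT-cong f s) (substT-cong f t)
subst-cong e f (t ∊ X) = cong₂ _∊_ (substT-cong f t) (e X)
subst-cong e f falsum  = refl
subst-cong e f (φ ∧ ψ) = cong₂ _∧_ (subst-cong e f φ) (subst-cong e f ψ)
subst-cong e f (φ ∨ ψ) = cong₂ _∨_ (subst-cong e f φ) (subst-cong e f ψ)
subst-cong e f (φ ⇒ ψ) = cong₂ _⇒_ (subst-cong e f φ) (subst-cong e f ψ)
subst-cong e f (∀ᴺ φ)  = cong ∀ᴺ_ (subst-cong e (liftT-cong f) φ)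
subst-cong e f (∃ᴺ φ)  = cong ∃ᴺ_ (subst-cong e (liftT-cong f) φ)
subst-cong e f (∀ˢ φ)  = cong ∀ˢ_ (subst-cong (lift-cong e) f φ)
subst-cong e f (∃ˢ φ)  = cong ∃ˢ_ (subst-cong (lift-cong e) f φ)

liftT-var : ∀ {n} → liftT (var {n}) ≗ var
liftT-var zero    = refl
liftT-var (suc i) = refl

lift-id : ∀ {m} → lift 1 (id {A = Fin m}) ≗ id
lift-id zero    = refl
lift-id (suc i) = refl

subst-id : ∀ {m n} (φ : Formula m n) → subst id var φ ≡ φ
subst-id (s ≈ t) = cong₂ _≈_ (substT-var s) (substT-var t)
subst-id (s ≺ t) = cong₂ _≺_ (substT-var s) (substT-var t)
subst-id (t ∊ X) = cong (_∊ X) (substT-var t)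
subst-id falsum  = refl
subst-id (φ ∧ ψ) = cong₂ _∧_ (subst-id φ) (subst-id ψ)
subst-id (φ ∨ ψ) = cong₂ _∨_ (subst-id φ) (subst-id ψ)
subst-id (φ ⇒ ψ) = cong₂ _⇒_ (subst-id φ) (subst-id ψ)
subst-id (∀ᴺ φ)  = cong ∀ᴺ_ (trans (subst-cong (λ _ → refl) liftT-var φ) (subst-id φ))
subst-id (∃ᴺ φ)  = cong ∃ᴺ_ (trans (subst-cong (λ _ → refl) liftT-var φ) (subst-id φ))
subst-id (∀ˢ φ)  = cong ∀ˢ_ (trans (subst-cong lift-id (λ _ → refl) φ) (subst-id φ))
subst-id (∃ˢ φ)  = cong ∃ˢ_ (trans (subst-cong lift-id (λ _ → refl) φ) (subst-id φ))

subst-∘ : ∀ {m m′ m″ n n′ n″} (π : Fin m′ → Fin m″) (τ : Fin n′ → Term n″)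
          (ρ : Fin m → Fin m′) (σ : Fin n → Term n′) φ →
          subst π τ (subst ρ σ φ) ≡ subst (π ∘ ρ) (substT τ ∘ σ) φ
subst-∘ π τ ρ σ (s ≈ t) = cong₂ _≈_ (substT-∘ τ σ s) (substT-∘ τ σ t)
subst-∘ π τ ρ σ (s ≺ t) = cong₂ _≺_ (substT-∘ τ σ s) (substT-∘ τ σ t)
subst-∘ π τ ρ σ (t ∊ X) = cong (_∊ π (ρ X)) (substT-∘ τ σ t)
subst-∘ π τ ρ σ falsum  = refl
subst-∘ π τ ρ σ (φ ∧ ψ) = cong₂ _∧_ (subst-∘ π τ ρ σ φ) (subst-∘ π τ ρ σ ψ)
subst-∘ π τ ρ σ (φ ∨ ψ) = cong₂ _∨_ (subst-∘ π τ ρ σ φ) (subst-∘ π τ ρ σ ψ)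
subst-∘ π τ ρ σ (φ ⇒ ψ) = cong₂ _⇒_ (subst-∘ π τ ρ σ φ) (subst-∘ π τ ρ σ ψ)
subst-∘ π τ ρ σ (∀ᴺ φ)  = cong ∀ᴺ_ (trans (subst-∘ π (liftT τ) ρ (liftT σ) φ) (subst-cong (λ _ → refl) (liftT-∘ τ σ) φ))
subst-∘ π τ ρ σ (∃ᴺ φ)  = cong ∃ᴺ_ (trans (subst-∘ π (liftT τ) ρ (liftT σ) φ) (subst-cong (λ _ → refl) (liftT-∘ τ σ) φ))
subst-∘ π τ ρ σ (∀ˢ φ)  = cong ∀ˢ_ (trans (subst-∘ (lift 1 π) τ (lift 1 ρ) σ φ) (subst-cong (lift-∘ π ρ) (λ _ → refl) φ))
subst-∘ π τ ρ σ (∃ˢ φ)  = cong ∃ˢ_ (trans (subst-∘ (lift 1 π) τ (lift 1 ρ) σ φ) (subst-cong (lift-∘ π ρ) (λ _ → refl) φ))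

-- Two composites of substitutions that agree pointwise commute past a formula.
subst-square : ∀ {m m₁ m₂ m′ n n₁ n₂ n′}
  {π : Fin m₁ → Fin m′} {τ : Fin n₁ → Term n′} {ρ : Fin m → Fin m₁} {σ : Fin n → Term n₁}
  {π′ : Fin m₂ → Fin m′} {τ′ : Fin n₂ → Term n′} {ρ′ : Fin m → Fin m₂} {σ′ : Fin n → Term n₂} →
  π ∘ ρ ≗ π′ ∘ ρ′ → substT τ ∘ σ ≗ substT τ′ ∘ σ′ →
  ∀ φ → subst π τ (subst ρ σ φ) ≡ subst π′ τ′ (subst ρ′ σ′ φ)
subst-square e f φ = trans (subst-∘ _ _ _ _ φ) (trans (subst-cong e f φ) (sym (subst-∘ _ _ _ _ φ)))

subst-wkᴺ : (ρ : Fin m → Fin m′) (σ : Fin n → Term n′) (φ : Formula m n) →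
            subst ρ (liftT σ) (wkᴺ φ) ≡ wkᴺ (subst ρ σ φ)
subst-wkᴺ ρ σ = subst-square (λ _ → refl) (λ _ → refl)

subst-wkˢ : (ρ : Fin m → Fin m′) (σ : Fin n → Term n′) (φ : Formula m n) →
            subst (lift 1 ρ) σ (wkˢ φ) ≡ wkˢ (subst ρ σ φ)
subst-wkˢ ρ σ = subst-square (λ _ → refl) (λ i → sym (substT-var (σ i)))

instᴺ-wkT : (t s : Term n) → substT (instᴺ t) (wkT s) ≡ s
instᴺ-wkT t s = trans (substT-∘ _ _ s) (substT-var s)

subst-instᴺ : (ρ : Fin m → Fin m′) (σ : Fin n → Term n′) (φ : Formula m (suc n)) (t : Term n) →
              subst ρ σ (φ [ t ]ᴺ) ≡ subst ρ (liftT σ) φ [ substT σ t ]ᴺ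
subst-instᴺ ρ σ φ t = subst-square (λ _ → refl) agree φ
  where
  agree : substT σ ∘ instᴺ t ≗ substT (instᴺ (substT σ t)) ∘ liftT σ
  agree zero    = refl
  agree (suc i) = sym (instᴺ-wkT _ (σ i))

subst-instˢ : (ρ : Fin m → Fin m′) (σ : Fin n → Term n′) (φ : Formula (suc m) n) (X : Fin m) →
              subst ρ σ (φ [ X ]ˢ) ≡ subst (lift 1 ρ) σ φ [ ρ X ]ˢ
subst-instˢ ρ σ φ X = subst-square agree (λ i → sym (substT-var (σ i))) φ
  where
  agree : ρ ∘ instˢ X ≗ instˢ (ρ X) ∘ lift 1 ρ
  agree zero    = refl
  agree (suc i) = refl

subst-[+1] : (ρ : Fin m → Fin m′) (σ : Fin n → Term n′) (φ : Formula m (suc n)) →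
             subst ρ (liftT σ) (φ [+1]) ≡ subst ρ (liftT σ) φ [+1]
subst-[+1] ρ σ = subst-square (λ _ → refl) agree
  where
  agree : substT (liftT σ) ∘ succᴺ ≗ substT succᴺ ∘ liftT σ
  agree zero    = refl
  agree (suc i) = sym (substT-∘ _ _ (σ i))

wkᴺ-inst : (φ : Formula m n) (t : Term n) → wkᴺ φ [ t ]ᴺ ≡ φ
wkᴺ-inst φ t = trans (subst-∘ _ _ _ _ φ) (subst-id φ)

wkˢ-inst : (φ : Formula m n) (X : Fin m) → wkˢ φ [ X ]ˢ ≡ φ
wkˢ-inst φ X = trans (subst-∘ _ _ _ _ φ) (subst-id φ)

-- Closure of formula classes, axioms and derivations under substitution.

subst-Δ₀ : (ρ : Fin m → Fin m′) (σ : Fin n → Term n′) {φ : Formula m n} → Δ₀ φ → Δ₀ (subst ρ σ φ)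
subst-Δ₀ ρ σ (eq s t)  = eq _ _
subst-Δ₀ ρ σ (lt s t)  = lt _ _
subst-Δ₀ ρ σ (mem t X) = mem _ _
subst-Δ₀ ρ σ bot       = bot
subst-Δ₀ ρ σ (and p q) = and (subst-Δ₀ ρ σ p) (subst-Δ₀ ρ σ q)
subst-Δ₀ ρ σ (or p q)  = or (subst-Δ₀ ρ σ p) (subst-Δ₀ ρ σ q)
subst-Δ₀ ρ σ (imp p q) = imp (subst-Δ₀ ρ σ p) (subst-Δ₀ ρ σ q)
subst-Δ₀ ρ σ (all t p) rewrite liftT-wkT σ t = all (substT σ t) (subst-Δ₀ ρ (liftT σ) p)
subst-Δ₀ ρ σ (ex t p)  rewrite liftT-wkT σ t = ex (substT σ t) (subst-Δ₀ ρ (liftT σ) p)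

subst-Σ₁ : (ρ : Fin m → Fin m′) (σ : Fin n → Term n′) {φ : Formula m n} → Σ₁ φ → Σ₁ (subst ρ σ φ)
subst-Σ₁ ρ σ (ex p) = ex (subst-Δ₀ ρ (liftT σ) p)

subst-Π₁ : (ρ : Fin m → Fin m′) (σ : Fin n → Term n′) {φ : Formula m n} → Π₁ φ → Π₁ (subst ρ σ φ)
subst-Π₁ ρ σ (all p) = all (subst-Δ₀ ρ (liftT σ) p)

subst-RCA₀ : (ρ : Fin m → Fin m′) (σ : Fin n → Term n′) {φ : Formula m n} →
             RCA₀ m n φ → RCA₀ m′ n′ (subst ρ σ φ)
subst-RCA₀ ρ σ (suc≢0 s)     = suc≢0 _
subst-RCA₀ ρ σ (suc-inj s t) = suc-inj _ _
subst-RCA₀ ρ σ (⊕-zero s)    = ⊕-zero _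
subst-RCA₀ ρ σ (⊕-suc s t)   = ⊕-suc _ _
subst-RCA₀ ρ σ (⊗-zero s)    = ⊗-zero _
subst-RCA₀ ρ σ (⊗-suc s t)   = ⊗-suc _ _
subst-RCA₀ ρ σ (≺-zero s)    = ≺-zero _
subst-RCA₀ ρ σ (≺-suc s t)   = ≺-suc _ _
subst-RCA₀ ρ σ (Σ₁-ind {φ} p)
  rewrite subst-instᴺ ρ σ φ 𝟎 | subst-[+1] ρ σ φ = Σ₁-ind (subst-Σ₁ ρ (liftT σ) p)
subst-RCA₀ ρ σ (Δ₁-comp {φ} p q)
  rewrite subst-wkˢ ρ (liftT σ) φ = Δ₁-comp (subst-Σ₁ ρ (liftT σ) p) (subst-Π₁ ρ (liftT σ) q)

weaken : ∀ {T m n} {Γ Δ : List (Formula m n)} {φ} → Γ ⊆ Δ → T ∣ Γ ⊢ φ → T ∣ Δ ⊢ φ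
weaken s (axiom a)       = axiom a
weaken s (assume x)      = assume (s x)
weaken s (⇒-I d)         = ⇒-I (weaken (∷⁺ʳ _ s) d)
weaken s (⇒-E d e)       = ⇒-E (weaken s d) (weaken s e)
weaken s (∧-I d e)       = ∧-I (weaken s d) (weaken s e)
weaken s (∧-E₁ d)        = ∧-E₁ (weaken s d)
weaken s (∧-E₂ d)        = ∧-E₂ (weaken s d)
weaken s (∨-I₁ d)        = ∨-I₁ (weaken s d)
weaken s (∨-I₂ d)        = ∨-I₂ (weaken s d)
weaken s (∨-E d e f)     = ∨-E (weaken s d) (weaken (∷⁺ʳ _ s) e) (weaken (∷⁺ʳ _ s) f)
weaken s (raa d)         = raa (weaken (∷⁺ʳ _ s) d)
weaken s (∀ᴺ-I d)        = ∀ᴺ-I (weaken (map⁺ _ s) d)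
weaken s (∀ᴺ-E d t)      = ∀ᴺ-E (weaken s d) t
weaken s (∃ᴺ-I t d)      = ∃ᴺ-I t (weaken s d)
weaken s (∃ᴺ-E d e)      = ∃ᴺ-E (weaken s d) (weaken (∷⁺ʳ _ (map⁺ _ s)) e)
weaken s (∀ˢ-I d)        = ∀ˢ-I (weaken (map⁺ _ s) d)
weaken s (∀ˢ-E d X)      = ∀ˢ-E (weaken s d) X
weaken s (∃ˢ-I X d)      = ∃ˢ-I X (weaken s d)
weaken s (∃ˢ-E d e)      = ∃ˢ-E (weaken s d) (weaken (∷⁺ʳ _ (map⁺ _ s)) e)
weaken s (≈-refl t)      = ≈-refl t
weaken s (≈-subst φ d e) = ≈-subst φ (weaken s d) (weaken s e)

-- What allows Henkin constants to be free variables: axioms survive the passage to a larger scope.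
Substitutive : Theory → Set
Substitutive T = ∀ {m m′ n n′} (ρ : Fin m → Fin m′) (σ : Fin n → Term n′) {φ} →
                 T m n φ → T m′ n′ (subst ρ σ φ)

private
  map-square : ∀ {A B B′ C : Set} {f : A → B} {g : B → C} {f′ : A → B′} {g′ : B′ → C} →
               g ∘ f ≗ g′ ∘ f′ → ∀ xs → map g (map f xs) ≡ map g′ (map f′ xs)
  map-square e xs = trans (sym (map-∘ xs)) (trans (map-cong e xs) (map-∘ xs))

subst-⊢ : ∀ {T} → Substitutive T → ∀ {m m′ n n′} (ρ : Fin m → Fin m′) (σ : Fin n → Term n′) {Γ φ} →
          T ∣ Γ ⊢ φ → T ∣ map (subst ρ σ) Γ ⊢ subst ρ σ φ
subst-⊢ {T} c = go
  where
  go : ∀ {m m′ n n′} (ρ : Fin m → Fin m′) (σ : Fin n → Term n′) {Γ φ} →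
       T ∣ Γ ⊢ φ → T ∣ map (subst ρ σ) Γ ⊢ subst ρ σ φ
  go ρ σ (axiom a)   = axiom (c ρ σ a)
  go ρ σ (assume x)  = assume (∈-map⁺ _ x)
  go ρ σ (⇒-I d)     = ⇒-I (go ρ σ d)
  go ρ σ (⇒-E d e)   = ⇒-E (go ρ σ d) (go ρ σ e)
  go ρ σ (∧-I d e)   = ∧-I (go ρ σ d) (go ρ σ e)
  go ρ σ (∧-E₁ d)    = ∧-E₁ (go ρ σ d)
  go ρ σ (∧-E₂ d)    = ∧-E₂ (go ρ σ d)
  go ρ σ (∨-I₁ d)    = ∨-I₁ (go ρ σ d)
  go ρ σ (∨-I₂ d)    = ∨-I₂ (go ρ σ d)
  go ρ σ (∨-E d e f) = ∨-E (go ρ σ d) (go ρ σ e) (go ρ σ f)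
  go ρ σ (raa d)     = raa (go ρ σ d)
  go ρ σ (∀ᴺ-I {φ} d) =
    ∀ᴺ-I (transport (T ∣_⊢ _) (map-square (subst-wkᴺ ρ σ) _) (go ρ (liftT σ) d))
  go ρ σ (∀ᴺ-E {φ} d t) = transport (T ∣ _ ⊢_) (sym (subst-instᴺ ρ σ φ t)) (∀ᴺ-E (go ρ σ d) (substT σ t))
  go ρ σ (∃ᴺ-I {φ} t d) = ∃ᴺ-I (substT σ t) (transport (T ∣ _ ⊢_) (subst-instᴺ ρ σ φ t) (go ρ σ d))
  go ρ σ (∃ᴺ-E {ψ = ψ} d e) =
    ∃ᴺ-E (go ρ σ d) (transport₂ (T ∣_⊢_) (cong (_ ∷_) (map-square (subst-wkᴺ ρ σ) _)) (subst-wkᴺ ρ σ ψ)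
                                (go ρ (liftT σ) e))
  go ρ σ (∀ˢ-I d) =
    ∀ˢ-I (transport (T ∣_⊢ _) (map-square (subst-wkˢ ρ σ) _) (go (lift 1 ρ) σ d))
  go ρ σ (∀ˢ-E {φ} d X) = transport (T ∣ _ ⊢_) (sym (subst-instˢ ρ σ φ X)) (∀ˢ-E (go ρ σ d) (ρ X))
  go ρ σ (∃ˢ-I {φ} X d) = ∃ˢ-I (ρ X) (transport (T ∣ _ ⊢_) (subst-instˢ ρ σ φ X) (go ρ σ d))
  go ρ σ (∃ˢ-E {ψ = ψ} d e) =
    ∃ˢ-E (go ρ σ d) (transport₂ (T ∣_⊢_) (cong (_ ∷_) (map-square (subst-wkˢ ρ σ) _)) (subst-wkˢ ρ σ ψ)
                                (go (lift 1 ρ) σ e))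
  go ρ σ (≈-refl t) = ≈-refl _
  go ρ σ (≈-subst φ {s} {t} d e) = transport (T ∣ _ ⊢_) (sym (subst-instᴺ ρ σ φ t))
    (≈-subst (subst ρ (liftT σ) φ) (go ρ σ d) (transport (T ∣ _ ⊢_) (subst-instᴺ ρ σ φ s) (go ρ σ e)))

-- Structures, models and truth.

infixr 5 _▹_

∅ : {A : Set} → Fin 0 → A
∅ ()

_▹_ : ∀ {A : Set} {n} → A → (Fin n → A) → Fin (suc n) → A
(a ▹ ρ) zero    = a
(a ▹ ρ) (suc i) = ρ i

-- Structures with a truth value A for falsum, read through the negative translation.
record Structure : Set₁ where
  infix 4 _≐_ _<_ _∈ˢ_
  infixl 6 _+_
  infixl 7 _*_
  field
    A D S    : Set
    _≐_ _<_  : D → D → Set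
    _∈ˢ_     : D → S → Set
    0# 1#    : D
    _+_ _*_  : D → D → D

  M : Set → Set
  M X = (X → A) → A

  ⟦_⟧ᵗ : ∀ {n} → Term n → (Fin n → D) → D
  ⟦ var i ⟧ᵗ ρ = ρ i
  ⟦ 𝟎 ⟧ᵗ     ρ = 0#
  ⟦ 𝟏 ⟧ᵗ     ρ = 1#
  ⟦ s ⊕ t ⟧ᵗ ρ = ⟦ s ⟧ᵗ ρ + ⟦ t ⟧ᵗ ρ
  ⟦ s ⊗ t ⟧ᵗ ρ = ⟦ s ⟧ᵗ ρ * ⟦ t ⟧ᵗ ρ

  ⟦_⟧ : ∀ {m n} → Formula m n → (Fin m → S) → (Fin n → D) → Set
  ⟦ s ≈ t ⟧  σ ρ = ⟦ s ⟧ᵗ ρ ≐ ⟦ t ⟧ᵗ ρ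
  ⟦ s ≺ t ⟧  σ ρ = ⟦ s ⟧ᵗ ρ < ⟦ t ⟧ᵗ ρ
  ⟦ t ∊ X ⟧  σ ρ = ⟦ t ⟧ᵗ ρ ∈ˢ σ X
  ⟦ falsum ⟧ σ ρ = A
  ⟦ φ ∧ ψ ⟧  σ ρ = ⟦ φ ⟧ σ ρ × ⟦ ψ ⟧ σ ρ
  ⟦ φ ∨ ψ ⟧  σ ρ = M (⟦ φ ⟧ σ ρ ⊎ ⟦ ψ ⟧ σ ρ)
  ⟦ φ ⇒ ψ ⟧  σ ρ = ⟦ φ ⟧ σ ρ → ⟦ ψ ⟧ σ ρ
  ⟦ ∀ᴺ φ ⟧   σ ρ = ∀ d → ⟦ φ ⟧ σ (d ▹ ρ)
  ⟦ ∃ᴺ φ ⟧   σ ρ = M (Σ[ d ∈ D ] ⟦ φ ⟧ σ (d ▹ ρ))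
  ⟦ ∀ˢ φ ⟧   σ ρ = ∀ X → ⟦ φ ⟧ (X ▹ σ) ρ
  ⟦ ∃ˢ φ ⟧   σ ρ = M (Σ[ X ∈ S ] ⟦ φ ⟧ (X ▹ σ) ρ)

-- Truth of all theorems is a field, rather than truth of the axioms: this replaces a soundness
-- theorem, and the Henkin model obtains it from its truth lemma. Stability is asked of atoms only,
-- since it passes to compound formulas.
record Model (T : Theory) : Set₁ where
  field
    structure : Structure
  open Structure structure public
  field
    stable-≐ : ∀ {x y} → M (x ≐ y) → x ≐ y
    stable-< : ∀ {x y} → M (x < y) → x < y
    stable-∈ : ∀ {x X} → M (x ∈ˢ X) → x ∈ˢ X
    sound    : ∀ {m n} {φ : Formula m n} → T ∣ [] ⊢ φ → ∀ σ ρ → ⟦ φ ⟧ σ ρ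

infix 4 _⊨_
_⊨_ : ∀ {T} → Model T → Sentence → Set
𝔐 ⊨ φ = Model.⟦_⟧ 𝔐 φ ∅ ∅

-- Enumeration of formulas by depth.

depthᵗ : Term n → ℕ
depthᵗ (var i) = 1
depthᵗ 𝟎       = 1
depthᵗ 𝟏       = 1
depthᵗ (s ⊕ t) = suc (depthᵗ s ⊔ depthᵗ t)
depthᵗ (s ⊗ t) = suc (depthᵗ s ⊔ depthᵗ t)

depth : Formula m n → ℕ
depth (s ≈ t) = suc (depthᵗ s ⊔ depthᵗ t)
depth (s ≺ t) = suc (depthᵗ s ⊔ depthᵗ t)
depth (t ∊ X) = suc (depthᵗ t)
depth falsum  = 1
depth (φ ∧ ψ) = suc (depth φ ⊔ depth ψ)
depth (φ ∨ ψ) = suc (depth φ ⊔ depth ψ)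
depth (φ ⇒ ψ) = suc (depth φ ⊔ depth ψ)
depth (∀ᴺ φ)  = suc (depth φ)
depth (∃ᴺ φ)  = suc (depth φ)
depth (∀ˢ φ)  = suc (depth φ)
depth (∃ˢ φ)  = suc (depth φ)

terms    : ℕ → ∀ n → List (Term n)
termRows : ℕ → ∀ n → List (List (Term n))
terms zero    n = []
terms (suc d) n = concat (termRows d n)
termRows d n =
  ( (𝟎 ∷ 𝟏 ∷ [])
  ∷ map var (allFin n)
  ∷ cartesianProductWith _⊕_ (terms d n) (terms d n)
  ∷ cartesianProductWith _⊗_ (terms d n) (terms d n)
  ∷ [])

formulas    : ℕ → ∀ m n → List (Formula m n)
formulaRows : ℕ → ∀ m n → List (List (Formula m n))
formulas zero    m n = []
formulas (suc d) m n = concat (formulaRows d m n)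
formulaRows d m n =
  ( (falsum ∷ [])
  ∷ cartesianProductWith _≈_ (terms d n) (terms d n)
  ∷ cartesianProductWith _≺_ (terms d n) (terms d n)
  ∷ cartesianProductWith _∊_ (terms d n) (allFin m)
  ∷ cartesianProductWith _∧_ (formulas d m n) (formulas d m n)
  ∷ cartesianProductWith _∨_ (formulas d m n) (formulas d m n)
  ∷ cartesianProductWith _⇒_ (formulas d m n) (formulas d m n)
  ∷ map ∀ᴺ_ (formulas d m (suc n))
  ∷ map ∃ᴺ_ (formulas d m (suc n))
  ∷ map ∀ˢ_ (formulas d (suc m) n)
  ∷ map ∃ˢ_ (formulas d (suc m) n)
  ∷ [])

private
  pattern at0 = here refl
  pattern at1 = there at0
  pattern at2 = there at1
  pattern at3 = there at2
  pattern at4 = there at3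
  pattern at5 = there at4
  pattern at6 = there at5
  pattern at7 = there at6
  pattern at8 = there at7
  pattern at9 = there at8
  pattern at10 = there at9

∈-terms : (t : Term n) → ∀ {d} → depthᵗ t ≤ⁿ d → t ∈ terms d n
∈-terms (var i) {suc d} (s≤s _) = ∈-concat⁺′ {xss = termRows d _} (∈-map⁺ var (∈-allFin i)) at1
∈-terms 𝟎       {suc d} (s≤s _) = ∈-concat⁺′ {xss = termRows d _} at0 at0
∈-terms 𝟏       {suc d} (s≤s _) = ∈-concat⁺′ {xss = termRows d _} at1 at0
∈-terms (s ⊕ t) {suc d} (s≤s p) = ∈-concat⁺′ {xss = termRows d _} (∈-cartesianProductWith⁺ _⊕_
  (∈-terms s (m⊔n≤o⇒m≤o _ _ p)) (∈-terms t (m⊔n≤o⇒n≤o _ _ p))) at2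
∈-terms (s ⊗ t) {suc d} (s≤s p) = ∈-concat⁺′ {xss = termRows d _} (∈-cartesianProductWith⁺ _⊗_
  (∈-terms s (m⊔n≤o⇒m≤o _ _ p)) (∈-terms t (m⊔n≤o⇒n≤o _ _ p))) at3

∈-formulas : (φ : Formula m n) → ∀ {d} → depth φ ≤ⁿ d → φ ∈ formulas d m n
∈-formulas (s ≈ t) {suc d} (s≤s p) = ∈-concat⁺′ {xss = formulaRows d _ _} (∈-cartesianProductWith⁺ _≈_
  (∈-terms s (m⊔n≤o⇒m≤o _ _ p)) (∈-terms t (m⊔n≤o⇒n≤o _ _ p))) at1
∈-formulas (s ≺ t) {suc d} (s≤s p) = ∈-concat⁺′ {xss = formulaRows d _ _} (∈-cartesianProductWith⁺ _≺_
  (∈-terms s (m⊔n≤o⇒m≤o _ _ p)) (∈-terms t (m⊔n≤o⇒n≤o _ _ p))) at2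
∈-formulas (t ∊ X) {suc d} (s≤s p) = ∈-concat⁺′ {xss = formulaRows d _ _} (∈-cartesianProductWith⁺ _∊_ (∈-terms t p) (∈-allFin X)) at3
∈-formulas falsum  {suc d} (s≤s _) = ∈-concat⁺′ {xss = formulaRows d _ _} at0 at0
∈-formulas (φ ∧ ψ) {suc d} (s≤s p) = ∈-concat⁺′ {xss = formulaRows d _ _} (∈-cartesianProductWith⁺ _∧_
  (∈-formulas φ (m⊔n≤o⇒m≤o _ _ p)) (∈-formulas ψ (m⊔n≤o⇒n≤o _ _ p))) at4
∈-formulas (φ ∨ ψ) {suc d} (s≤s p) = ∈-concat⁺′ {xss = formulaRows d _ _} (∈-cartesianProductWith⁺ _∨_
  (∈-formulas φ (m⊔n≤o⇒m≤o _ _ p)) (∈-formulas ψ (m⊔n≤o⇒n≤o _ _ p))) at5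
∈-formulas (φ ⇒ ψ) {suc d} (s≤s p) = ∈-concat⁺′ {xss = formulaRows d _ _} (∈-cartesianProductWith⁺ _⇒_
  (∈-formulas φ (m⊔n≤o⇒m≤o _ _ p)) (∈-formulas ψ (m⊔n≤o⇒n≤o _ _ p))) at6
∈-formulas (∀ᴺ φ) {suc d} (s≤s p) = ∈-concat⁺′ {xss = formulaRows d _ _} (∈-map⁺ ∀ᴺ_ (∈-formulas φ p)) at7
∈-formulas (∃ᴺ φ) {suc d} (s≤s p) = ∈-concat⁺′ {xss = formulaRows d _ _} (∈-map⁺ ∃ᴺ_ (∈-formulas φ p)) at8
∈-formulas (∀ˢ φ) {suc d} (s≤s p) = ∈-concat⁺′ {xss = formulaRows d _ _} (∈-map⁺ ∀ˢ_ (∈-formulas φ p)) at9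
∈-formulas (∃ˢ φ) {suc d} (s≤s p) = ∈-concat⁺′ {xss = formulaRows d _ _} (∈-map⁺ ∃ˢ_ (∈-formulas φ p)) at10

Renaming : (Fin n → Term n′) → Set
Renaming σ = ∀ i → Σ[ j ∈ _ ] σ i ≡ var j

Renaming-liftT : {σ : Fin n → Term n′} → Renaming σ → Renaming (liftT σ)
Renaming-liftT r zero    = zero , refl
Renaming-liftT r (suc i) = suc (proj₁ (r i)) , cong wkT (proj₂ (r i))

depthᵗ-rename : {σ : Fin n → Term n′} → Renaming σ → ∀ t → depthᵗ (substT σ t) ≡ depthᵗ t
depthᵗ-rename r (var i) = cong depthᵗ (proj₂ (r i))
depthᵗ-rename r 𝟎       = refl
depthᵗ-rename r 𝟏       = refl
depthᵗ-rename r (s ⊕ t) = cong₂ (λ a b → suc (a ⊔ b)) (depthᵗ-rename r s) (depthᵗ-rename r t)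
depthᵗ-rename r (s ⊗ t) = cong₂ (λ a b → suc (a ⊔ b)) (depthᵗ-rename r s) (depthᵗ-rename r t)

-- Substituting compound terms can increase depth. Weakening from stage to stage only renames, so a
-- fixed formula is eventually shallower than the stage it is viewed from.
depth-rename : (ρ : Fin m → Fin m′) {σ : Fin n → Term n′} → Renaming σ →
               ∀ φ → depth (subst ρ σ φ) ≡ depth φ
depth-rename ρ r (s ≈ t) = cong₂ (λ a b → suc (a ⊔ b)) (depthᵗ-rename r s) (depthᵗ-rename r t)
depth-rename ρ r (s ≺ t) = cong₂ (λ a b → suc (a ⊔ b)) (depthᵗ-rename r s) (depthᵗ-rename r t)
depth-rename ρ r (t ∊ X) = cong suc (depthᵗ-rename r t)
depth-rename ρ r falsum  = refl
depth-rename ρ r (φ ∧ ψ) = cong₂ (λ a b → suc (a ⊔ b)) (depth-rename ρ r φ) (depth-rename ρ r ψ)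
depth-rename ρ r (φ ∨ ψ) = cong₂ (λ a b → suc (a ⊔ b)) (depth-rename ρ r φ) (depth-rename ρ r ψ)
depth-rename ρ r (φ ⇒ ψ) = cong₂ (λ a b → suc (a ⊔ b)) (depth-rename ρ r φ) (depth-rename ρ r ψ)
depth-rename ρ r (∀ᴺ φ)  = cong suc (depth-rename ρ (Renaming-liftT r) φ)
depth-rename ρ r (∃ᴺ φ)  = cong suc (depth-rename ρ (Renaming-liftT r) φ)
depth-rename ρ r (∀ˢ φ)  = cong suc (depth-rename (lift 1 ρ) r φ)
depth-rename ρ r (∃ˢ φ)  = cong suc (depth-rename (lift 1 ρ) r φ)

-- Henkin stages and a fair queue of formulas.

-- Stage k of the construction has k number constants and k + 1 set constants;
-- they are the free variables, the most recent constant being index zero.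
Stage : ℕ → Set
Stage k = Formula (suc k) k

wk : ∀ {k} → Stage k → Stage (suc k)
wk = subst suc (var ∘ suc)

wkˢ-wkᴺ : ∀ {k} (φ : Stage k) → wkˢ (wkᴺ φ) ≡ wk φ
wkˢ-wkᴺ = subst-∘ suc var id (var ∘ suc)

wkᴺ-wkˢ : ∀ {k} (φ : Stage k) → wkᴺ (wkˢ φ) ≡ wk φ
wkᴺ-wkˢ = subst-∘ id (var ∘ suc) suc var

-- Every formula of every stage is eventually at the head of the queue.
queue : ∀ k → List (Stage k)
next  : ∀ k → List (Stage k) → List (Stage (suc k))
queue zero    = []
queue (suc k) = next k (queue k)
-- The depth bound of a refill is the stage itself, so it grows without limit over successive
-- refills.
next k []      = formulas (suc k) (suc (suc k)) (suc k)
next k (_ ∷ q) = map wk q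

headOr⊥ : ∀ {k} → List (Stage k) → Stage k
headOr⊥ []      = falsum
headOr⊥ (φ ∷ _) = φ

current : ∀ k → Stage k
current k = headOr⊥ (queue k)

Family : Set
Family = ∀ k → Stage k

-- A single formula with constants, viewed from every stage at which its constants exist.
Coherent : ℕ → Family → Set
Coherent j χ = ∀ k → j ≤ⁿ k → χ (suc k) ≡ wk (χ k)

-- Nothing joins a nonempty queue, so each stage shortens it by one; `l` bounds the length and
-- drives the recursion.
queue-empties : ∀ l k → length (queue k) ≤ⁿ l → Σ[ k′ ∈ ℕ ] k ≤ⁿ k′ × queue k′ ≡ []
queue-empties l k p with queue k in e
queue-empties l k p | [] = k , ≤ⁿ-refl , e
queue-empties (suc l) k (s≤s p) | φ ∷ q
  with k′ , le , r ← queue-empties l (suc k)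
         (≤ⁿ-trans (≤ⁿ-reflexive (trans (cong (length ∘ next k) e) (length-map wk q))) p)
  = k′ , ≤ⁿ-trans (m≤n⇒m≤1+n ≤ⁿ-refl) le , r

depth-coherent : ∀ {j χ} → Coherent j χ → ∀ {k} → j ≤′ k → depth (χ k) ≡ depth (χ j)
depth-coherent c (≤′-reflexive refl) = refl
depth-coherent {χ = χ} c (≤′-step {n = k} p) =
  trans (cong depth (c k (≤′⇒≤ p)))
        (trans (depth-rename suc (λ i → suc i , refl) (χ k)) (depth-coherent c p))

queue-visits : ∀ {j χ} → Coherent j χ → ∀ l k → length (queue k) ≤ⁿ l → j ≤ⁿ k → χ k ∈ queue k →
               Σ[ k′ ∈ ℕ ] j ≤ⁿ k′ × current k′ ≡ χ k′
queue-visits c l k p le x with queue k in e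
queue-visits c l k p le (here refl) | φ ∷ q = k , le , cong headOr⊥ e
queue-visits {χ = χ} c (suc l) k (s≤s p) le (there x) | φ ∷ q =
  queue-visits c l (suc k)
    (≤ⁿ-trans (≤ⁿ-reflexive (trans (cong (length ∘ next k) e) (length-map wk q))) p)
    (m≤n⇒m≤1+n le)
    (transport₂ _∈_ (sym (c k le)) (sym (cong (next k) e)) (∈-map⁺ wk x))

visited : ∀ {j χ} → Coherent j χ → Σ[ k ∈ ℕ ] j ≤ⁿ k × current k ≡ χ k
visited {j} {χ} c
  with k , le , e ← queue-empties _ (j ⊔ depth (χ j)) ≤ⁿ-refl =
  queue-visits c _ (suc k) ≤ⁿ-refl j≤
    (transport (χ (suc k) ∈_) (sym (cong (next k) e)) (∈-formulas (χ (suc k)) shallow))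
  where
  j≤ : j ≤ⁿ suc k
  j≤ = m≤n⇒m≤1+n (≤ⁿ-trans (m≤m⊔n j _) le)
  shallow : depth (χ (suc k)) ≤ⁿ suc k
  shallow = ≤ⁿ-trans (≤ⁿ-reflexive (depth-coherent c (≤⇒≤′ j≤)))
                    (m≤n⇒m≤1+n (≤ⁿ-trans (m≤n⊔m j _) le))

henkin : ∀ {k} → Stage k → Stage (suc k)
henkin (∀ᴺ φ) = wkˢ (φ ⇒ wkᴺ (∀ᴺ φ))
henkin (∀ˢ φ) = wkᴺ (φ ⇒ wkˢ (∀ˢ φ))
henkin _      = falsum ⇒ falsum

-- Classical derivations, and derivability from infinite sets of formulas.

module _ {T : Theory} where

  dne : ∀ {m n Γ} {φ : Formula m n} → T ∣ Γ ⊢ ~ ~ φ → T ∣ Γ ⊢ φ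
  dne d = raa (⇒-E (weaken there d) (assume at0))

  ⇒-refuted₁ : ∀ {m n Γ} {φ ψ : Formula m n} → T ∣ Γ ⊢ ~ (φ ⇒ ψ) → T ∣ Γ ⊢ φ
  ⇒-refuted₁ d = raa (⇒-E (weaken there d) (⇒-I (raa (⇒-E (assume at2) (assume at1)))))

  ⇒-refuted₂ : ∀ {m n Γ} {φ ψ : Formula m n} → T ∣ Γ ⊢ ~ (φ ⇒ ψ) → T ∣ Γ ⊢ ~ ψ
  ⇒-refuted₂ d = ⇒-I (⇒-E (weaken there d) (⇒-I (assume at1)))

  strengthenᴺ : ∀ {m n Γ} {φ : Formula m n} → T ∣ map wkᴺ Γ ⊢ wkᴺ φ → T ∣ Γ ⊢ φ
  strengthenᴺ {φ = φ} d = transport (T ∣ _ ⊢_) (wkᴺ-inst φ 𝟎) (∀ᴺ-E (∀ᴺ-I d) 𝟎)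

  -- Generalise over the fresh variable and instantiate. There are no closed set terms, so a set
  -- variable must already be in scope; this is why every stage has one more set constant than
  -- number constants.
  strengthenˢ : ∀ {m n Γ} {φ : Formula (suc m) n} → T ∣ map wkˢ Γ ⊢ wkˢ φ → T ∣ Γ ⊢ φ
  strengthenˢ {φ = φ} d = transport (T ∣ _ ⊢_) (wkˢ-inst φ zero) (∀ˢ-E (∀ˢ-I d) zero)

  module _ (closed : Substitutive T) where

    ∃ᴺ-refute : ∀ {m n Γ} (φ : Formula m (suc n)) → T ∣ Γ ⊢ ∃ᴺ φ → T ∣ Γ ⊢ ∀ᴺ ~ φ → T ∣ Γ ⊢ falsum
    ∃ᴺ-refute {Γ = Γ} φ d e = ∃ᴺ-E d (⇒-E
        (transport (T ∣ φ ∷ map wkᴺ Γ ⊢_) body (∀ᴺ-E {φ = subst id (liftT (var ∘ suc)) (~ φ)}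
          (weaken there (subst-⊢ closed id (var ∘ suc) e)) (var zero)))
        (assume at0))
      where
      body : subst id (liftT (var ∘ suc)) (~ φ) [ var zero ]ᴺ ≡ ~ φ
      body = trans (subst-∘ _ _ _ _ (~ φ)) (trans
        (subst-cong {ρ = id} {π = id} {τ = var} (λ _ → refl) (λ { zero → refl ; (suc i) → refl }) (~ φ))
        (subst-id (~ φ)))

    ∃ˢ-refute : ∀ {m n Γ} (φ : Formula (suc m) n) → T ∣ Γ ⊢ ∃ˢ φ → T ∣ Γ ⊢ ∀ˢ ~ φ → T ∣ Γ ⊢ falsum
    ∃ˢ-refute {Γ = Γ} φ d e = ∃ˢ-E d (⇒-E
        (transport (T ∣ φ ∷ map wkˢ Γ ⊢_) body (∀ˢ-E {φ = subst (lift 1 suc) var (~ φ)}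
          (weaken there (subst-⊢ closed suc var e)) zero))
        (assume at0))
      where
      body : subst (lift 1 suc) var (~ φ) [ zero ]ˢ ≡ ~ φ
      body = trans (subst-∘ _ _ _ _ (~ φ)) (trans
        (subst-cong {π = id} {τ = var} (λ { zero → refl ; (suc i) → refl }) (λ _ → refl) (~ φ))
        (subst-id (~ φ)))

  map-wkˢ-wkᴺ : ∀ {k} (Δ : List (Stage k)) → map wk Δ ≡ map wkˢ (map wkᴺ Δ)
  map-wkˢ-wkᴺ []      = refl
  map-wkˢ-wkᴺ (φ ∷ Δ) = cong₂ _∷_ (sym (wkˢ-wkᴺ φ)) (map-wkˢ-wkᴺ Δ)

  map-wkᴺ-wkˢ : ∀ {k} (Δ : List (Stage k)) → map wk Δ ≡ map wkᴺ (map wkˢ Δ)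
  map-wkᴺ-wkˢ []      = refl
  map-wkᴺ-wkˢ (φ ∷ Δ) = cong₂ _∷_ (sym (wkᴺ-wkˢ φ)) (map-wkᴺ-wkˢ Δ)

  -- If Δ refutes φ(c) → ∀x φ, it proves φ(c) and ¬∀x φ. As c does not occur in Δ, generalising over
  -- it contradicts the latter.
  henkin-conservative : ∀ {k} (φ : Stage k) {Δ} → T ∣ henkin φ ∷ map wk Δ ⊢ falsum → T ∣ Δ ⊢ falsum
  henkin-conservative {k} φ {Δ} d = go φ (⇒-I d)
    where
    trivial : T ∣ map wk Δ ⊢ ~ (falsum ⇒ falsum) → T ∣ Δ ⊢ falsum
    trivial e = strengthenᴺ (strengthenˢ (transport (T ∣_⊢ _) (map-wkˢ-wkᴺ Δ)
                  (⇒-E e (⇒-I (assume at0)))))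
    go : ∀ φ → T ∣ map wk Δ ⊢ ~ henkin φ → T ∣ Δ ⊢ falsum
    go (∀ᴺ φ) e =
      let e′ = transport (T ∣_⊢ _) (map-wkˢ-wkᴺ Δ) e
      in ⇒-E (strengthenᴺ {φ = ~ (∀ᴺ φ)} (strengthenˢ {φ = ~ wkᴺ (∀ᴺ φ)} (⇒-refuted₂ e′)))
             (∀ᴺ-I (strengthenˢ (⇒-refuted₁ e′)))
    go (∀ˢ φ) e =
      let e′ = transport (T ∣_⊢ _) (map-wkᴺ-wkˢ Δ) e
      in ⇒-E (strengthenˢ {φ = ~ (∀ˢ φ)} (strengthenᴺ {φ = ~ wkˢ (∀ˢ φ)} (⇒-refuted₂ e′)))
             (∀ˢ-I (strengthenᴺ (⇒-refuted₁ e′)))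
    go (_ ≈ _) = trivial
    go (_ ≺ _) = trivial
    go (_ ∊ _) = trivial
    go falsum  = trivial
    go (_ ∧ _) = trivial
    go (_ ∨ _) = trivial
    go (_ ⇒ _) = trivial
    go (∃ᴺ _)  = trivial
    go (∃ˢ _)  = trivial

  infix 4 _⊩_
  _⊩_ : ∀ {m n} → (Formula m n → Set) → Formula m n → Set
  P ⊩ φ = Σ[ Δ ∈ List _ ] All P Δ × T ∣ Δ ⊢ φ

  module _ {m n} {P : Formula m n → Set} where

    ⊩-map : ∀ {φ ψ} → (∀ {Δ} → T ∣ Δ ⊢ φ → T ∣ Δ ⊢ ψ) → P ⊩ φ → P ⊩ ψ
    ⊩-map f (Δ , a , d) = Δ , a , f d

    ⊩-map₂ : ∀ {φ ψ χ} → (∀ {Δ} → T ∣ Δ ⊢ φ → T ∣ Δ ⊢ ψ → T ∣ Δ ⊢ χ) → P ⊩ φ → P ⊩ ψ → P ⊩ χ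
    ⊩-map₂ f (Δ , a , d) (Δ′ , a′ , d′) =
      _ , ++⁺ a a′ , f (weaken (xs⊆xs++ys _ _) d) (weaken (xs⊆ys++xs _ _) d′)

    ⊩-assume : ∀ {φ} → P φ → P ⊩ φ
    ⊩-assume p = _ , p ∷ [] , assume at0

    ⊩-⊢ : ∀ {φ} → T ∣ [] ⊢ φ → P ⊩ φ
    ⊩-⊢ d = [] , [] , d

    -- No equality test on formulas is needed: the tags in the `All` proof tell which premises are
    -- φ, and these are contracted into one.
    ⊩-deduction : ∀ {φ ψ} → (λ χ → P χ ⊎ χ ≡ φ) ⊩ ψ → P ⊩ φ ⇒ ψ
    ⊩-deduction {φ} (Δ , a , d) = let Δ₁ , a₁ , s = split a in Δ₁ , a₁ , ⇒-I (weaken s d)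
      where
      split : ∀ {Δ} → All (λ χ → P χ ⊎ χ ≡ φ) Δ → Σ[ Δ₁ ∈ List _ ] All P Δ₁ × Δ ⊆ φ ∷ Δ₁
      split [] = [] , [] , λ ()
      split (inj₁ p ∷ a) = let Δ₁ , a₁ , s = split a in
        _ , p ∷ a₁ , λ { (here e) → there (here e)
                       ; (there x) → case s x of λ { (here e) → here e ; (there y) → there (there y) } }
      split (inj₂ refl ∷ a) = let Δ₁ , a₁ , s = split a in
        Δ₁ , a₁ , λ { (here e) → here e ; (there x) → s x }

-- The Henkin theory and its model.

module Henkin {T : Theory} (closed : Substitutive T) (Γ₀ : List (Stage 0)) where

  Inconsistent : Set
  Inconsistent = T ∣ Γ₀ ⊢ falsum

  -- Whether `current k` enters the theory is never decided: a proof of membership carries the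
  -- certificate `Admissible k`, to be inspected only when a derivation uses that premise.
  Theoryᴴ : ∀ k → Stage k → Set
  Admissible : ∀ k → Set
  Extended : ∀ k → Stage k → Set
  Admissible k = _⊩_ {T} (λ ψ → Theoryᴴ k ψ ⊎ ψ ≡ current k) falsum → Inconsistent
  Extended k φ = Theoryᴴ k φ ⊎ (φ ≡ current k × Admissible k)
  Theoryᴴ zero    φ = φ ∈ Γ₀
  Theoryᴴ (suc k) φ = (Σ[ ψ ∈ Stage k ] φ ≡ wk ψ × Extended k ψ) ⊎ φ ≡ henkin (current k)

  Provable : ∀ k → Stage k → Set
  Provable k φ = _⊩_ {T} (Theoryᴴ k) φ

  consistent : ∀ k → Provable k falsum → Inconsistent
  consistent zero    (Δ , a , d) = weaken (lookup a) d
  consistent (suc k) (Δ , a , d) =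
    let Δ′ , b , s = unweaken a in extended b (henkin-conservative (current k) (weaken s d))
    where
    unweaken : ∀ {Δ} → All (Theoryᴴ (suc k)) Δ →
               Σ[ Δ′ ∈ List (Stage k) ] All (Extended k) Δ′ × Δ ⊆ henkin (current k) ∷ map wk Δ′
    unweaken [] = [] , [] , λ ()
    unweaken (inj₁ (ψ , refl , p) ∷ a) = let Δ′ , b , s = unweaken a in
      ψ ∷ Δ′ , p ∷ b , λ { (here e) → there (here e)
                         ; (there x) → case s x of λ { (here e) → here e ; (there y) → there (there y) } }
    unweaken (inj₂ refl ∷ a) = let Δ′ , b , s = unweaken a in
      Δ′ , b , λ { (here e) → here e ; (there x) → s x }
    old-or-admissible : ∀ {Δ} → All (Extended k) Δ → All (Theoryᴴ k) Δ ⊎ Admissible k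
    old-or-admissible [] = inj₁ []
    old-or-admissible (inj₂ (_ , c) ∷ _) = inj₂ c
    old-or-admissible (inj₁ p ∷ a) with old-or-admissible a
    ... | inj₁ ps = inj₁ (p ∷ ps)
    ... | inj₂ c  = inj₂ c
    extended : ∀ {Δ} → All (Extended k) Δ → T ∣ Δ ⊢ falsum → Inconsistent
    extended a d with old-or-admissible a
    ... | inj₁ ps = consistent k (_ , ps , d)
    ... | inj₂ c  = c (_ , mapAll [ inj₁ , inj₂ ∘ proj₁ ]′ a , d)

  Provable-wk : ∀ {k φ} → Provable k φ → Provable (suc k) (wk φ)
  Provable-wk (Δ , a , d) = map wk Δ , wks a , subst-⊢ closed suc (var ∘ suc) d
    where
    wks : ∀ {k} {Δ : List (Stage k)} → All (Theoryᴴ k) Δ → All (Theoryᴴ (suc k)) (map wk Δ)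
    wks []      = []
    wks (p ∷ a) = inj₁ (_ , refl , inj₁ p) ∷ wks a

  Eventually : Family → Set
  Eventually χ = Σ[ j ∈ ℕ ] (∀ k → j ≤ⁿ k → Provable k (χ k))

  eventually-from : ∀ {j χ} → Coherent j χ → ∀ k → j ≤ⁿ k → Provable k (χ k) → Eventually χ
  eventually-from {χ = χ} c k le p = k , λ k′ → go k′ ∘ ≤⇒≤′
    where
    go : ∀ k′ → k ≤′ k′ → Provable k′ (χ k′)
    go _ (≤′-reflexive refl) = p
    go (suc k′) (≤′-step q)  =
      transport (Provable _) (sym (c k′ (≤ⁿ-trans le (≤′⇒≤ q)))) (Provable-wk (go k′ q))

  ev-⊢ : ∀ {χ} → (∀ k → T ∣ [] ⊢ χ k) → Eventually χ
  ev-⊢ d = 0 , λ k _ → ⊩-⊢ (d k)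

  ev-map : ∀ {χ χ′} → (∀ {k Δ} → T ∣ Δ ⊢ χ k → T ∣ Δ ⊢ χ′ k) → Eventually χ → Eventually χ′
  ev-map f (j , p) = j , λ k le → ⊩-map f (p k le)

  ev-map₂ : ∀ {χ χ′ χ″} → (∀ {k Δ} → T ∣ Δ ⊢ χ k → T ∣ Δ ⊢ χ′ k → T ∣ Δ ⊢ χ″ k) →
            Eventually χ → Eventually χ′ → Eventually χ″
  ev-map₂ f (j , p) (j′ , p′) = j ⊔ j′ , λ k le →
    ⊩-map₂ f (p k (m⊔n≤o⇒m≤o j j′ le)) (p′ k (m⊔n≤o⇒n≤o j j′ le))

  ev-falsum : Eventually (λ _ → falsum) → Inconsistent
  ev-falsum (j , p) = consistent j (p j ≤ⁿ-refl)

  falsum-ev : ∀ {χ} → Inconsistent → Eventually χ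
  falsum-ev {χ} i = ev-map {χ = λ _ → falsum} (λ d → raa (weaken there d))
    (eventually-from {0} (λ _ _ → refl) 0 z≤n (Γ₀ , Γ₀-all Γ₀ id , i))
    where
    Γ₀-all : ∀ Δ → Δ ⊆ Γ₀ → All (_∈ Γ₀) Δ
    Γ₀-all []      s = []
    Γ₀-all (φ ∷ Δ) s = s at0 ∷ Γ₀-all Δ (s ∘ there)

  -- When χ comes to the head of the queue, it is admitted unless its negation is provable.
  ev-stable : ∀ {j χ} → Coherent j χ → (Eventually (λ k → ~ χ k) → Inconsistent) → Eventually χ
  ev-stable {j} {χ} c h with k , le , e ← visited c =
    eventually-from c (suc k) (m≤n⇒m≤1+n le)
      (⊩-assume (inj₁ (χ k , c k le , inj₂ (sym e , λ r →
        h (eventually-from (λ k q → cong (_⇒ falsum) (c k q)) k le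
            (⊩-map (λ d → transport (λ φ → T ∣ _ ⊢ ~ φ) e d) (⊩-deduction r)))))))

  -- A closed term of the Henkin language, viewed from every stage; below `from` the value of `fam`
  -- is unconstrained.
  record Number : Set where
    field
      fam  : ∀ k → Term k
      from : ℕ
      coh  : ∀ k → from ≤ⁿ k → fam (suc k) ≡ wkT (fam k)
  open Number

  record SetName : Set where
    field
      famˢ  : ∀ k → Fin (suc k)
      fromˢ : ℕ
      cohˢ  : ∀ k → fromˢ ≤ⁿ k → famˢ (suc k) ≡ suc (famˢ k)
  open SetName

  -- The constant created in passing from stage `l` to `l + 1`: variable zero on arrival, weakened
  -- afterwards, with 𝟎 as a default before it exists.
  constant : ℕ → Number
  constant l = record { fam = f ; from = suc l ; coh = c }
    where
    f : ∀ k → Term k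
    f zero = 𝟎
    f (suc k) with k ≟ℕ l
    ... | yes _ = var zero
    ... | no _  = wkT (f k)
    c : ∀ k → suc l ≤ⁿ k → f (suc k) ≡ wkT (f k)
    c k le with k ≟ℕ l
    ... | yes e = ⊥-elim (<ⁿ⇒≢ le (sym e))
    ... | no _  = refl

  constant-new : ∀ l → fam (constant l) (suc l) ≡ var zero
  constant-new l with l ≟ℕ l
  ... | yes _ = refl
  ... | no ¬e = ⊥-elim (¬e refl)

  constantˢ : ℕ → SetName
  constantˢ l = record { famˢ = f ; fromˢ = suc l ; cohˢ = c }
    where
    f : ∀ k → Fin (suc k)
    f zero = zero
    f (suc k) with k ≟ℕ l
    ... | yes _ = zero
    ... | no _  = suc (f k)
    c : ∀ k → suc l ≤ⁿ k → f (suc k) ≡ suc (f k)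
    c k le with k ≟ℕ l
    ... | yes e = ⊥-elim (<ⁿ⇒≢ le (sym e))
    ... | no _  = refl

  constantˢ-new : ∀ l → famˢ (constantˢ l) (suc l) ≡ zero
  constantˢ-new l with l ≟ℕ l
  ... | yes _ = refl
  ... | no ¬e = ⊥-elim (¬e refl)

  henkinStructure : Structure
  henkinStructure = record
    { A = Inconsistent ; D = Number ; S = SetName
    ; _≐_ = λ x y → Eventually (λ k → fam x k ≈ fam y k)
    ; _<_ = λ x y → Eventually (λ k → fam x k ≺ fam y k)
    ; _∈ˢ_ = λ x X → Eventually (λ k → fam x k ∊ famˢ X k)
    ; 0# = record { fam = λ _ → 𝟎 ; from = 0 ; coh = λ _ _ → refl }
    ; 1# = record { fam = λ _ → 𝟏 ; from = 0 ; coh = λ _ _ → refl }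
    ; _+_ = λ x y → record { fam = λ k → fam x k ⊕ fam y k ; from = from x ⊔ from y
        ; coh = λ k le → cong₂ _⊕_ (coh x k (m⊔n≤o⇒m≤o _ _ le)) (coh y k (m⊔n≤o⇒n≤o (from x) _ le)) }
    ; _*_ = λ x y → record { fam = λ k → fam x k ⊗ fam y k ; from = from x ⊔ from y
        ; coh = λ k le → cong₂ _⊗_ (coh x k (m⊔n≤o⇒m≤o _ _ le)) (coh y k (m⊔n≤o⇒n≤o (from x) _ le)) }
    }
  open Structure henkinStructure using (⟦_⟧ᵗ; ⟦_⟧; M)

  names : (Fin n → Number) → ∀ k → Fin n → Term k
  names ρ k i = fam (ρ i) k

  namesˢ : (Fin m → SetName) → ∀ k → Fin m → Fin (suc k)
  namesˢ σ k i = famˢ (σ i) k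

  at : Formula m n → (Fin m → SetName) → (Fin n → Number) → Family
  at φ σ ρ k = subst (namesˢ σ k) (names ρ k) φ

  ⨆ : (Fin n → ℕ) → ℕ
  ⨆ {zero}  f = 0
  ⨆ {suc n} f = f zero ⊔ ⨆ (f ∘ suc)

  ≤-⨆ : (f : Fin n → ℕ) → ∀ i → f i ≤ⁿ ⨆ f
  ≤-⨆ f zero    = m≤m⊔n _ _
  ≤-⨆ f (suc i) = ≤ⁿ-trans (≤-⨆ (f ∘ suc) i) (m≤n⊔m (f zero) _)

  start : (Fin m → SetName) → (Fin n → Number) → ℕ
  start σ ρ = ⨆ (fromˢ ∘ σ) ⊔ ⨆ (from ∘ ρ)

  names-coh : (σ : Fin m → SetName) (ρ : Fin n → Number) → ∀ k → start σ ρ ≤ⁿ k →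
              names ρ (suc k) ≗ wkT ∘ names ρ k
  names-coh σ ρ k le i = coh (ρ i) k (≤ⁿ-trans (≤-⨆ (from ∘ ρ) i) (m⊔n≤o⇒n≤o (⨆ (fromˢ ∘ σ)) _ le))

  namesˢ-coh : (σ : Fin m → SetName) (ρ : Fin n → Number) → ∀ k → start σ ρ ≤ⁿ k →
               namesˢ σ (suc k) ≗ suc ∘ namesˢ σ k
  namesˢ-coh σ ρ k le i = cohˢ (σ i) k (≤ⁿ-trans (≤-⨆ (fromˢ ∘ σ) i) (m⊔n≤o⇒m≤o _ _ le))

  at-coherent : (φ : Formula m n) → ∀ σ ρ → Coherent (start σ ρ) (at φ σ ρ)
  at-coherent φ σ ρ k le =
    trans (subst-cong (namesˢ-coh σ ρ k le) (names-coh σ ρ k le) φ) (sym (subst-∘ _ _ _ _ φ))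

  True : Formula m n → (Fin m → SetName) → (Fin n → Number) → Set
  True φ σ ρ = Eventually (at φ σ ρ)

  ⟦⟧ᵗ-at : (t : Term n) → ∀ ρ k → substT (names ρ k) t ≡ fam (⟦ t ⟧ᵗ ρ) k
  ⟦⟧ᵗ-at (var i) ρ k = refl
  ⟦⟧ᵗ-at 𝟎       ρ k = refl
  ⟦⟧ᵗ-at 𝟏       ρ k = refl
  ⟦⟧ᵗ-at (s ⊕ t) ρ k = cong₂ _⊕_ (⟦⟧ᵗ-at s ρ k) (⟦⟧ᵗ-at t ρ k)
  ⟦⟧ᵗ-at (s ⊗ t) ρ k = cong₂ _⊗_ (⟦⟧ᵗ-at s ρ k) (⟦⟧ᵗ-at t ρ k)

  at-▹ : (φ : Formula m (suc n)) → ∀ σ ρ d k →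
         subst (namesˢ σ k) (liftT (names ρ k)) φ [ fam d k ]ᴺ ≡ at φ σ (d ▹ ρ) k
  at-▹ φ σ ρ d k = trans (subst-∘ _ _ _ _ φ) (subst-cong (λ _ → refl) agree φ)
    where
    agree : substT (instᴺ (fam d k)) ∘ liftT (names ρ k) ≗ names (d ▹ ρ) k
    agree zero    = refl
    agree (suc i) = instᴺ-wkT _ _

  at-▹ˢ : (φ : Formula (suc m) n) → ∀ σ ρ X k →
          subst (lift 1 (namesˢ σ k)) (names ρ k) φ [ famˢ X k ]ˢ ≡ at φ (X ▹ σ) ρ k
  at-▹ˢ φ σ ρ X k = trans (subst-∘ _ _ _ _ φ) (subst-cong agree (λ i → substT-var _) φ)
    where
    agree : instˢ (famˢ X k) ∘ lift 1 (namesˢ σ k) ≗ namesˢ (X ▹ σ) k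
    agree zero    = refl
    agree (suc i) = refl

  ∀ᴺ-elim : (φ : Formula m (suc n)) → ∀ σ ρ → True (∀ᴺ φ) σ ρ → ∀ d → True φ σ (d ▹ ρ)
  ∀ᴺ-elim φ σ ρ p d = ev-map {χ = at (∀ᴺ φ) σ ρ} {χ′ = at φ σ (d ▹ ρ)} (λ e → transport (T ∣ _ ⊢_) (at-▹ φ σ ρ d _) (∀ᴺ-E e (fam d _))) p

  ∀ˢ-elim : (φ : Formula (suc m) n) → ∀ σ ρ → True (∀ˢ φ) σ ρ → ∀ X → True φ (X ▹ σ) ρ
  ∀ˢ-elim φ σ ρ p X = ev-map {χ = at (∀ˢ φ) σ ρ} {χ′ = at φ (X ▹ σ) ρ} (λ e → transport (T ∣ _ ⊢_) (at-▹ˢ φ σ ρ X _) (∀ˢ-E e (famˢ X _))) p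

  -- When ∀x φ reaches the head of the queue at stage `k`, the constant created there is a generic
  -- counterexample: the Henkin axiom added at that stage is the implication sought.
  ∀ᴺ-witness : (φ : Formula m (suc n)) → ∀ σ ρ → Σ[ c ∈ Number ] (True φ σ (c ▹ ρ) → True (∀ᴺ φ) σ ρ)
  ∀ᴺ-witness φ σ ρ with k , le , e ← visited (at-coherent (∀ᴺ φ) σ ρ) =
    constant k , ev-map₂ {χ = λ k → at φ σ ρ′ k ⇒ at (∀ᴺ φ) σ ρ k} {χ′ = at φ σ ρ′} {χ″ = at (∀ᴺ φ) σ ρ} ⇒-E axiomatic
    where
    ρ′ = constant k ▹ ρ
    bound : start σ ρ ≤ⁿ suc k
    bound = m≤n⇒m≤1+n le
    agree : liftT (names ρ k) ≗ names ρ′ (suc k)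
    agree zero    = sym (constant-new k)
    agree (suc i) = sym (names-coh σ ρ k le i)
    new : henkin (current k) ≡ (at φ σ ρ′ (suc k) ⇒ at (∀ᴺ φ) σ ρ (suc k))
    new = trans (cong henkin e) (cong₂ _⇒_
      (trans (subst-∘ _ _ _ _ φ)
             (subst-cong (λ i → sym (namesˢ-coh σ ρ k le i))
                         (λ i → trans (substT-var _) (agree i)) φ))
      (trans (wkˢ-wkᴺ _) (sym (at-coherent (∀ᴺ φ) σ ρ k le))))
    axiomatic : Eventually (λ k → at φ σ ρ′ k ⇒ at (∀ᴺ φ) σ ρ k)
    axiomatic = eventually-from (λ k′ q → cong₂ _⇒_
        (trans (subst-cong (namesˢ-coh σ ρ k′ (≤ⁿ-trans bound q)) (coh′ k′ q) φ) (sym (subst-∘ _ _ _ _ φ)))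
        (at-coherent (∀ᴺ φ) σ ρ k′ (≤ⁿ-trans bound q)))
      (suc k) ≤ⁿ-refl (⊩-assume (inj₂ (sym new)))
      where
      coh′ : ∀ k′ → suc k ≤ⁿ k′ → names ρ′ (suc k′) ≗ wkT ∘ names ρ′ k′
      coh′ k′ q zero    = coh (constant k) k′ q
      coh′ k′ q (suc i) = names-coh σ ρ k′ (≤ⁿ-trans bound q) i

  ∀ˢ-witness : (φ : Formula (suc m) n) → ∀ σ ρ → Σ[ X ∈ SetName ] (True φ (X ▹ σ) ρ → True (∀ˢ φ) σ ρ)
  ∀ˢ-witness φ σ ρ with k , le , e ← visited (at-coherent (∀ˢ φ) σ ρ) =
    constantˢ k , ev-map₂ {χ = λ k → at φ σ′ ρ k ⇒ at (∀ˢ φ) σ ρ k} {χ′ = at φ σ′ ρ} {χ″ = at (∀ˢ φ) σ ρ} ⇒-E axiomatic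
    where
    σ′ = constantˢ k ▹ σ
    bound : start σ ρ ≤ⁿ suc k
    bound = m≤n⇒m≤1+n le
    agree : lift 1 (namesˢ σ k) ≗ namesˢ σ′ (suc k)
    agree zero    = sym (constantˢ-new k)
    agree (suc i) = sym (namesˢ-coh σ ρ k le i)
    new : henkin (current k) ≡ (at φ σ′ ρ (suc k) ⇒ at (∀ˢ φ) σ ρ (suc k))
    new = trans (cong henkin e) (cong₂ _⇒_
      (trans (subst-∘ _ _ _ _ φ) (subst-cong agree (λ i → sym (names-coh σ ρ k le i)) φ))
      (trans (wkᴺ-wkˢ _) (sym (at-coherent (∀ˢ φ) σ ρ k le))))
    axiomatic : Eventually (λ k → at φ σ′ ρ k ⇒ at (∀ˢ φ) σ ρ k)
    axiomatic = eventually-from (λ k′ q → cong₂ _⇒_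
        (trans (subst-cong (coh′ k′ q) (names-coh σ ρ k′ (≤ⁿ-trans bound q)) φ) (sym (subst-∘ _ _ _ _ φ)))
        (at-coherent (∀ˢ φ) σ ρ k′ (≤ⁿ-trans bound q)))
      (suc k) ≤ⁿ-refl (⊩-assume (inj₂ (sym new)))
      where
      coh′ : ∀ k′ → suc k ≤ⁿ k′ → namesˢ σ′ (suc k′) ≗ suc ∘ namesˢ σ′ k′
      coh′ k′ q zero    = cohˢ (constantˢ k) k′ q
      coh′ k′ q (suc i) = namesˢ-coh σ ρ k′ (≤ⁿ-trans bound q) i

  stable : (φ : Formula m n) → ∀ σ ρ → (True (~ φ) σ ρ → Inconsistent) → True φ σ ρ
  stable φ σ ρ = ev-stable (at-coherent φ σ ρ)

  ~-elim : (φ : Formula m n) → ∀ σ ρ → True (~ φ) σ ρ → True φ σ ρ → Inconsistent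
  ~-elim φ σ ρ p q = ev-falsum (ev-map₂ {χ = at (~ φ) σ ρ} {χ′ = at φ σ ρ} {χ″ = λ _ → falsum} ⇒-E p q)

  stable-M : (φ : Formula m n) → ∀ σ ρ → M (True φ σ ρ) → True φ σ ρ
  stable-M φ σ ρ h = stable φ σ ρ (λ n → h (~-elim φ σ ρ n))

  ~-intro : (φ : Formula m n) → ∀ σ ρ → (True φ σ ρ → Inconsistent) → True (~ φ) σ ρ
  ~-intro φ σ ρ h = stable (~ φ) σ ρ (λ n → h (ev-map {χ = at (~ ~ φ) σ ρ} {χ′ = at φ σ ρ} dne n))

  instantiate : ∀ {C Q : Set} {P : C → Set} → Σ[ c ∈ C ] (P c → Q) → (∀ c → P c) → Q
  instantiate (c , w) f = w (f c)

  ∀ᴺ-intro : (φ : Formula m (suc n)) → ∀ σ ρ → (∀ d → True φ σ (d ▹ ρ)) → True (∀ᴺ φ) σ ρ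
  ∀ᴺ-intro φ σ ρ f = instantiate {P = λ c → True φ σ (c ▹ ρ)} (∀ᴺ-witness φ σ ρ) f

  ∀ˢ-intro : (φ : Formula (suc m) n) → ∀ σ ρ → (∀ X → True φ (X ▹ σ) ρ) → True (∀ˢ φ) σ ρ
  ∀ˢ-intro φ σ ρ f = instantiate {P = λ X → True φ (X ▹ σ) ρ} (∀ˢ-witness φ σ ρ) f

  ∃ᴺ-absurd : (φ : Formula m (suc n)) → ∀ σ ρ → True (∃ᴺ φ) σ ρ → True (∀ᴺ ~ φ) σ ρ → Inconsistent
  ∃ᴺ-absurd φ σ ρ p q = ev-falsum
    (ev-map₂ {χ = at (∃ᴺ φ) σ ρ} {χ′ = at (∀ᴺ ~ φ) σ ρ} {χ″ = λ _ → falsum} (∃ᴺ-refute closed _) p q)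

  ∃ˢ-absurd : (φ : Formula (suc m) n) → ∀ σ ρ → True (∃ˢ φ) σ ρ → True (∀ˢ ~ φ) σ ρ → Inconsistent
  ∃ˢ-absurd φ σ ρ p q = ev-falsum
    (ev-map₂ {χ = at (∃ˢ φ) σ ρ} {χ′ = at (∀ˢ ~ φ) σ ρ} {χ″ = λ _ → falsum} (∃ˢ-refute closed _) p q)

  ∨-absurd : (φ ψ : Formula m n) → ∀ σ ρ →
             True (φ ∨ ψ) σ ρ → True (~ φ) σ ρ → True (~ ψ) σ ρ → Inconsistent
  ∨-absurd φ ψ σ ρ p q r = ~-elim (φ ∨ ψ) σ ρ
    (ev-map₂ {χ = at (~ φ) σ ρ} {χ′ = at (~ ψ) σ ρ} {χ″ = at (~ (φ ∨ ψ)) σ ρ} (λ x y → ⇒-I (∨-E (assume at0)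
      (⇒-E (weaken (there ∘ there) x) (assume at0)) (⇒-E (weaken (there ∘ there) y) (assume at0)))) q r) p

  ∃ᴺ-intro : (φ : Formula m (suc n)) → ∀ σ ρ d → True φ σ (d ▹ ρ) → True (∃ᴺ φ) σ ρ
  ∃ᴺ-intro φ σ ρ d = ev-map {χ = at φ σ (d ▹ ρ)} {χ′ = at (∃ᴺ φ) σ ρ}
    (λ e → ∃ᴺ-I (fam d _) (transport (T ∣ _ ⊢_) (sym (at-▹ φ σ ρ d _)) e))

  ∃ˢ-intro : (φ : Formula (suc m) n) → ∀ σ ρ X → True φ (X ▹ σ) ρ → True (∃ˢ φ) σ ρ
  ∃ˢ-intro φ σ ρ X = ev-map {χ = at φ (X ▹ σ) ρ} {χ′ = at (∃ˢ φ) σ ρ}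
    (λ e → ∃ˢ-I (famˢ X _) (transport (T ∣ _ ⊢_) (sym (at-▹ˢ φ σ ρ X _)) e))

  -- The two halves of the truth lemma are mutual because implication exchanges them. A provable
  -- disjunction or existential statement need not reveal a disjunct or witness, which is why `⟦_⟧`
  -- reads them through `M`.
  truth   : (φ : Formula m n) → ∀ σ ρ → True φ σ ρ → ⟦ φ ⟧ σ ρ
  untruth : (φ : Formula m n) → ∀ σ ρ → ⟦ φ ⟧ σ ρ → True φ σ ρ

  truth (s ≈ t) σ ρ = ev-map (λ {k} → transport₂ (λ a b → T ∣ _ ⊢ a ≈ b) (⟦⟧ᵗ-at s ρ k) (⟦⟧ᵗ-at t ρ k))
  truth (s ≺ t) σ ρ = ev-map (λ {k} → transport₂ (λ a b → T ∣ _ ⊢ a ≺ b) (⟦⟧ᵗ-at s ρ k) (⟦⟧ᵗ-at t ρ k))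
  truth (t ∊ X) σ ρ = ev-map (λ {k} → transport (λ a → T ∣ _ ⊢ a ∊ _) (⟦⟧ᵗ-at t ρ k))
  truth falsum  σ ρ p = ev-falsum p
  truth (φ ∧ ψ) σ ρ p = truth φ σ ρ (ev-map ∧-E₁ p) , truth ψ σ ρ (ev-map ∧-E₂ p)
  truth (φ ∨ ψ) σ ρ p h = ∨-absurd φ ψ σ ρ p
    (~-intro φ σ ρ (h ∘ inj₁ ∘ truth φ σ ρ)) (~-intro ψ σ ρ (h ∘ inj₂ ∘ truth ψ σ ρ))
  truth (φ ⇒ ψ) σ ρ p q = truth ψ σ ρ (ev-map₂ ⇒-E p (untruth φ σ ρ q))
  truth (∀ᴺ φ)  σ ρ p d = truth φ σ (d ▹ ρ) (∀ᴺ-elim φ σ ρ p d)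
  truth (∃ᴺ φ)  σ ρ p h = ∃ᴺ-absurd φ σ ρ p
    (∀ᴺ-intro (~ φ) σ ρ (λ d → ~-intro φ σ (d ▹ ρ) (λ q → h (d , truth φ σ (d ▹ ρ) q))))
  truth (∀ˢ φ)  σ ρ p X = truth φ (X ▹ σ) ρ (∀ˢ-elim φ σ ρ p X)
  truth (∃ˢ φ)  σ ρ p h = ∃ˢ-absurd φ σ ρ p
    (∀ˢ-intro (~ φ) σ ρ (λ X → ~-intro φ (X ▹ σ) ρ (λ q → h (X , truth φ (X ▹ σ) ρ q))))

  untruth (s ≈ t) σ ρ =
    ev-map (λ {k} → transport₂ (λ a b → T ∣ _ ⊢ a ≈ b) (sym (⟦⟧ᵗ-at s ρ k)) (sym (⟦⟧ᵗ-at t ρ k)))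
  untruth (s ≺ t) σ ρ =
    ev-map (λ {k} → transport₂ (λ a b → T ∣ _ ⊢ a ≺ b) (sym (⟦⟧ᵗ-at s ρ k)) (sym (⟦⟧ᵗ-at t ρ k)))
  untruth (t ∊ X) σ ρ = ev-map (λ {k} → transport (λ a → T ∣ _ ⊢ a ∊ _) (sym (⟦⟧ᵗ-at t ρ k)))
  untruth falsum  σ ρ a = falsum-ev a
  untruth (φ ∧ ψ) σ ρ (p , q) = ev-map₂ ∧-I (untruth φ σ ρ p) (untruth ψ σ ρ q)
  untruth (φ ∨ ψ) σ ρ h = stable-M (φ ∨ ψ) σ ρ λ r → h λ
    { (inj₁ p) → r (ev-map ∨-I₁ (untruth φ σ ρ p)) ; (inj₂ q) → r (ev-map ∨-I₂ (untruth ψ σ ρ q)) }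
  untruth (φ ⇒ ψ) σ ρ f = stable (φ ⇒ ψ) σ ρ λ n →
    ~-elim ψ σ ρ (ev-map ⇒-refuted₂ n) (untruth ψ σ ρ (f (truth φ σ ρ (ev-map ⇒-refuted₁ n))))
  untruth (∀ᴺ φ)  σ ρ f = ∀ᴺ-intro φ σ ρ (λ d → untruth φ σ (d ▹ ρ) (f d))
  untruth (∃ᴺ φ)  σ ρ h = stable-M (∃ᴺ φ) σ ρ λ r → h λ (d , p) →
    r (∃ᴺ-intro φ σ ρ d (untruth φ σ (d ▹ ρ) p))
  untruth (∀ˢ φ)  σ ρ f = ∀ˢ-intro φ σ ρ (λ X → untruth φ (X ▹ σ) ρ (f X))
  untruth (∃ˢ φ)  σ ρ h = stable-M (∃ˢ φ) σ ρ λ r → h λ (X , p) →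
    r (∃ˢ-intro φ σ ρ X (untruth φ (X ▹ σ) ρ p))

  henkinModel : Model T
  henkinModel = record
    { structure = henkinStructure
    ; stable-≐ = λ {x} {y} → stable-M (var zero ≈ var (suc zero)) (∅ {SetName}) (x ▹ y ▹ ∅)
    ; stable-< = λ {x} {y} → stable-M (var zero ≺ var (suc zero)) (∅ {SetName}) (x ▹ y ▹ ∅)
    ; stable-∈ = λ {x} {X} → stable-M (var zero ∊ zero) (X ▹ ∅) (x ▹ ∅)
    ; sound = λ {_} {_} {φ} d σ ρ → truth φ σ ρ (ev-⊢ (λ k → subst-⊢ closed _ _ d))
    }

  initial : (φ : Sentence) → wkˢ φ ∈ Γ₀ → ⟦ φ ⟧ ∅ ∅
  initial φ x = truth φ ∅ ∅ (eventually-from (at-coherent φ ∅ ∅) 0 z≤n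
    (⊩-assume (transport (_∈ Γ₀) (subst-cong {π = namesˢ ∅ 0} {τ = names ∅ 0} (λ ()) (λ ()) φ) x)))

-- In the Henkin model of ¬φ and Γ, falsum means that these premises are inconsistent. Validity
-- makes φ true there, so applying the truth of ¬φ yields an actual derivation of falsum. It still
-- mentions the set constant of stage 0, which `inhabited` discharges by ∃-elimination.
completeness : ∀ {T} → Substitutive T → (∀ {Γ : List Sentence} → T ∣ Γ ⊢ ∃ˢ (falsum ⇒ falsum)) →
  ∀ {Γ φ} →
  (∀ (𝔐 : Model T) → (∀ {γ} → γ ∈ Γ → 𝔐 ⊨ γ) → 𝔐 ⊨ φ) → T ∣ Γ ⊢ φ
completeness {T} closed inhabited {Γ} {φ} valid =
  raa (∃ˢ-E inhabited (weaken there inconsistent))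
  where
  open Henkin closed (map wkˢ (~ φ ∷ Γ))
  inconsistent : Inconsistent
  inconsistent = initial (~ φ) at0 (valid henkinModel (λ {γ} x → initial γ (there (∈-map⁺ wkˢ x))))

-- Δ₀ formulas written together with their certificates.

Bounded : ℕ → ℕ → Set
Bounded m n = Σ (Formula m n) Δ₀

infix  15 _≈ᵇ_ _≺ᵇ_ _∊ᵇ_
infix  14 ~ᵇ_
infixr 13 _∧ᵇ_
infixr 12 _∨ᵇ_
infixr 11 _⇒ᵇ_
infix  9  ∀<_·_ ∃<_·_

_≈ᵇ_ _≺ᵇ_ : Term n → Term n → Bounded m n
s ≈ᵇ t = s ≈ t , eq s t
s ≺ᵇ t = s ≺ t , lt s t

_∊ᵇ_ : Term n → Fin m → Bounded m n
t ∊ᵇ X = t ∊ X , mem t X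

_∧ᵇ_ _∨ᵇ_ _⇒ᵇ_ : Bounded m n → Bounded m n → Bounded m n
(φ , p) ∧ᵇ (ψ , q) = φ ∧ ψ , and p q
(φ , p) ∨ᵇ (ψ , q) = φ ∨ ψ , or p q
(φ , p) ⇒ᵇ (ψ , q) = (φ ⇒ ψ) , imp p q

~ᵇ_ : Bounded m n → Bounded m n
~ᵇ φ = φ ⇒ᵇ (falsum , bot)

∀<_·_ ∃<_·_ : Term n → Bounded m (suc n) → Bounded m n
∀< t · (φ , p) = (∀ᴺ (var zero ≺ wkT t ⇒ φ)) , all t p
∃< t · (φ , p) = (∃ᴺ (var zero ≺ wkT t ∧ φ)) , ex t p

substᵇ : (Fin m → Fin m′) → (Fin n → Term n′) → Bounded m n → Bounded m′ n′
substᵇ ρ σ (φ , p) = subst ρ σ φ , subst-Δ₀ ρ σ p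

pattern #0 = zero
pattern #1 = suc zero

pattern v0 = var zero
pattern v1 = var (suc zero)
pattern v2 = var (suc (suc zero))
pattern v3 = var (suc (suc (suc zero)))
pattern v4 = var (suc (suc (suc (suc zero))))
pattern v5 = var (suc (suc (suc (suc (suc zero)))))
pattern v6 = var (suc (suc (suc (suc (suc (suc zero))))))

-- Reasoning inside a model: stability, equality, induction and comprehension.

module Logic (𝔐 : Model RCA₀) where
  open Model 𝔐 public

  infix 3 _↔_
  _↔_ : Set → Set → Set
  X ↔ Y = (X → Y) × (Y → X)

  ↔-refl : ∀ {X} → X ↔ X
  ↔-refl = id , id

  Ex : {X : Set} → (X → Set) → Set
  Ex P = M (Σ _ P)

  -- Instance search proves goals stable, so that `do` blocks can open classical disjunctions and
  -- existentials. `M X` is stable as a function type into `A`.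
  record Stable (X : Set) : Set where
    constructor stably
    field stable : M X → X
  open Stable {{...}} public

  instance
    Stable-A : Stable A
    Stable-A = stably λ h → h id
    Stable-≐ : ∀ {x y} → Stable (x ≐ y)
    Stable-≐ = stably stable-≐
    Stable-< : ∀ {x y} → Stable (x < y)
    Stable-< = stably stable-<
    Stable-∈ : ∀ {x X} → Stable (x ∈ˢ X)
    Stable-∈ = stably stable-∈
    Stable-× : ∀ {X Y} → {{Stable X}} → {{Stable Y}} → Stable (X × Y)
    Stable-× = stably λ h → stable (λ k → h (k ∘ proj₁)) , stable (λ k → h (k ∘ proj₂))
    Stable-Π : ∀ {X : Set} {Y : X → Set} → {{∀ {x} → Stable (Y x)}} → Stable (∀ x → Y x)
    Stable-Π = stably λ h x → stable (λ k → h (λ f → k (f x)))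

  infixl 1 _>>=_
  _>>=_ : ∀ {X Y : Set} → {{Stable Y}} → M X → (X → Y) → Y
  m >>= f = stable (λ k → m (λ x → k (f x)))

  η : {X : Set} → X → M X
  η x k = k x

  em : (X : Set) → M (X ⊎ (X → A))
  em X k = k (inj₂ (λ x → k (inj₁ x)))

  by-contradiction : ∀ {X} → {{Stable X}} → ((X → A) → A) → X
  by-contradiction h = stable h

  absurd : ∀ {X} → {{Stable X}} → A → X
  absurd a = stable (λ _ → a)

  axiomᴹ : ∀ {m n φ} → RCA₀ m n φ → ∀ σ ρ → ⟦ φ ⟧ σ ρ
  axiomᴹ a = sound (axiom a)

  ≐-refl : ∀ {x} → x ≐ x
  ≐-refl {x} = sound {0} {1} (≈-refl v0) ∅ (x ▹ ∅)

  private
    -- Soundness of one derivation with the substitution rule; all congruence facts below are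
    -- instances of it, `≐` being an equivalence relation and not identity.
    leibniz : (φ : Formula m (suc n)) (s t : Term n) → ∀ σ ρ →
              ⟦ s ≈ t ⟧ σ ρ → ⟦ φ [ s ]ᴺ ⟧ σ ρ → ⟦ φ [ t ]ᴺ ⟧ σ ρ
    leibniz φ s t = sound (⇒-I (⇒-I (≈-subst φ (assume (there (here ≡.refl))) (assume (here ≡.refl)))))

  ≐-sym : ∀ {x y} → x ≐ y → y ≐ x
  ≐-sym {x} {y} p = leibniz {0} (v0 ≈ v1) v0 v1 ∅ (x ▹ y ▹ ∅) p ≐-refl

  ≐-trans : ∀ {x y z} → x ≐ y → y ≐ z → x ≐ z
  ≐-trans {x} {y} {z} p q = leibniz {0} (v1 ≈ v0) v1 v2 ∅ (x ▹ y ▹ z ▹ ∅) q p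

  <-resp : ∀ {x x′ y y′} → x ≐ x′ → y ≐ y′ → x < y → x′ < y′
  <-resp {x} {x′} {y} {y′} p q r =
    leibniz {0} (v2 ≺ v0) v2 v3 ∅ (x ▹ x′ ▹ y ▹ y′ ▹ ∅) q
      (leibniz {0} (v0 ≺ v3) v0 v1 ∅ (x ▹ x′ ▹ y ▹ y′ ▹ ∅) p r)

  ∈-resp : ∀ {x y X} → x ≐ y → x ∈ˢ X → y ∈ˢ X
  ∈-resp {x} {y} {X} = leibniz {1} (v0 ∊ zero) v0 v1 (X ▹ ∅) (x ▹ y ▹ ∅)

  +-cong : ∀ {x x′ y y′} → x ≐ x′ → y ≐ y′ → x + y ≐ x′ + y′
  +-cong {x} {x′} {y} {y′} p q =
    leibniz {0} (v1 ⊕ v3 ≈ v2 ⊕ v0) v2 v3 ∅ (x ▹ x′ ▹ y ▹ y′ ▹ ∅) q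
      (leibniz {0} (v1 ⊕ v3 ≈ v0 ⊕ v3) v0 v1 ∅ (x ▹ x′ ▹ y ▹ y′ ▹ ∅) p ≐-refl)

  *-cong : ∀ {x x′ y y′} → x ≐ x′ → y ≐ y′ → x * y ≐ x′ * y′
  *-cong {x} {x′} {y} {y′} p q =
    leibniz {0} (v1 ⊗ v3 ≈ v2 ⊗ v0) v2 v3 ∅ (x ▹ x′ ▹ y ▹ y′ ▹ ∅) q
      (leibniz {0} (v1 ⊗ v3 ≈ v0 ⊗ v3) v0 v1 ∅ (x ▹ x′ ▹ y ▹ y′ ▹ ∅) p ≐-refl)

  ⟦substT⟧ : ∀ {σ : Fin n → Term n′} {ρ ρ′} → (∀ i → ⟦ σ i ⟧ᵗ ρ ≐ ρ′ i) →
             ∀ t → ⟦ substT σ t ⟧ᵗ ρ ≐ ⟦ t ⟧ᵗ ρ′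
  ⟦substT⟧ e (var i) = e i
  ⟦substT⟧ e 𝟎       = ≐-refl
  ⟦substT⟧ e 𝟏       = ≐-refl
  ⟦substT⟧ e (s ⊕ t) = +-cong (⟦substT⟧ e s) (⟦substT⟧ e t)
  ⟦substT⟧ e (s ⊗ t) = *-cong (⟦substT⟧ e s) (⟦substT⟧ e t)

  ⟦liftT⟧ : ∀ {σ : Fin n → Term n′} {ρ ρ′} → (∀ i → ⟦ σ i ⟧ᵗ ρ ≐ ρ′ i) →
            ∀ d i → ⟦ liftT σ i ⟧ᵗ (d ▹ ρ) ≐ (d ▹ ρ′) i
  ⟦liftT⟧ e d zero    = ≐-refl
  ⟦liftT⟧ {σ = σ} e d (suc i) = ≐-trans (⟦substT⟧ (λ _ → ≐-refl) (σ i)) (e i)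

  ⟦lift⟧ : ∀ {π : Fin m → Fin m′} {τ : Fin m′ → S} {τ′} → τ ∘ π ≗ τ′ →
           ∀ X → (X ▹ τ) ∘ lift 1 π ≗ X ▹ τ′
  ⟦lift⟧ e X zero    = ≡.refl
  ⟦lift⟧ e X (suc i) = e i

  private
    M-map : ∀ {X Y : Set} → (X → Y) → M X → M Y
    M-map f h k = h (k ∘ f)

    ∃-map : ∀ {X : Set} {P Q : X → Set} → (∀ x → P x → Q x) → Ex P → Ex Q
    ∃-map f = M-map (λ (x , p) → x , f x p)

  -- The semantic substitution lemma. Numbers are compared up to `≐`, sets up to identity, because
  -- the language has no equality of sets.
  ⟦subst⟧ : ∀ {π : Fin m → Fin m′} {σ : Fin n → Term n′} {τ τ′ ρ ρ′} →
            τ ∘ π ≗ τ′ → (∀ i → ⟦ σ i ⟧ᵗ ρ ≐ ρ′ i) →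
            ∀ φ → ⟦ subst π σ φ ⟧ τ ρ ↔ ⟦ φ ⟧ τ′ ρ′
  ⟦subst⟧ f e (s ≈ t) =
    (λ p → ≐-trans (≐-sym (⟦substT⟧ e s)) (≐-trans p (⟦substT⟧ e t))) ,
    (λ p → ≐-trans (⟦substT⟧ e s) (≐-trans p (≐-sym (⟦substT⟧ e t))))
  ⟦subst⟧ f e (s ≺ t) =
    <-resp (⟦substT⟧ e s) (⟦substT⟧ e t) , <-resp (≐-sym (⟦substT⟧ e s)) (≐-sym (⟦substT⟧ e t))
  ⟦subst⟧ f e (t ∊ X) =
    (λ p → ≡.subst (_ ∈ˢ_) (f X) (∈-resp (⟦substT⟧ e t) p)) ,
    (λ p → ∈-resp (≐-sym (⟦substT⟧ e t)) (≡.subst (_ ∈ˢ_) (≡.sym (f X)) p))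
  ⟦subst⟧ f e falsum = ↔-refl
  ⟦subst⟧ f e (φ ∧ ψ) with ⟦subst⟧ f e φ | ⟦subst⟧ f e ψ
  ... | a , b | c , d = (λ (p , q) → a p , c q) , (λ (p , q) → b p , d q)
  ⟦subst⟧ f e (φ ∨ ψ) with ⟦subst⟧ f e φ | ⟦subst⟧ f e ψ
  ... | a , b | c , d = M-map [ inj₁ ∘ a , inj₂ ∘ c ]′ , M-map [ inj₁ ∘ b , inj₂ ∘ d ]′
  ⟦subst⟧ f e (φ ⇒ ψ) with ⟦subst⟧ f e φ | ⟦subst⟧ f e ψ
  ... | a , b | c , d = (λ p → c ∘ p ∘ b) , (λ p → d ∘ p ∘ a)
  ⟦subst⟧ f e (∀ᴺ φ) =
    (λ p d → proj₁ (⟦subst⟧ f (⟦liftT⟧ e d) φ) (p d)) , (λ p d → proj₂ (⟦subst⟧ f (⟦liftT⟧ e d) φ) (p d))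
  ⟦subst⟧ f e (∃ᴺ φ) =
    ∃-map (λ d → proj₁ (⟦subst⟧ f (⟦liftT⟧ e d) φ)) , ∃-map (λ d → proj₂ (⟦subst⟧ f (⟦liftT⟧ e d) φ))
  ⟦subst⟧ f e (∀ˢ φ) =
    (λ p X → proj₁ (⟦subst⟧ (⟦lift⟧ f X) e φ) (p X)) , (λ p X → proj₂ (⟦subst⟧ (⟦lift⟧ f X) e φ) (p X))
  ⟦subst⟧ f e (∃ˢ φ) =
    ∃-map (λ X → proj₁ (⟦subst⟧ (⟦lift⟧ f X) e φ)) , ∃-map (λ X → proj₂ (⟦subst⟧ (⟦lift⟧ f X) e φ))

  ⟦resp⟧ : (φ : Formula m n) → ∀ {σ ρ ρ′} → (∀ i → ρ i ≐ ρ′ i) → ⟦ φ ⟧ σ ρ → ⟦ φ ⟧ σ ρ′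
  ⟦resp⟧ φ {σ} {ρ} e p =
    proj₁ (⟦subst⟧ (λ _ → ≡.refl) e φ) (≡.subst (λ ψ → ⟦ ψ ⟧ σ ρ) (≡.sym (subst-id φ)) p)

  ⟪_⟫ : Bounded m n → (Fin m → S) → (Fin n → D) → Set
  ⟪ b ⟫ = ⟦ proj₁ b ⟧

  induction-Σ₁ : (b : Bounded m (suc (suc n))) → ∀ σ ρ →
    Ex (λ z → ⟪ b ⟫ σ (z ▹ 0# ▹ ρ)) →
    (∀ d z → ⟪ b ⟫ σ (z ▹ d ▹ ρ) → Ex (λ z → ⟪ b ⟫ σ (z ▹ d + 1# ▹ ρ))) →
    ∀ d → Ex (λ z → ⟪ b ⟫ σ (z ▹ d ▹ ρ))
  induction-Σ₁ (φ , p) σ ρ base step = axiomᴹ (Σ₁-ind (ex p)) σ ρ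
    ( proj₂ (⟦subst⟧ (λ _ → ≡.refl) zero-env (∃ᴺ φ)) base
    , λ d h → proj₂ (⟦subst⟧ (λ _ → ≡.refl) (suc-env d) (∃ᴺ φ)) (h >>= λ (z , q) → step d z q) )
    where
    zero-env : ∀ i → ⟦ instᴺ 𝟎 i ⟧ᵗ ρ ≐ (0# ▹ ρ) i
    zero-env zero    = ≐-refl
    zero-env (suc i) = ≐-refl
    suc-env : ∀ d i → ⟦ succᴺ i ⟧ᵗ (d ▹ ρ) ≐ (d + 1# ▹ ρ) i
    suc-env d zero    = ≐-refl
    suc-env d (suc i) = ≐-refl

  ⟪⟫-stable : (b : Bounded m n) → ∀ σ ρ → Stable (⟪ b ⟫ σ ρ)
  ⟪⟫-stable (φ , _) = go φ
    where
    go : (φ : Formula m n) → ∀ σ ρ → Stable (⟦ φ ⟧ σ ρ)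
    go (s ≈ t) σ ρ = Stable-≐
    go (s ≺ t) σ ρ = Stable-<
    go (t ∊ X) σ ρ = Stable-∈
    go falsum σ ρ  = Stable-A
    go (φ ∧ ψ) σ ρ = Stable-× {{go φ σ ρ}} {{go ψ σ ρ}}
    go (φ ∨ ψ) σ ρ = Stable-Π
    go (φ ⇒ ψ) σ ρ = Stable-Π {{go ψ σ ρ}}
    go (∀ᴺ φ) σ ρ  = Stable-Π {{λ {d} → go φ σ (d ▹ ρ)}}
    go (∃ᴺ φ) σ ρ  = Stable-Π
    go (∀ˢ φ) σ ρ  = Stable-Π {{λ {X} → go φ (X ▹ σ) ρ}}
    go (∃ˢ φ) σ ρ  = Stable-Π

  wkᵇ : Bounded m n → Bounded m (suc n)
  wkᵇ = substᵇ id (var ∘ suc)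

  ⟪wkᵇ⟫ : (b : Bounded m n) → ∀ {σ ρ d} → ⟪ wkᵇ b ⟫ σ (d ▹ ρ) ↔ ⟪ b ⟫ σ ρ
  ⟪wkᵇ⟫ (φ , _) = ⟦subst⟧ (λ _ → ≡.refl) (λ _ → ≐-refl) φ

  -- Σ₁ induction with a dummy existential quantifier, which stability of the formula removes again.
  induction : (b : Bounded m (suc n)) → ∀ σ ρ → ⟪ b ⟫ σ (0# ▹ ρ) →
    (∀ d → ⟪ b ⟫ σ (d ▹ ρ) → ⟪ b ⟫ σ (d + 1# ▹ ρ)) → ∀ d → ⟪ b ⟫ σ (d ▹ ρ)
  induction b σ ρ base step d = _>>=_ {{⟪⟫-stable b σ (d ▹ ρ)}}
    (induction-Σ₁ (wkᵇ b) σ ρ (η (0# , proj₂ (⟪wkᵇ⟫ b) base))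
      (λ e z p → η (z , proj₂ (⟪wkᵇ⟫ b) (step e (proj₁ (⟪wkᵇ⟫ b) p)))) d)
    (λ (z , p) → proj₁ (⟪wkᵇ⟫ b) p)

  comprehension-Δ₁ : (b c : Bounded m (suc (suc n))) → ∀ σ ρ →
    (∀ d → Ex (λ z → ⟪ b ⟫ σ (z ▹ d ▹ ρ)) ↔ (∀ z → ⟪ c ⟫ σ (z ▹ d ▹ ρ))) →
    Ex (λ X → ∀ d → d ∈ˢ X ↔ Ex (λ z → ⟪ b ⟫ σ (z ▹ d ▹ ρ)))
  comprehension-Δ₁ (φ , p) (ψ , q) σ ρ h = do
    X , e ← axiomᴹ (Δ₁-comp (ex p) (all q)) σ ρ h
    η (X , λ d → let f , g = ⟦subst⟧ {π = suc} {σ = var} {ρ = d ▹ ρ} (λ _ → ≡.refl) (λ _ → ≐-refl) (∃ᴺ φ)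
                 in f ∘ proj₁ (e d) , proj₂ (e d) ∘ g)

  comprehension : (b : Bounded m (suc n)) → ∀ σ ρ → Ex (λ X → ∀ d → d ∈ˢ X ↔ ⟪ b ⟫ σ (d ▹ ρ))
  comprehension b σ ρ = do
    X , e ← comprehension-Δ₁ (wkᵇ b) (wkᵇ b) σ ρ (λ d →
      (λ p z → proj₂ (⟪wkᵇ⟫ b) (_>>=_ {{⟪⟫-stable b σ (d ▹ ρ)}} p (λ (z , q) → proj₁ (⟪wkᵇ⟫ b) q))) ,
      (λ f → η (0# , f 0#)))
    η (X , λ d → (λ p → _>>=_ {{⟪⟫-stable b σ (d ▹ ρ)}} (proj₁ (e d) p) (λ (z , q) → proj₁ (⟪wkᵇ⟫ b) q)) ,
                 (λ p → proj₂ (e d) (η (0# , proj₂ (⟪wkᵇ⟫ b) p))))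

-- Ordered semiring arithmetic and the pairing function.

module Arithmetic (𝔐 : Model RCA₀) where
  open Logic 𝔐 public

  suc≢0ᴹ : ∀ {x} → x + 1# ≐ 0# → A
  suc≢0ᴹ {x} = axiomᴹ {0} {1} (suc≢0 v0) ∅ (x ▹ ∅)

  suc-injᴹ : ∀ {x y} → x + 1# ≐ y + 1# → x ≐ y
  suc-injᴹ {x} {y} = axiomᴹ {0} {2} (suc-inj v0 v1) ∅ (x ▹ y ▹ ∅)

  +-zero : ∀ x → x + 0# ≐ x
  +-zero x = axiomᴹ {0} {1} (⊕-zero v0) ∅ (x ▹ ∅)

  +-suc : ∀ x y → x + (y + 1#) ≐ (x + y) + 1#
  +-suc x y = axiomᴹ {0} {2} (⊕-suc v0 v1) ∅ (x ▹ y ▹ ∅)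

  *-zero : ∀ x → x * 0# ≐ 0#
  *-zero x = axiomᴹ {0} {1} (⊗-zero v0) ∅ (x ▹ ∅)

  *-suc : ∀ x y → x * (y + 1#) ≐ x * y + x
  *-suc x y = axiomᴹ {0} {2} (⊗-suc v0 v1) ∅ (x ▹ y ▹ ∅)

  ≮0 : ∀ {x} → x < 0# → A
  ≮0 {x} = axiomᴹ {0} {1} (≺-zero v0) ∅ (x ▹ ∅)

  <-suc : ∀ {x y} → x < y + 1# ↔ M (x < y ⊎ x ≐ y)
  <-suc {x} {y} = axiomᴹ {0} {2} (≺-suc v0 v1) ∅ (x ▹ y ▹ ∅)

  infixr 5 _∙_
  _∙_ : ∀ {x y z} → x ≐ y → y ≐ z → x ≐ z
  _∙_ = ≐-trans

  +-congˡ : ∀ {x y y′} → y ≐ y′ → x + y ≐ x + y′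
  +-congˡ = +-cong ≐-refl
  +-congʳ : ∀ {x x′ y} → x ≐ x′ → x + y ≐ x′ + y
  +-congʳ p = +-cong p ≐-refl

  0+ : ∀ x → 0# + x ≐ x
  0+ = induction {0} (𝟎 ⊕ v0 ≈ᵇ v0) ∅ ∅ (+-zero 0#) (λ d p → +-suc 0# d ∙ +-congʳ p)

  suc+ : ∀ x y → (x + 1#) + y ≐ (x + y) + 1#
  suc+ x = induction {0} ((v1 ⊕ 𝟏) ⊕ v0 ≈ᵇ (v1 ⊕ v0) ⊕ 𝟏) ∅ (x ▹ ∅)
    (+-zero _ ∙ +-congʳ (≐-sym (+-zero x)))
    (λ d p → +-suc _ d ∙ +-congʳ p ∙ +-congʳ (≐-sym (+-suc x d)))

  +-comm : ∀ x y → x + y ≐ y + x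
  +-comm x = induction {0} (v1 ⊕ v0 ≈ᵇ v0 ⊕ v1) ∅ (x ▹ ∅)
    (+-zero x ∙ ≐-sym (0+ x)) (λ d p → +-suc x d ∙ +-congʳ p ∙ ≐-sym (suc+ d x))

  +-assoc : ∀ x y z → (x + y) + z ≐ x + (y + z)
  +-assoc x y = induction {0} ((v1 ⊕ v2) ⊕ v0 ≈ᵇ v1 ⊕ (v2 ⊕ v0)) ∅ (x ▹ y ▹ ∅)
    (+-zero _ ∙ +-congˡ (≐-sym (+-zero y)))
    (λ d p → +-suc _ d ∙ +-congʳ p ∙ ≐-sym (+-suc x _) ∙ +-congˡ (≐-sym (+-suc y d)))

  +-swap : ∀ a b c d → (a + b) + (c + d) ≐ (a + c) + (b + d)
  +-swap a b c d = +-assoc a b _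
    ∙ +-congˡ (≐-sym (+-assoc b c d) ∙ +-congʳ (+-comm b c) ∙ +-assoc c b d) ∙ ≐-sym (+-assoc a c _)

  0* : ∀ x → 0# * x ≐ 0#
  0* = induction {0} (𝟎 ⊗ v0 ≈ᵇ 𝟎) ∅ ∅ (*-zero 0#) (λ d p → *-suc 0# d ∙ +-zero _ ∙ p)

  suc* : ∀ x y → (x + 1#) * y ≐ x * y + y
  suc* x = induction {0} ((v1 ⊕ 𝟏) ⊗ v0 ≈ᵇ v1 ⊗ v0 ⊕ v0) ∅ (x ▹ ∅)
    (*-zero _ ∙ ≐-sym (+-zero _ ∙ *-zero x))
    (λ d p → *-suc _ d ∙ +-congʳ p ∙ +-swap _ d x 1# ∙ +-congʳ (≐-sym (*-suc x d)))

  *-comm : ∀ x y → x * y ≐ y * x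
  *-comm x = induction {0} (v1 ⊗ v0 ≈ᵇ v0 ⊗ v1) ∅ (x ▹ ∅)
    (*-zero x ∙ ≐-sym (0* x)) (λ d p → *-suc x d ∙ +-congʳ p ∙ ≐-sym (suc* d x))

  *-distribˡ-+ : ∀ x y z → x * (y + z) ≐ x * y + x * z
  *-distribˡ-+ x y = induction {0} (v1 ⊗ (v2 ⊕ v0) ≈ᵇ v1 ⊗ v2 ⊕ v1 ⊗ v0) ∅ (x ▹ y ▹ ∅)
    (*-cong ≐-refl (+-zero y) ∙ ≐-sym (+-congˡ (*-zero x) ∙ +-zero _))
    (λ d p → *-cong ≐-refl (+-suc y d) ∙ *-suc x _ ∙ +-congʳ p ∙ +-assoc _ _ x
           ∙ +-congˡ (≐-sym (*-suc x d)))

  *-distribʳ-+ : ∀ x y z → (y + z) * x ≐ y * x + z * x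
  *-distribʳ-+ x y z = *-comm _ x ∙ *-distribˡ-+ x y z ∙ +-cong (*-comm x y) (*-comm x z)

  *-assoc : ∀ x y z → (x * y) * z ≐ x * (y * z)
  *-assoc x y = induction {0} ((v1 ⊗ v2) ⊗ v0 ≈ᵇ v1 ⊗ (v2 ⊗ v0)) ∅ (x ▹ y ▹ ∅)
    (*-zero _ ∙ ≐-sym (*-cong ≐-refl (*-zero y) ∙ *-zero x))
    (λ d p → *-suc _ d ∙ +-congʳ p ∙ ≐-sym (*-distribˡ-+ x _ y) ∙ *-cong ≐-refl (≐-sym (*-suc y d)))

  *1 : ∀ x → x * 1# ≐ x
  *1 x = *-cong ≐-refl (≐-sym (0+ 1#)) ∙ *-suc x 0# ∙ +-congʳ (*-zero x) ∙ 0+ x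

  semiring : CommutativeSemiring _ _
  semiring = record
    { Carrier = D ; _≈_ = _≐_ ; _+_ = _+_ ; _*_ = _*_ ; 0# = 0# ; 1# = 1#
    ; isCommutativeSemiring = record
      { isSemiring = record
        { isSemiringWithoutAnnihilatingZero = record
          { +-isCommutativeMonoid = record
            { isMonoid = record
              { isSemigroup = record
                { isMagma = record { isEquivalence = record { refl = ≐-refl ; sym = ≐-sym ; trans = ≐-trans }
                                   ; ∙-cong = +-cong }
                ; assoc = +-assoc }
              ; identity = 0+ , +-zero }
            ; comm = +-comm }
          ; *-cong = *-cong
          ; *-assoc = *-assoc
          ; *-identity = (λ x → *-comm 1# x ∙ *1 x) , *1
          ; distrib = *-distribˡ-+ , *-distribʳ-+ }
        ; zero = 0* , *-zero }
      ; *-comm = *-comm } }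

  open NaturalSolver semiring public using (solve; _:+_; _:*_; _:=_; con)

  +-cancelʳ : ∀ {x y} z → x + z ≐ y + z → x ≐ y
  +-cancelʳ {x} {y} = induction {0} (v1 ⊕ v0 ≈ᵇ v2 ⊕ v0 ⇒ᵇ v1 ≈ᵇ v2) ∅ (x ▹ y ▹ ∅)
    (λ p → ≐-sym (+-zero x) ∙ p ∙ +-zero y)
    (λ d ih p → ih (suc-injᴹ (≐-sym (+-suc x d) ∙ p ∙ +-suc y d)))

  +-cancelˡ : ∀ {x y} z → z + x ≐ z + y → x ≐ y
  +-cancelˡ z p = +-cancelʳ z (+-comm _ z ∙ p ∙ +-comm z _)

  zero-or-suc : ∀ x → M (x ≐ 0# ⊎ Σ[ y ∈ D ] x ≐ y + 1#)
  zero-or-suc x = do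
    y , c ← induction-Σ₁ {0} (v1 ≈ᵇ 𝟎 ∨ᵇ v1 ≈ᵇ v0 ⊕ 𝟏) ∅ ∅ (η (0# , η (inj₁ ≐-refl)))
              (λ d _ _ → η (d , η (inj₂ ≐-refl))) x
    inj₂ p ← c
      where inj₁ p → η (inj₁ p)
    η (inj₂ (y , p))

  <-+suc : ∀ x z → x < x + (z + 1#)
  <-+suc x = induction {0} (v1 ≺ᵇ v1 ⊕ (v0 ⊕ 𝟏)) ∅ (x ▹ ∅)
    (<-resp ≐-refl (+-congˡ (≐-sym (0+ 1#))) (proj₂ <-suc (η (inj₂ ≐-refl))))
    (λ d p → <-resp ≐-refl (≐-sym (+-suc x _)) (proj₂ <-suc (η (inj₁ p))))

  -- The axioms describe `<` only at zero and successors. Turning it into an equation makes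
  -- transitivity and irreflexivity matters of semiring algebra.
  <-difference : ∀ {x y} → x < y → Ex (λ z → y ≐ x + (z + 1#))
  <-difference {x} {y} p = do
    z , f ← induction-Σ₁ {0} (v2 ≺ᵇ v1 ⇒ᵇ v1 ≈ᵇ v2 ⊕ (v0 ⊕ 𝟏)) ∅ (x ▹ ∅)
      (η (0# , λ q → absurd (≮0 q))) step y
    η (z , f p)
    where
    step : ∀ d z → (x < d → d ≐ x + (z + 1#)) → Ex (λ z → x < d + 1# → d + 1# ≐ x + (z + 1#))
    step d z ih = do
      inj₁ q ← em (x < d)
        where inj₂ ¬q → η (0# , λ r → proj₁ <-suc r >>= λ where
                (inj₁ q) → absurd (¬q q)
                (inj₂ e) → +-cong (≐-sym e) (≐-sym (0+ 1#)))
      η (z + 1# , λ _ → +-congʳ (ih q) ∙ ≐-sym (+-suc x _))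

  -- x ≤ y is x < y + 1, the form in which it bounds quantifiers.
  infix 4 _≤_
  _≤_ : D → D → Set
  x ≤ y = x < y + 1#

  ≤-+ : ∀ x z → x ≤ x + z
  ≤-+ x z = <-resp ≐-refl (≐-sym (+-assoc x z 1#)) (<-+suc x z)

  ≤-difference : ∀ {x y} → x ≤ y → Ex (λ z → y ≐ x + z)
  ≤-difference {x} p = do
    z , e ← <-difference p
    η (z , suc-injᴹ (e ∙ ≐-sym (+-assoc x z 1#)))

  <⇒≤ : ∀ {x y} → x < y → x ≤ y
  <⇒≤ p = proj₂ <-suc (η (inj₁ p))

  ≤-reflexive : ∀ {x y} → x ≐ y → x ≤ y
  ≤-reflexive p = proj₂ <-suc (η (inj₂ p))

  ≤-refl : ∀ {x} → x ≤ x
  ≤-refl = ≤-reflexive ≐-refl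

  ≤-split : ∀ {x y} → x ≤ y → M (x < y ⊎ x ≐ y)
  ≤-split = proj₁ <-suc

  ≤-≐ : ∀ {x y z} → x ≤ y → y ≐ z → x ≤ z
  ≤-≐ p e = <-resp ≐-refl (+-congʳ e) p

  <-≤-trans : ∀ {x y z} → x < y → y ≤ z → x < z
  <-≤-trans {x} p q = do
    a , e ← <-difference p
    b , f ← ≤-difference q
    <-resp ≐-refl
      (solve 3 (λ x a b → x :+ (a :+ b :+ con 1) := x :+ (a :+ con 1) :+ b) ≐-refl x a b
        ∙ +-congʳ (≐-sym e) ∙ ≐-sym f) (<-+suc x (a + b))

  <-trans : ∀ {x y z} → x < y → y < z → x < z
  <-trans p q = <-≤-trans p (<⇒≤ q)

  ≤-<-trans : ∀ {x y z} → x ≤ y → y < z → x < z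
  ≤-<-trans p q = ≤-split p >>= λ where
    (inj₁ r) → <-trans r q
    (inj₂ e) → <-resp (≐-sym e) ≐-refl q

  <-irrefl : ∀ {x} → x < x → A
  <-irrefl {x} p = do
    z , e ← <-difference p
    suc≢0ᴹ (≐-sym (+-cancelˡ x (+-zero x ∙ e)))

  <⇒≢ : ∀ {x y} → x < y → x ≐ y → A
  <⇒≢ p e = <-irrefl (<-resp e ≐-refl p)

  <-asym : ∀ {x y} → x < y → y < x → A
  <-asym p q = <-irrefl (<-trans p q)

  ≤⇒≯ : ∀ {x y} → x ≤ y → y < x → A
  ≤⇒≯ p q = <-irrefl (≤-<-trans p q)

  0≤ : ∀ {x} → 0# ≤ x
  0≤ {x} = ≤-≐ (≤-+ 0# x) (0+ x)

  suc-≤ : ∀ {x y} → x < y → x + 1# ≤ y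
  suc-≤ {x} p = do
    z , e ← <-difference p
    ≤-≐ (≤-+ (x + 1#) z)
      (solve 2 (λ x z → x :+ con 1 :+ z := x :+ (z :+ con 1)) ≐-refl x z ∙ ≐-sym e)

  ≤-suc : ∀ {x y} → x + 1# ≤ y → x < y
  ≤-suc p = <-≤-trans ≤-refl p

  ≤-trans : ∀ {x y z} → x ≤ y → y ≤ z → x ≤ z
  ≤-trans p q = ≤-<-trans p q

  compare : ∀ x y → M (x < y ⊎ x ≐ y ⊎ y < x)
  compare x y = induction {0} (v1 ≺ᵇ v0 ∨ᵇ v1 ≈ᵇ v0 ∨ᵇ v0 ≺ᵇ v1) ∅ (x ▹ ∅) base step y
      >>= λ where
        (inj₁ p) → η (inj₁ p)
        (inj₂ h) → h >>= λ q → η (inj₂ q)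
    where
    base : M (x < 0# ⊎ M (x ≐ 0# ⊎ 0# < x))
    base = zero-or-suc x >>= λ where
      (inj₁ e)       → η (inj₂ (η (inj₁ e)))
      (inj₂ (y , e)) → η (inj₂ (η (inj₂ (<-resp ≐-refl (≐-sym e) 0≤))))
    step : ∀ d → M (x < d ⊎ M (x ≐ d ⊎ d < x)) → M (x < d + 1# ⊎ M (x ≐ d + 1# ⊎ d + 1# < x))
    step d ih = do
      inj₂ h ← ih
        where inj₁ p → η (inj₁ (<⇒≤ p))
      inj₂ q ← h
        where inj₁ e → η (inj₁ (≤-reflexive e))
      inj₁ r ← ≤-split (suc-≤ q)
        where inj₂ e → η (inj₂ (η (inj₁ (≐-sym e))))
      η (inj₂ (η (inj₂ r)))

  ≮⇒≥ : ∀ {x y} → (x < y → A) → y ≤ x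
  ≮⇒≥ {x} {y} h = compare x y >>= λ where
    (inj₁ p)        → absurd (h p)
    (inj₂ (inj₁ e)) → ≤-reflexive (≐-sym e)
    (inj₂ (inj₂ q)) → <⇒≤ q

  -- `Ex` unfolds, so the proof starts from the assumption `none` that there is no least element;
  -- induction then empties every initial segment.
  least : ∀ {X x} → x ∈ˢ X → Ex (λ y → y ∈ˢ X × (∀ z → z < y → z ∈ˢ X → A))
  least {X} {x} p none = none-below (x + 1#) x ≤-refl p
    where
    none-below : ∀ d z → z < d → z ∈ˢ X → A
    none-below = induction {1} (∀< v0 · ~ᵇ (v0 ∊ᵇ zero)) (X ▹ ∅) ∅
      (λ z q → absurd (≮0 q))
      (λ d ih z q r → ≤-split q >>= λ where
        (inj₁ s) → ih z s r
        (inj₂ e) → none (z , r , λ y t → ih y (<-resp ≐-refl e t)))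

  ≤-+ʳ : ∀ x z → x ≤ z + x
  ≤-+ʳ x z = ≤-≐ (≤-+ x z) (+-comm x z)

  ⟨_,_⟩ : D → D → D
  ⟨ x , y ⟩ = (x + y) * (x + y) + x

  ⟨,⟩-cong : ∀ {x x′ y y′} → x ≐ x′ → y ≐ y′ → ⟨ x , y ⟩ ≐ ⟨ x′ , y′ ⟩
  ⟨,⟩-cong p q = +-cong (*-cong (+-cong p q) (+-cong p q)) p

  fst≤ : ∀ x y → x ≤ ⟨ x , y ⟩
  fst≤ x y = ≤-+ʳ x _

  snd≤ : ∀ x y → y ≤ ⟨ x , y ⟩
  snd≤ x y = zero-or-suc y >>= λ where
    (inj₁ e)       → <-resp (≐-sym e) ≐-refl 0≤
    -- For y = z + 1 the surplus of (x + y)² + x over y is x + (x + z)(x + z + 1) + x; the successor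
    -- form avoids subtraction.
    (inj₂ (z , e)) → ≤-≐ (≤-+ y (x + (x + z) * (x + z + 1#) + x))
      (+-congʳ e ∙
       solve 2 (λ x z → z :+ con 1 :+ (x :+ (x :+ z) :* (x :+ z :+ con 1) :+ x)
                     := (x :+ (z :+ con 1)) :* (x :+ (z :+ con 1)) :+ x) ≐-refl x z
       ∙ ⟨,⟩-cong ≐-refl (≐-sym e))

  -- Between consecutive squares s² and (s + 1)² there is room for s² + x with x ≤ s.
  pair-sum : ∀ {x y x′ y′} → x + y < x′ + y′ → ⟨ x , y ⟩ ≐ ⟨ x′ , y′ ⟩ → A
  pair-sum {x} {y} {x′} {y′} p e = do
    z , f ← <-difference p
    let s  = x + y
        e′ : s * s + x ≐ (s + (z + 1#)) * (s + (z + 1#)) + x′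
        e′ = e ∙ +-congʳ (*-cong f f)
        h : 0# ≐ ((x + y) * (z + z + 1#) + y + z * z + z + z + x′) + 1#
        h = +-cancelˡ (s * s + x) (+-zero _ ∙ e′ ∙ solve 4 (λ x y z w →
              (x :+ y :+ (z :+ con 1)) :* (x :+ y :+ (z :+ con 1)) :+ w
              := (x :+ y) :* (x :+ y) :+ x
                 :+ ((x :+ y) :* (z :+ z :+ con 1) :+ y :+ z :* z :+ z :+ z :+ w :+ con 1)) ≐-refl x y z x′)
    suc≢0ᴹ (≐-sym h)

  ⟨,⟩-injective : ∀ {x y x′ y′} → ⟨ x , y ⟩ ≐ ⟨ x′ , y′ ⟩ → x ≐ x′ × y ≐ y′
  ⟨,⟩-injective {x} {y} {x′} {y′} e = compare (x + y) (x′ + y′) >>= λ where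
    (inj₁ p)        → absurd (pair-sum p e)
    (inj₂ (inj₂ p)) → absurd (pair-sum p (≐-sym e))
    (inj₂ (inj₁ s)) →
      let f = +-cancelˡ ((x + y) * (x + y)) (e ∙ +-congʳ (≐-sym (*-cong s s)))
      in f , +-cancelˡ x (s ∙ +-congʳ (≐-sym f))

-- Functions as graphs, and comprehension for binary relations.

module Relations (𝔐 : Model RCA₀) where
  open Arithmetic 𝔐 public

  Relation : S → Set
  Relation R = ∀ d → d ∈ˢ R → Ex λ x → Ex λ y → d ≐ ⟨ x , y ⟩

  Function : S → Set
  Function F = Relation F × (∀ n → Ex λ x → ⟨ n , x ⟩ ∈ˢ F × (∀ y → ⟨ n , y ⟩ ∈ˢ F → y ≐ x))

  related : ∀ {R x x′ y y′} → x ≐ x′ → y ≐ y′ → ⟨ x , y ⟩ ∈ˢ R → ⟨ x′ , y′ ⟩ ∈ˢ R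
  related p q = ∈-resp (⟨,⟩-cong p q)

  value : ∀ {F} → Function F → ∀ n → Ex λ x → ⟨ n , x ⟩ ∈ˢ F
  value (_ , f) n = do
    x , p , _ ← f n
    η (x , p)

  functional : ∀ {F} → Function F → ∀ {n x y} → ⟨ n , x ⟩ ∈ˢ F → ⟨ n , y ⟩ ∈ˢ F → x ≐ y
  functional (_ , f) {n} p q = do
    _ , _ , u ← f n
    u _ p ∙ ≐-sym (u _ q)

  function : ∀ {F} → Relation F → (∀ n → Ex λ x → ⟨ n , x ⟩ ∈ˢ F) →
             (∀ {n x y} → ⟨ n , x ⟩ ∈ˢ F → ⟨ n , y ⟩ ∈ˢ F → x ≐ y) → Function F
  function r v u = r , λ n → v n >>= λ (x , p) → η (x , p , λ y q → u q p)

  -- From a formula in z, y, x to one in z, p saying that p is the code of such a pair (x , y).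
  onPairs : Bounded m (suc (suc (suc n))) → Bounded m (suc (suc n))
  onPairs b = ∃< v1 ⊕ 𝟏 · ∃< v2 ⊕ 𝟏 · (v3 ≈ᵇ pair v1 v0 ∧ᵇ substᵇ id reorder b)
    where
    reorder : Fin (suc (suc (suc n))) → Term (suc (suc (suc (suc n))))
    reorder zero                = v2
    reorder (suc zero)          = v0
    reorder (suc (suc zero))    = v1
    reorder (suc (suc (suc i))) = var (suc (suc (suc (suc i))))

  ⟪onPairs⟫ : (b : Bounded m (suc (suc (suc n)))) → ∀ {σ ρ z p} →
    ⟪ onPairs b ⟫ σ (z ▹ p ▹ ρ) ↔ (Ex λ x → Ex λ y → p ≐ ⟨ x , y ⟩ × ⟪ b ⟫ σ (z ▹ y ▹ x ▹ ρ))
  ⟪onPairs⟫ {n = n} b {σ} {ρ} {z} {p} =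
    (λ h → do
      x , _ , h′ ← h
      y , _ , e , q ← h′
      η (x , η (y , e , proj₁ (⟦subst⟧ (λ _ → ≡.refl) env (proj₁ b)) q))) ,
    (λ h → do
      x , h′ ← h
      y , e , q ← h′
      η (x , ≤-≐ (fst≤ x y) (≐-sym e) , η (y , ≤-≐ (snd≤ x y) (≐-sym e) , e ,
        proj₂ (⟦subst⟧ (λ _ → ≡.refl) env (proj₁ b)) q)))
    where
    env : ∀ {x y} i → _ ≐ (z ▹ y ▹ x ▹ ρ) i
    env zero                = ≐-refl
    env (suc zero)          = ≐-refl
    env (suc (suc zero))    = ≐-refl
    env (suc (suc (suc i))) = ≐-refl

  -- The formulas are moved to codes by `onPairs`. At a number that codes no pair both resulting
  -- formulas fail, so the Δ₁ equivalence extends to all numbers.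
  relation-comprehension-Δ₁ : (b c : Bounded m (suc (suc (suc n)))) → ∀ σ ρ →
    (∀ x y → Ex (λ z → ⟪ b ⟫ σ (z ▹ y ▹ x ▹ ρ)) ↔ (∀ z → ⟪ c ⟫ σ (z ▹ y ▹ x ▹ ρ))) →
    Ex λ R → Relation R × (∀ x y → ⟨ x , y ⟩ ∈ˢ R ↔ Ex (λ z → ⟪ b ⟫ σ (z ▹ y ▹ x ▹ ρ)))
  relation-comprehension-Δ₁ b c σ ρ h = do
    R , e ← comprehension-Δ₁ (onPairs b) (onPairs c) σ ρ equivalent
    η (R , (λ d p → do
              z , q ← proj₁ (e d) p
              x , q′ ← proj₁ (⟪onPairs⟫ b) q
              y , f , _ ← q′
              η (x , η (y , f)))
         , λ x y →
           (λ p → do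
              z , q ← proj₁ (e _) p
              x′ , q′ ← proj₁ (⟪onPairs⟫ b) q
              y′ , f , r ← q′
              η (z , moved b f r)) ,
           (λ p → p >>= λ (z , q) → proj₂ (e _) (η (z , proj₂ (⟪onPairs⟫ b) (η (x , η (y , ≐-refl , q)))))))
    where
    moved : (b : Bounded _ _) → ∀ {x y x′ y′ z} → ⟨ x , y ⟩ ≐ ⟨ x′ , y′ ⟩ →
            ⟪ b ⟫ σ (z ▹ y′ ▹ x′ ▹ ρ) → ⟪ b ⟫ σ (z ▹ y ▹ x ▹ ρ)
    moved b {x} {y} {x′} {y′} {z} f = ⟦resp⟧ (proj₁ b) env
      where
      env : ∀ i → (z ▹ y′ ▹ x′ ▹ ρ) i ≐ (z ▹ y ▹ x ▹ ρ) i
      env zero                = ≐-refl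
      env (suc zero)          = ≐-sym (proj₂ (⟨,⟩-injective f))
      env (suc (suc zero))    = ≐-sym (proj₁ (⟨,⟩-injective f))
      env (suc (suc (suc i))) = ≐-refl
    equivalent : ∀ p → Ex (λ z → ⟪ onPairs b ⟫ σ (z ▹ p ▹ ρ)) ↔ (∀ z → ⟪ onPairs c ⟫ σ (z ▹ p ▹ ρ))
    equivalent p =
      (λ q z → proj₂ (⟪onPairs⟫ c) (do
        z′ , r ← q
        x , r′ ← proj₁ (⟪onPairs⟫ b) r
        y , f , s ← r′
        η (x , η (y , f , proj₁ (h x y) (η (z′ , s)) z)))) ,
      (λ q → do
        -- Any instance shows that `p` codes a pair; 0 is as good as another. The decodings at other
        -- z agree with it by injectivity of pairing.
        x , r ← proj₁ (⟪onPairs⟫ c) (q 0#)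
        y , f , _ ← r
        z , s ← proj₂ (h x y) (λ z → _>>=_ {{⟪⟫-stable c σ (z ▹ y ▹ x ▹ ρ)}} (proj₁ (⟪onPairs⟫ c) (q z))
                  (λ (x′ , r) → _>>=_ {{⟪⟫-stable c σ (z ▹ y ▹ x ▹ ρ)}} r
                  (λ (y′ , f′ , s) → moved c (≐-sym f ∙ f′) s)))
        η (z , proj₂ (⟪onPairs⟫ b) (η (x , η (y , f , s)))))

  relation-comprehension : (b : Bounded m (suc (suc n))) → ∀ σ ρ →
    Ex λ R → Relation R × (∀ x y → ⟨ x , y ⟩ ∈ˢ R ↔ ⟪ b ⟫ σ (y ▹ x ▹ ρ))
  relation-comprehension b σ ρ = do
    R , r , e ← relation-comprehension-Δ₁ (wkᵇ b) (wkᵇ b) σ ρ (λ x y →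
      (λ p z → proj₂ (⟪wkᵇ⟫ b) (strip x y p)) ,
      (λ f → η (0# , f 0#)))
    η (R , r , λ x y → (λ p → strip x y (proj₁ (e x y) p)) , (λ p → proj₂ (e x y) (η (0# , proj₂ (⟪wkᵇ⟫ b) p))))
    where
    strip : ∀ x y → Ex (λ z → ⟪ wkᵇ b ⟫ σ (z ▹ y ▹ x ▹ ρ)) → ⟪ b ⟫ σ (y ▹ x ▹ ρ)
    strip x y p = _>>=_ {{⟪⟫-stable b σ (y ▹ x ▹ ρ)}} p (λ (z , q) → proj₁ (⟪wkᵇ⟫ b) q)

-- Coding finite sets by divisibility.

-- A finite set of numbers below N is coded by a and b, where k belongs to the set when
-- 1 + (k + 1) b divides a; these moduli are coprime once b is divisible by 1, …, N.
module FiniteSets (𝔐 : Model RCA₀) where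
  open Relations 𝔐 public

  infix 4 _∣ᴰ_
  _∣ᴰ_ : D → D → Set
  x ∣ᴰ y = Ex λ q → y ≐ q * x

  ∣-≐ : ∀ {x y y′} → y ≐ y′ → x ∣ᴰ y → x ∣ᴰ y′
  ∣-≐ e p = p >>= λ (q , f) → η (q , ≐-sym e ∙ f)

  ∣-* : ∀ {x y} z → x ∣ᴰ y → x ∣ᴰ y * z
  ∣-* {x} {y} z p = do
    q , e ← p
    η (q * z , *-cong e ≐-refl ∙ solve 3 (λ q x z → q :* x :* z := q :* z :* x) ≐-refl q x z)

  +-zero-left : ∀ {x y} → x + y ≐ 0# → x ≐ 0#
  +-zero-left {x} {y} e = zero-or-suc x >>= λ where
    (inj₁ p)       → p
    (inj₂ (z , p)) → absurd (suc≢0ᴹ (≐-sym (suc+ z y) ∙ +-congʳ (≐-sym p) ∙ e))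

  -- The quotient of `y` is the difference of the two given quotients; when that difference would be
  -- negative, `y` is 0.
  ∣-+-cancel : ∀ {d x y} → d ∣ᴰ x + y → d ∣ᴰ x → d ∣ᴰ y
  ∣-+-cancel {d} {x} {y} p q = do
    r , e ← p
    s , f ← q
    inj₂ s≮r ← em (r < s)
      where inj₁ r<s → do
              t , g ← <-difference r<s
              η (0# , +-zero-left (+-cancelˡ x (≐-sym (+-assoc x y (d * (t + 1#))) ∙ +-congʳ e
                        ∙ solve 3 (λ r d t → r :* d :+ d :* t := (r :+ t) :* d) ≐-refl r d (t + 1#)
                        ∙ *-cong (≐-sym g) ≐-refl ∙ ≐-sym f ∙ ≐-sym (+-zero x))) ∙ ≐-sym (0* d))
    t , g ← ≤-difference (≮⇒≥ s≮r)
    η (t , +-cancelˡ x (e ∙ *-cong g ≐-refl ∙ *-distribʳ-+ d s t ∙ +-congʳ (≐-sym f)))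

  modulus : D → D → D
  modulus b k = 1# + (k + 1#) * b

  -- Modulo 1 + u, where u = (i + 1) b, the number b is invertible, hence so is every d
  -- dividing it; this is applied to d = |i - j|, and d b is the difference of the moduli.
  ∣-unit : ∀ {a b i d} → d ∣ᴰ b → modulus b i ∣ᴰ a * (d * b) → modulus b i ∣ᴰ a
  ∣-unit {a} {b} {i} {d} p q = do
    e , f ← p
    -- With m = 1 + u, the identity 2am + au² = am² + a exhibits a as a difference of multiples of
    -- m: au² is a multiple of abb, hence of a(db), because d divides b.
    ∣-+-cancel
      (∣-≐ (solve 3 (λ a b i → let m = con 1 :+ (i :+ con 1) :* b in
              m :* (a :+ a) :+ a :* b :* b :* ((i :+ con 1) :* (i :+ con 1)) := a :* m :* m :+ a) ≐-refl a b i)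
           (∣-sum (η (a + a , *-comm _ _)) (∣-* _ (∣-≐ (*-assoc a _ _ ∙ *-cong ≐-refl (solve 3 (λ b d e →
              d :* b :* e := e :* d :* b) ≐-refl b d e ∙ *-cong (≐-sym f) ≐-refl) ∙ ≐-sym (*-assoc a b b)) (∣-* e q)))))
      (η (a * modulus b i , ≐-refl))
    where
    ∣-sum : ∀ {d x y} → d ∣ᴰ x → d ∣ᴰ y → d ∣ᴰ x + y
    ∣-sum {d} p q = do
      r , e ← p
      s , f ← q
      η (r + s , +-cong e f ∙ ≐-sym (*-distribʳ-+ d r s))

  -- `d` is the distance of `i` and `j`, the disjunction standing in for an absolute value. The
  -- larger modulus is the smaller plus db, so in both cases the modulus of `i` divides a(db).
  moduli-coprime : ∀ {a b i j d} → M (j ≐ i + d ⊎ i ≐ j + d) → d ∣ᴰ b →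
                   modulus b i ∣ᴰ a * modulus b j → modulus b i ∣ᴰ a
  moduli-coprime {a} {b} {i} {j} {d} c p q = ∣-unit p (c >>= λ where
    (inj₁ e) → ∣-+-cancel
      (∣-≐ (*-cong ≐-refl (+-congˡ (*-cong (+-congʳ e) ≐-refl))
            ∙ solve 4 (λ a b i d → a :* (con 1 :+ (i :+ d :+ con 1) :* b)
                := a :* (con 1 :+ (i :+ con 1) :* b) :+ a :* (d :* b)) ≐-refl a b i d) q)
      (η (a , ≐-refl))
    (inj₂ e) → ∣-+-cancel
      (∣-≐ (*-cong ≐-refl (+-congˡ (*-cong (+-congʳ e) ≐-refl))
            ∙ solve 4 (λ a b i d → a :* (con 1 :+ (i :+ d :+ con 1) :* b)
                := a :* (con 1 :+ (i :+ con 1) :* b) :+ a :* (d :* b)) ≐-refl a b j d)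
           (η (a , ≐-refl)))
      q)

  -- Bounds the search for a quotient, which makes divisibility by a modulus a Δ₀ condition.
  quotient≤ : ∀ {x q w} → x ≐ q * (1# + w) → q ≤ x
  quotient≤ {x} {q} {w} e = ≤-≐ (≤-+ q (q * w))
    (solve 2 (λ q w → q :+ q :* w := q :* (con 1 :+ w)) ≐-refl q w ∙ ≐-sym e)

  -- The number built is N!. Its positivity will make every modulus exceed 1.
  common-multiple : ∀ N → Ex λ b → 0# < b × (∀ d → d < N → d + 1# ∣ᴰ b)
  common-multiple N = do
    b , p , h ← induction-Σ₁ {0} (𝟎 ≺ᵇ v0 ∧ᵇ (∀< v1 · ∃< v1 ⊕ 𝟏 · v2 ≈ᵇ v0 ⊗ (v1 ⊕ 𝟏))) ∅ ∅
      (η (1# , <-resp ≐-refl (0+ 1#) 0≤ , λ d p → absurd (≮0 p)))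
      (λ n b (p , h) → η (b * (n + 1#)
        , positive p
        , λ d q → bounded (≤-split q >>= λ where
            (inj₁ r) → h d r >>= λ (q , _ , e) → ∣-* (n + 1#) (η (q , e))
            (inj₂ e) → η (b , *-cong ≐-refl (+-congʳ (≐-sym e))))))
      N
    η (b , p , λ d q → h d q >>= λ (r , _ , e) → η (r , e))
    where
    positive : ∀ {b n} → 0# < b → 0# < b * (n + 1#)
    positive {b} {n} p = do
      c , e ← <-difference p
      <-resp ≐-refl (solve 2 (λ c n → con 0 :+ (c :* (n :+ con 1) :+ n :+ con 1) := (con 0 :+ (c :+ con 1)) :* (n :+ con 1)) ≐-refl c n
                     ∙ *-cong (≐-sym e) ≐-refl) (<-+suc 0# _)
    bounded : ∀ {b d} → d + 1# ∣ᴰ b → Ex λ q → q ≤ b × b ≐ q * (d + 1#)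
    bounded {b} {d} h = do
      q , e ← h
      η (q , quotient≤ (e ∙ *-cong ≐-refl (+-comm d 1#)) , e)

  infixr 11 _⟺ᵇ_
  _⟺ᵇ_ : Bounded m n → Bounded m n → Bounded m n
  φ ⟺ᵇ ψ = (φ ⇒ᵇ ψ) ∧ᵇ (ψ ⇒ᵇ φ)

  bounded-divisor : ∀ {a b k} → modulus b k ∣ᴰ a → Ex λ q → q ≤ a × a ≐ q * modulus b k
  bounded-divisor h = h >>= λ (q , e) → η (q , quotient≤ e , e)

  unbounded-divisor : ∀ {a b k} → Ex (λ q → q ≤ a × a ≐ q * modulus b k) → modulus b k ∣ᴰ a
  unbounded-divisor h = h >>= λ (q , _ , e) → η (q , e)

  -- Candidates x are treated in turn: if x is in `Z`, multiply by its modulus. By coprimality this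
  -- leaves divisibility by the other moduli unchanged.
  code-below : ∀ Z N → Ex λ a → Ex λ b → ∀ k → k < N → modulus b k ∣ᴰ a ↔ k ∈ˢ Z
  code-below Z N = do
    b , 0<b , multiple ← common-multiple N
    let step : ∀ x a →
               (∀ k → k < N → Ex (λ q → q ≤ a × a ≐ q * modulus b k) ↔ (k < x × k ∈ˢ Z)) →
               Ex (λ a → ∀ k → k < N → Ex (λ q → q ≤ a × a ≐ q * modulus b k) ↔ (k < x + 1# × k ∈ˢ Z))
        step x a h = do
          -- Elements from N on are skipped, since b is known to be divisible only by distances up
          -- to N.
          inj₁ (x<N , x∈Z) ← em (x < N × x ∈ˢ Z)
            where inj₂ new → η (a , λ k k<N →
                    (λ p → let k<x , k∈Z = proj₁ (h k k<N) p in <⇒≤ k<x , k∈Z) ,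
                    (λ (k≤x , k∈Z) → ≤-split k≤x >>= λ where
                      (inj₁ k<x) → proj₂ (h k k<N) (k<x , k∈Z)
                      (inj₂ e)   → absurd (new (<-resp e ≐-refl k<N , ∈-resp e k∈Z))))
          let difference<N : ∀ {i j d} → i < N → i ≐ j + (d + 1#) → d < N
              difference<N {i} {j} {d} i<N e = ≤-<-trans (≤-≐ (≤-+ d (j + 1#))
                (solve 2 (λ d j → d :+ (j :+ con 1) := j :+ (d :+ con 1)) ≐-refl d j ∙ ≐-sym e)) i<N
          η (a * modulus b x , λ k k<N →
            (λ p → compare k x >>= λ where
              (inj₁ k<x) → <-difference k<x >>= λ (d , e) →
                let _ , k∈Z = proj₁ (h k k<N) (bounded-divisor (moduli-coprime (η (inj₁ e))
                                (multiple d (difference<N x<N e)) (unbounded-divisor p)))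
                in <⇒≤ k<x , k∈Z
              (inj₂ (inj₁ e)) → ≤-reflexive e , ∈-resp (≐-sym e) x∈Z
              (inj₂ (inj₂ x<k)) → <-difference x<k >>= λ (d , e) →
                let k<x , _ = proj₁ (h k k<N) (bounded-divisor (moduli-coprime (η (inj₂ e))
                                (multiple d (difference<N k<N e)) (unbounded-divisor p)))
                in absurd (<-asym x<k k<x)) ,
            (λ (k≤x , k∈Z) → bounded-divisor (≤-split k≤x >>= λ where
              (inj₁ k<x) → ∣-* _ (unbounded-divisor (proj₂ (h k k<N) (k<x , k∈Z)))
              (inj₂ e)   → η (a , *-cong ≐-refl (+-congˡ (*-cong (+-congʳ (≐-sym e)) ≐-refl))))))
        base : ∀ k → k < N → Ex (λ q → q ≤ 1# × 1# ≐ q * modulus b k) ↔ (k < 0# × k ∈ˢ Z)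
        base k k<N = (λ p → absurd (no-divisor 0<b (unbounded-divisor p))) , (λ (p , _) → absurd (≮0 p))
    a , h ← induction-Σ₁ {1}
      (∀< v2 · (∃< v1 ⊕ 𝟏 · v2 ≈ᵇ v0 ⊗ (𝟏 ⊕ (v1 ⊕ 𝟏) ⊗ v5)) ⟺ᵇ (v0 ≺ᵇ v2 ∧ᵇ v0 ∊ᵇ zero))
      (Z ▹ ∅) (N ▹ b ▹ ∅) (η (1# , base)) step N
    η (a , η (b , λ k k<N →
      (λ p → proj₂ (proj₁ (h k k<N) (bounded-divisor p))) ,
      (λ k∈Z → unbounded-divisor (proj₂ (h k k<N) (k<N , k∈Z)))))
    where
    no-divisor : ∀ {b k} → 0# < b → modulus b k ∣ᴰ 1# → A
    no-divisor {b} {k} p h = do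
      c , e ← <-difference p
      q , f ← h
      inj₂ (r , g) ← zero-or-suc q
        where inj₁ g → suc≢0ᴹ {0#} (0+ 1# ∙ f ∙ *-cong g ≐-refl ∙ 0* _)
      suc≢0ᴹ (≐-sym (suc-injᴹ (0+ 1# ∙ f ∙ *-cong g (+-congˡ (*-cong ≐-refl e))
        ∙ solve 3 (λ r k c → (r :+ con 1) :* (con 1 :+ (k :+ con 1) :* (con 0 :+ (c :+ con 1)))
            := r :+ r :* ((k :+ con 1) :* (c :+ con 1)) :+ k :* (c :+ con 1) :+ c :+ con 1 :+ con 1) ≐-refl r k c)))

  Coding : S → Set
  Coding E = (∀ {p s} → ⟨ p , s ⟩ ∈ˢ E → p < s) ×
             (∀ Z N → Ex λ s → ∀ p → ⟨ p , s ⟩ ∈ˢ E ↔ (p < N × p ∈ˢ Z))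

  coding : Ex Coding
  coding = do
    E , _ , e ← relation-comprehension {0}
      (∃< v0 ⊕ 𝟏 · ∃< v1 ⊕ 𝟏 · ∃< v2 ⊕ 𝟏 · (v3 ≈ᵇ pair (pair v2 v1) v0 ∧ᵇ v4 ≺ᵇ v0
        ∧ᵇ (∃< v2 ⊕ 𝟏 · v3 ≈ᵇ v0 ⊗ (𝟏 ⊕ (v5 ⊕ 𝟏) ⊗ v2)))) ∅ ∅
    η (E
      , (λ {p} {s} h → do
          a , _ , h₁ ← proj₁ (e p s) h
          b , _ , h₂ ← h₁
          N , N≤s , _ , p<N , _ ← h₂
          <-≤-trans p<N N≤s)
      , λ Z N → do
          a , h ← code-below Z N
          b , c ← h
          -- N belongs to the code because divisibility says nothing at k ≥ N; it also gives p < N ≤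
          -- s.
          let s = ⟨ ⟨ a , b ⟩ , N ⟩
          η (s , λ p →
            (λ q → do
              a′ , _ , h₁ ← proj₁ (e p s) q
              b′ , _ , h₂ ← h₁
              N′ , _ , f , p<N′ , d ← h₂
              let ab≐ , N≐ = ⟨,⟩-injective f
                  a≐ , b≐  = ⟨,⟩-injective ab≐
                  p<N      = <-resp ≐-refl (≐-sym N≐) p<N′
              p<N , proj₁ (c p p<N) (d >>= λ (q , _ , g) →
                η (q , a≐ ∙ g ∙ *-cong ≐-refl (+-congˡ (*-cong ≐-refl (≐-sym b≐)))))) ,
            (λ (p<N , p∈Z) → proj₂ (e p s)
              (η (a , ≤-trans (fst≤ a b) (fst≤ _ N) , η (b , ≤-trans (snd≤ a b) (fst≤ _ N) ,
                η (N , snd≤ _ N , ≐-refl , p<N , bounded-divisor (proj₂ (c p p<N) p∈Z)))))))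
      )

-- Iteration of a function and enumeration of unbounded sets.

module Iteration (𝔐 : Model RCA₀) where
  open FiniteSets 𝔐 public

  -- The graph is Δ₁: some computation contains (n , x), or equivalently every entry at n in any
  -- computation has value x. Agreement of computations gives one direction, their existence at
  -- every n the other.
  iteration : ∀ {G} → Function G → ∀ a → Ex λ F → Function F × ⟨ 0# , a ⟩ ∈ˢ F ×
              (∀ n x y → ⟨ n , x ⟩ ∈ˢ F → ⟨ x , y ⟩ ∈ˢ G → ⟨ n + 1# , y ⟩ ∈ˢ F)
  iteration {G} G-fun a = do
    E , E< , encode ← coding
    -- s ∈ C when s codes a finite partial function all of whose entries follow from earlier ones.
    C , C-def ← comprehension {2}
      (∀< v0 · ∀< v1 · (pair (pair v1 v0) v2 ∊ᵇ #0 ⇒ᵇ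
        (v1 ≈ᵇ 𝟎 ∧ᵇ v0 ≈ᵇ v3)
        ∨ᵇ (∃< v2 · ∃< v3 · (v3 ≈ᵇ v1 ⊕ 𝟏 ∧ᵇ pair (pair v1 v0) v4 ∊ᵇ #0 ∧ᵇ pair v0 v2 ∊ᵇ #1))))
      (E ▹ G ▹ ∅) (a ▹ ∅)
    let Justified : D → D → D → Set
        Justified s k x = (k ≐ 0# × x ≐ a) ⊎
          (Σ[ j ∈ D ] Σ[ w ∈ D ] k ≐ j + 1# × ⟨ ⟨ j , w ⟩ , s ⟩ ∈ˢ E × ⟨ w , x ⟩ ∈ˢ G)

        fst< : ∀ {k x s} → ⟨ ⟨ k , x ⟩ , s ⟩ ∈ˢ E → k < s
        fst< p = ≤-<-trans (fst≤ _ _) (E< p)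
        snd< : ∀ {k x s} → ⟨ ⟨ k , x ⟩ , s ⟩ ∈ˢ E → x < s
        snd< p = ≤-<-trans (snd≤ _ _) (E< p)

        entry : ∀ {s k x} → s ∈ˢ C → ⟨ ⟨ k , x ⟩ , s ⟩ ∈ˢ E → M (Justified s k x)
        entry s∈C p = proj₁ (C-def _) s∈C _ (fst< p) _ (snd< p) p >>= λ where
          (inj₁ q) → η (inj₁ q)
          (inj₂ h) → h >>= λ (j , _ , h′) → h′ >>= λ (w , _ , q) → η (inj₂ (j , w , q))

        justified : ∀ {s} → (∀ {k x} → ⟨ ⟨ k , x ⟩ , s ⟩ ∈ˢ E → M (Justified s k x)) → s ∈ˢ C
        justified h = proj₂ (C-def _) (λ k _ x _ p → h p >>= λ where
          (inj₁ q)           → η (inj₁ q)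
          (inj₂ (j , w , e , q , r)) →
            η (inj₂ (η (j , fst< q , η (w , snd< q , e , q , r)))))

        extend : ∀ {s k x} → s ∈ˢ C → M (Justified s k x) → Ex λ s′ → s′ ∈ˢ C × ⟨ ⟨ k , x ⟩ , s′ ⟩ ∈ˢ E
        extend {s} {k} {x} s∈C new = do
          Z , Z-def ← comprehension {1} (pair v0 v1 ∊ᵇ #0 ∨ᵇ v0 ≈ᵇ pair v2 v3) (E ▹ ∅) (s ▹ k ▹ x ▹ ∅)
          -- The bound exceeds the new entry and, by `E<`, every entry of s.
          s′ , s′-def ← encode Z (s + (⟨ k , x ⟩ + 1#))
          let old : ∀ {p} → ⟨ p , s ⟩ ∈ˢ E → ⟨ p , s′ ⟩ ∈ˢ E
              old p = proj₂ (s′-def _) (<-≤-trans (E< p) (≤-+ _ _) , proj₂ (Z-def _) (η (inj₁ p)))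
              still : ∀ {k x} → Justified s k x → Justified s′ k x
              still = λ { (inj₁ q) → inj₁ q ; (inj₂ (j , w , e , q , r)) → inj₂ (j , w , e , old q , r) }
              moved : ∀ {k′ x′} → k′ ≐ k → x′ ≐ x → Justified s k x → Justified s k′ x′
              moved e f = λ where
                (inj₁ (g , h))             → inj₁ (e ∙ g , f ∙ h)
                (inj₂ (j , w , g , q , r)) → inj₂ (j , w , e ∙ g , q , related ≐-refl (≐-sym f) r)
          η (s′
            , justified (λ p → proj₁ (Z-def _) (proj₂ (proj₁ (s′-def _) p)) >>= λ where
                (inj₁ q) → entry s∈C q >>= λ j → η (still j)
                (inj₂ e) → let e₁ , e₂ = ⟨,⟩-injective e in new >>= λ j → η (still (moved e₁ e₂ j)))
            , proj₂ (s′-def _) (<-≤-trans ≤-refl (≤-+ʳ _ s) , proj₂ (Z-def _) (η (inj₂ ≐-refl))))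

        agree : ∀ {s s′} → s ∈ˢ C → s′ ∈ˢ C → ∀ n {x x′} →
                ⟨ ⟨ n , x ⟩ , s ⟩ ∈ˢ E → ⟨ ⟨ n , x′ ⟩ , s′ ⟩ ∈ˢ E → x ≐ x′
        -- Bounding the values by the codes keeps the induction formula Δ₀.
        agree {s} {s′} s∈C s′∈C n p q = induction {1}
          (∀< v1 · ∀< v3 · (pair (pair v2 v1) v3 ∊ᵇ #0 ⇒ᵇ pair (pair v2 v0) v4 ∊ᵇ #0 ⇒ᵇ v1 ≈ᵇ v0))
          (E ▹ ∅) (s ▹ s′ ▹ ∅)
          (λ x _ x′ _ p q → entry s∈C p >>= λ where
            (inj₂ (_ , _ , e , _)) → absurd (suc≢0ᴹ (≐-sym e))
            (inj₁ (_ , e)) → entry s′∈C q >>= λ where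
              (inj₂ (_ , _ , e′ , _)) → absurd (suc≢0ᴹ (≐-sym e′))
              (inj₁ (_ , e′)) → e ∙ ≐-sym e′)
          (λ n ih x _ x′ _ p q → entry s∈C p >>= λ where
            (inj₁ (e , _)) → absurd (suc≢0ᴹ e)
            (inj₂ (j , w , e , r , t)) → entry s′∈C q >>= λ where
              (inj₁ (e′ , _)) → absurd (suc≢0ᴹ e′)
              (inj₂ (j′ , w′ , e′ , r′ , t′)) →
                let g  = related (⟨,⟩-cong (≐-sym (suc-injᴹ e)) ≐-refl) ≐-refl r
                    g′ = related (⟨,⟩-cong (≐-sym (suc-injᴹ e′)) ≐-refl) ≐-refl r′
                in functional G-fun t (related (≐-sym (ih w (snd< g) w′ (snd< g′) g g′)) ≐-refl t′))
          n _ (snd< p) _ (snd< q) p q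

        base : ∀ {s} → s ∈ˢ C → Ex λ s → Ex λ x → x < s × s ∈ˢ C × ⟨ ⟨ 0# , x ⟩ , s ⟩ ∈ˢ E
        base s∈C = extend s∈C (η (inj₁ (≐-refl , ≐-refl))) >>= λ (s , s∈C , p) → η (s , η (a , snd< p , s∈C , p))

        empty : Ex λ s → s ∈ˢ C
        -- Any set cut off below 0 is empty, and the empty computation is justified vacuously.
        empty = encode C 0# >>= λ (s , h) → η (s , justified (λ p → absurd (≮0 (proj₁ (proj₁ (h _) p)))))

        successor : ∀ {n s x y} → s ∈ˢ C → ⟨ ⟨ n , x ⟩ , s ⟩ ∈ˢ E → ⟨ x , y ⟩ ∈ˢ G →
                    Ex λ s → s ∈ˢ C × ⟨ ⟨ n + 1# , y ⟩ , s ⟩ ∈ˢ E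
        successor s∈C p q = extend s∈C (η (inj₂ (_ , _ , ≐-refl , p , q)))

        total : ∀ n → Ex λ s → Ex λ x → x < s × s ∈ˢ C × ⟨ ⟨ n , x ⟩ , s ⟩ ∈ˢ E
        total = induction-Σ₁ {2} (∃< v0 · (v1 ∊ᵇ #0 ∧ᵇ pair (pair v2 v0) v1 ∊ᵇ #1)) (C ▹ E ▹ ∅) ∅
          (empty >>= λ (s , s∈C) → base s∈C)
          (λ n s h → do
            x , _ , s∈C , p ← h
            y , q ← value G-fun x
            s′ , s′∈C , r ← successor s∈C p q
            η (s′ , η (y , snd< r , s′∈C , r)))
    F , F-rel , F-def ← relation-comprehension-Δ₁ {2}
      (v0 ∊ᵇ #0 ∧ᵇ pair (pair v2 v1) v0 ∊ᵇ #1)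
      (∀< v0 · (v1 ∊ᵇ #0 ∧ᵇ pair (pair v3 v0) v1 ∊ᵇ #1 ⇒ᵇ v0 ≈ᵇ v2))
      (C ▹ E ▹ ∅) ∅
      (λ n x →
        (λ h s x′ _ (s∈C , p) → h >>= λ (s′ , s′∈C , q) → agree s∈C s′∈C n p q) ,
        (λ h → total n >>= λ (s , t) → t >>= λ (x′ , x′<s , s∈C , p) →
          η (s , s∈C , related (⟨,⟩-cong ≐-refl (h s x′ x′<s (s∈C , p))) ≐-refl p)))
    η (F
      , function F-rel
          (λ n → total n >>= λ (s , t) → t >>= λ (x , _ , p) → η (x , proj₂ (F-def n x) (η (s , p))))
          (λ p q → proj₁ (F-def _ _) p >>= λ (s , s∈C , r) → proj₁ (F-def _ _) q >>= λ (s′ , s′∈C , r′) →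
            agree s∈C s′∈C _ r r′)
      , (do
          s , s∈C ← empty
          s′ , q ← extend s∈C (η (inj₁ (≐-refl , ≐-refl)))
          proj₂ (F-def 0# a) (η (s′ , q)))
      , λ n x y p q → proj₁ (F-def _ _) p >>= λ (s , s∈C , r) → proj₂ (F-def _ _) (successor s∈C r q))

  Unbounded : S → Set
  Unbounded X = ∀ x → Ex λ y → x < y × y ∈ˢ X

  Increasing : S → Set
  Increasing F = ∀ n m x y → n < m → ⟨ n , x ⟩ ∈ˢ F → ⟨ m , y ⟩ ∈ˢ F → x < y

  -- Taking the least element of `X` above x makes the choice single-valued and its graph Δ₀.
  next-element : ∀ {X} → Unbounded X →
                 Ex λ G → Function G × (∀ x y → ⟨ x , y ⟩ ∈ˢ G → x < y × y ∈ˢ X)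
  next-element {X} unbounded = do
    G , G-rel , G-def ← relation-comprehension {1}
      (v0 ∊ᵇ #0 ∧ᵇ v1 ≺ᵇ v0 ∧ᵇ (∀< v0 · (v2 ≺ᵇ v0 ⇒ᵇ ~ᵇ (v0 ∊ᵇ #0)))) (X ▹ ∅) ∅
    η (G
      , function G-rel
          (λ x → do
            Y , Y-def ← comprehension {1} (v0 ∊ᵇ #0 ∧ᵇ v1 ≺ᵇ v0) (X ▹ ∅) (x ▹ ∅)
            y , x<y , y∈X ← unbounded x
            z , z∈Y , first ← least (proj₂ (Y-def y) (y∈X , x<y))
            let z∈X , x<z = proj₁ (Y-def z) z∈Y
            η (z , proj₂ (G-def x z) (z∈X , x<z , λ w w<z x<w w∈X → first w w<z (proj₂ (Y-def w) (w∈X , x<w)))))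
          (λ p q →
            let y∈X , x<y , first  = proj₁ (G-def _ _) p
                z∈X , x<z , first′ = proj₁ (G-def _ _) q
            in compare _ _ >>= λ where
              (inj₁ y<z)        → absurd (first′ _ y<z x<y y∈X)
              (inj₂ (inj₁ e))   → e
              (inj₂ (inj₂ z<y)) → absurd (first _ z<y x<z z∈X))
      , λ x y p → let y∈X , x<y , _ = proj₁ (G-def _ _) p in x<y , y∈X)

  enumeration : ∀ {X} → Unbounded X →
                Ex λ F → Function F × (∀ n x → ⟨ n , x ⟩ ∈ˢ F → x ∈ˢ X) × Increasing F
  enumeration {X} unbounded = do
    G , G-fun , G-next ← next-element unbounded
    a , _ , a∈X ← unbounded 0#
    F , F-fun , F0 , F-step ← iteration G-fun a
    let range : ∀ n → Ex λ x → ⟨ n , x ⟩ ∈ˢ F × x ∈ˢ X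
        range = induction-Σ₁ {2} (pair v1 v0 ∊ᵇ #0 ∧ᵇ v0 ∊ᵇ #1) (F ▹ X ▹ ∅) ∅ (η (a , F0 , a∈X))
          (λ n x (p , _) → value G-fun x >>= λ (y , q) → η (y , F-step _ _ _ p q , proj₂ (G-next _ _ q)))
        -- Monotonicity in Σ₁ form: the value at m is exhibited together with the inequality, and
        -- identified with the given value afterwards.
        above : ∀ {n x} → ⟨ n , x ⟩ ∈ˢ F → ∀ m → Ex λ y → ⟨ m , y ⟩ ∈ˢ F × (n < m → x < y)
        above {n} {x} p = induction-Σ₁ {1} (pair v1 v0 ∊ᵇ #0 ∧ᵇ (v2 ≺ᵇ v1 ⇒ᵇ v3 ≺ᵇ v0)) (F ▹ ∅) (n ▹ x ▹ ∅)
          (η (a , F0 , λ q → absurd (≮0 q)))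
          (λ m y (q , h) → do
            z , r ← value G-fun y
            let y<z , _ = G-next _ _ r
            η (z , F-step _ _ _ q r , λ n≤m → ≤-split n≤m >>= λ where
              (inj₁ n<m) → <-trans (h n<m) y<z
              (inj₂ e)   → <-resp (functional F-fun (related (≐-sym e) ≐-refl q) p) ≐-refl y<z))
    η (F , F-fun
      , (λ n x p → range _ >>= λ (x , q , x∈X) → ∈-resp (functional F-fun q p) x∈X)
      , (λ n m x y n<m p q → above p _ >>= λ (y , r , h) → <-resp ≐-refl (functional F-fun r q) (h n<m)))

-- The combinatorial implications inside a model.

module Principles (𝔐 : Model RCA₀) where
  open Iteration 𝔐 public

  -- Definitionally the meaning of `IsLinearOrder`, so the interpreted principles apply to it
  -- directly.
  LinearOrder : S → Set
  LinearOrder L = Relation L × (∀ x → ⟨ x , x ⟩ ∈ˢ L → A)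
    × (∀ x y z → ⟨ x , y ⟩ ∈ˢ L × ⟨ y , z ⟩ ∈ˢ L → ⟨ x , z ⟩ ∈ˢ L)
    × (∀ x y → M (x ≐ y ⊎ M (⟨ x , y ⟩ ∈ˢ L ⊎ ⟨ y , x ⟩ ∈ˢ L)))

  RT²₂⇒ADS : ⟦ RT²₂ ⟧ ∅ ∅ → ⟦ ADS ⟧ ∅ ∅
  RT²₂⇒ADS rt L (_ , irreflexive , _ , connected) = do
    C , C-rel , C-def ← relation-comprehension {1}
      (∃< v1 ⊕ 𝟏 · ∃< v2 ⊕ 𝟏 · (v3 ≈ᵇ pair v1 v0 ∧ᵇ v1 ≺ᵇ v0 ∧ᵇ
        (v2 ≈ᵇ 𝟎 ∧ᵇ pair v1 v0 ∊ᵇ #0 ∨ᵇ v2 ≈ᵇ 𝟏 ∧ᵇ ~ᵇ (pair v1 v0 ∊ᵇ #0))))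
      (L ▹ ∅) ∅
    let Coloured : D → D → D → Set
        Coloured x y i = (i ≐ 0# × ⟨ x , y ⟩ ∈ˢ L) ⊎ (i ≐ 1# × (⟨ x , y ⟩ ∈ˢ L → A))
        moved : ∀ {x y x′ y′ i} → x ≐ x′ → y ≐ y′ → Coloured x′ y′ i → Coloured x y i
        moved f g = λ where
          (inj₁ (e , l))  → inj₁ (e , related (≐-sym f) (≐-sym g) l)
          (inj₂ (e , ¬l)) → inj₂ (e , λ l → ¬l (related f g l))
        same : ∀ {x y i j} → Coloured x y i → Coloured x y j → i ≐ j
        same = λ where
          (inj₁ (e , _))  (inj₁ (e′ , _))  → e ∙ ≐-sym e′
          (inj₁ (_ , l))  (inj₂ (_ , ¬l))  → absurd (¬l l)
          (inj₂ (_ , ¬l)) (inj₁ (_ , l))   → absurd (¬l l)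
          (inj₂ (e , _))  (inj₂ (e′ , _))  → e ∙ ≐-sym e′
        zero-or-one : ∀ {x y i} → Coloured x y i → i ≐ 0# ⊎ i ≐ 1#
        zero-or-one = λ { (inj₁ (e , _)) → inj₁ e ; (inj₂ (e , _)) → inj₂ e }
        coloured : ∀ {q i} → ⟨ q , i ⟩ ∈ˢ C → Ex λ x → Ex λ y → q ≐ ⟨ x , y ⟩ × x < y × M (Coloured x y i)
        coloured p = do
          x , _ , h ← proj₁ (C-def _ _) p
          y , _ , h′ ← h
          η (x , η (y , h′))
        colour-of : ∀ {x y i} → ⟨ ⟨ x , y ⟩ , i ⟩ ∈ˢ C → M (Coloured x y i)
        colour-of p = do
          x′ , h ← coloured p
          y′ , e , _ , c ← h
          c′ ← c
          let f , g = ⟨,⟩-injective e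
          η (moved f g c′)
        case : ∀ x y → x < y → Ex λ i → ⟨ ⟨ x , y ⟩ , i ⟩ ∈ˢ C
        case x y x<y = do
          inj₁ p ← em (⟨ x , y ⟩ ∈ˢ L)
            where inj₂ ¬p → η (1# , proj₂ (C-def _ _)
                    (η (x , fst≤ x y , η (y , snd≤ x y , ≐-refl , x<y , η (inj₂ (≐-refl , ¬p))))))
          η (0# , proj₂ (C-def _ _)
                    (η (x , fst≤ x y , η (y , snd≤ x y , ≐-refl , x<y , η (inj₁ (≐-refl , p))))))
        unique : ∀ {x y i j} → ⟨ ⟨ x , y ⟩ , i ⟩ ∈ˢ C → ⟨ ⟨ x , y ⟩ , j ⟩ ∈ˢ C → i ≐ j
        unique p q = colour-of p >>= λ c → colour-of q >>= λ c′ → same c c′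
    H , infinite , homogeneous ← rt C
      ( (λ d p → do
          q , h ← C-rel d p
          i , e ← h
          x , h′ ← coloured (∈-resp e p)
          y , f , x<y , c ← h′
          η (x , η (y , η (i , x<y , (c >>= λ c′ → η (zero-or-one c′)) , e ∙ ⟨,⟩-cong f ≐-refl))))
      , λ x y x<y → case x y x<y >>= λ (i , p) → η (i , p , λ j q → unique q p))
    j , same-colour ← homogeneous
    F , F-fun , F⊆H , F-inc ← enumeration infinite
    let colour : ∀ n m x y → n < m → ⟨ n , x ⟩ ∈ˢ F → ⟨ m , y ⟩ ∈ˢ F → M (Coloured x y j)
        colour n m x y n<m p q = colour-of (same-colour x y (F⊆H n x p , F⊆H m y q , F-inc n m x y n<m p q))
    η (F , F-fun , (do
      -- The homogeneous colour is given merely as a number. Comparing it with 0 is enough, for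
      -- every pair then rules out the wrong case.
      inj₁ j≐0 ← em (j ≐ 0#)
        where inj₂ j≢0 → η (inj₂ λ n m x y (n<m , p , q) → colour n m x y n<m p q >>= λ where
                (inj₁ (e , _)) → absurd (j≢0 e)
                (inj₂ (_ , ¬l)) → connected x y >>= λ where
                  (inj₁ e) → absurd (<⇒≢ (F-inc n m x y n<m p q) e)
                  (inj₂ h) → h >>= λ where
                    (inj₁ l) → absurd (¬l l)
                    (inj₂ l) → l)
      η (inj₁ λ n m x y (n<m , p , q) → colour n m x y n<m p q >>= λ where
        (inj₁ (_ , l)) → l
        (inj₂ (e , _)) → absurd (0≢1 (≐-sym j≐0 ∙ e)))))
    where
    0≢1 : 0# ≐ 1# → A
    0≢1 e = suc≢0ᴹ (0+ 1# ∙ ≐-sym e)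

  Injective : S → Set
  Injective F = ∀ n m x → ⟨ n , x ⟩ ∈ˢ F → ⟨ m , x ⟩ ∈ˢ F → n ≐ m

  injective : ∀ {F} → (∀ n m x y → n < m → ⟨ n , x ⟩ ∈ˢ F → ⟨ m , y ⟩ ∈ˢ F → x ≐ y → A) → Injective F
  injective h n m x p q = compare n m >>= λ where
    (inj₁ r)        → absurd (h n m x x r p q ≐-refl)
    (inj₂ (inj₁ e)) → e
    (inj₂ (inj₂ r)) → absurd (h m n x x r q p ≐-refl)

  -- Relatedness of the values at x and y is Δ₁, as some values are related exactly when all are.
  -- Comprehension allows one unbounded quantifier, so z only bounds the two values u and v; u + v +
  -- 1 serves.
  pullback : ∀ R {F} → Function F → Ex λ K → Relation K ×
    (∀ x y → ⟨ x , y ⟩ ∈ˢ K ↔ (∀ u v → ⟨ x , u ⟩ ∈ˢ F → ⟨ y , v ⟩ ∈ˢ F → ⟨ u , v ⟩ ∈ˢ R))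
  pullback R {F} F-fun = do
    K , K-rel , K-def ← relation-comprehension-Δ₁ {2}
      (∃< v0 · ∃< v1 · (pair v4 v1 ∊ᵇ #0 ∧ᵇ pair v3 v0 ∊ᵇ #0 ∧ᵇ pair v1 v0 ∊ᵇ #1))
      (∀< v0 · ∀< v1 · (pair v4 v1 ∊ᵇ #0 ∧ᵇ pair v3 v0 ∊ᵇ #0 ⇒ᵇ pair v1 v0 ∊ᵇ #1))
      (F ▹ R ▹ ∅) ∅
      (λ x y →
        (λ h z u _ v _ (p , q) → related-values h p q) ,
        (λ h → witness x y (λ u v p q →
           h (u + v + 1#) u (≤-+ u v) v (≤-+ʳ v u) (p , q))))
    η (K , K-rel , λ x y → (λ p u v q r → related-values (proj₁ (K-def x y) p) q r) ,
                           (λ h → proj₂ (K-def x y) (witness x y h)))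
    where
    related-values : ∀ {x y u v} →
      Ex (λ z → Ex λ u → u < z × Ex λ v → v < z × ⟨ x , u ⟩ ∈ˢ F × ⟨ y , v ⟩ ∈ˢ F × ⟨ u , v ⟩ ∈ˢ R) →
      ⟨ x , u ⟩ ∈ˢ F → ⟨ y , v ⟩ ∈ˢ F → ⟨ u , v ⟩ ∈ˢ R
    related-values h p q = do
      z , h₁ ← h
      u , _ , h₂ ← h₁
      v , _ , p′ , q′ , r ← h₂
      related (functional F-fun p′ p) (functional F-fun q′ q) r
    witness : ∀ x y → (∀ u v → ⟨ x , u ⟩ ∈ˢ F → ⟨ y , v ⟩ ∈ˢ F → ⟨ u , v ⟩ ∈ˢ R) →
      Ex (λ z → Ex λ u → u < z × Ex λ v → v < z × ⟨ x , u ⟩ ∈ˢ F × ⟨ y , v ⟩ ∈ˢ F × ⟨ u , v ⟩ ∈ˢ R)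
    witness x y h = do
      u , p ← value F-fun x
      v , q ← value F-fun y
      η (u + v + 1# , η (u , ≤-+ u v , η (v , ≤-+ʳ v u , p , q , h u v p q)))

  -- Transitivity is demanded only at values of `F`. A tournament transitive on an infinite set thus
  -- becomes a linear order on all of ℕ when pulled back along an enumeration of that set.
  pullback-order : ∀ R {F} → Function F → Injective F →
    (∀ u → ⟨ u , u ⟩ ∈ˢ R → A) →
    (∀ n m k u v w → ⟨ n , u ⟩ ∈ˢ F → ⟨ m , v ⟩ ∈ˢ F → ⟨ k , w ⟩ ∈ˢ F →
      ⟨ u , v ⟩ ∈ˢ R → ⟨ v , w ⟩ ∈ˢ R → ⟨ u , w ⟩ ∈ˢ R) →
    (∀ u v → (u ≐ v → A) → M (⟨ u , v ⟩ ∈ˢ R ⊎ ⟨ v , u ⟩ ∈ˢ R)) →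
    Ex λ K → LinearOrder K ×
      (∀ x y → ⟨ x , y ⟩ ∈ˢ K ↔ (∀ u v → ⟨ x , u ⟩ ∈ˢ F → ⟨ y , v ⟩ ∈ˢ F → ⟨ u , v ⟩ ∈ˢ R))
  pullback-order R {F} F-fun F-inj R-irr R-trans R-conn = do
    K , K-rel , K-def ← pullback R F-fun
    η (K
      , ( K-rel
        , (λ x p → value F-fun x >>= λ (u , q) → R-irr u (proj₁ (K-def x x) p u u q q))
        , (λ x y z (p , q) → proj₂ (K-def x z) λ u w r t → value F-fun y >>= λ (v , s) →
            R-trans x y z u v w r s t (proj₁ (K-def x y) p u v r s) (proj₁ (K-def y z) q v w s t))
        , λ x y → do
            inj₂ x≢y ← em (x ≐ y)
              where inj₁ e → η (inj₁ e)
            u , p ← value F-fun x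
            v , q ← value F-fun y
            R-conn u v (λ e → x≢y (F-inj x y v (related ≐-refl e p) q)) >>= λ where
              (inj₁ r) → η (inj₂ (η (inj₁ (proj₂ (K-def x y) λ u′ v′ p′ q′ →
                           related (functional F-fun p p′) (functional F-fun q q′) r))))
              (inj₂ r) → η (inj₂ (η (inj₂ (proj₂ (K-def y x) λ v′ u′ q′ p′ →
                           related (functional F-fun q q′) (functional F-fun p p′) r)))))
      , K-def)

  UnboundedValues : S → Set
  UnboundedValues F = ∀ x → Ex λ n → Ex λ y → x < y × ⟨ n , y ⟩ ∈ˢ F

  -- ADS replaces the pigeonhole principle: in the order pulled back from (ℕ, <) along an
  -- injection F, a monotone sequence is ascending, and its values outgrow every bound.
  injection-unbounded : ⟦ ADS ⟧ ∅ ∅ → ∀ {F} → Function F → Injective F → UnboundedValues F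
  injection-unbounded ads {F} F-fun F-inj x = do
    R , _ , R-def ← relation-comprehension {0} (v1 ≺ᵇ v0) ∅ ∅
    K , K-lin , K-def ← pullback-order R F-fun F-inj
      (λ u p → <-irrefl (proj₁ (R-def u u) p))
      (λ _ _ _ u v w _ _ _ p q → proj₂ (R-def u w) (<-trans (proj₁ (R-def u v) p) (proj₁ (R-def v w) q)))
      (λ u v u≢v → compare u v >>= λ where
        (inj₁ p)        → η (inj₁ (proj₂ (R-def u v) p))
        (inj₂ (inj₁ e)) → absurd (u≢v e)
        (inj₂ (inj₂ p)) → η (inj₂ (proj₂ (R-def v u) p)))
    G , G-fun , monotone ← ads K K-lin
    let below : ∀ {n m u v} → ⟨ n , m ⟩ ∈ˢ K → ⟨ n , u ⟩ ∈ˢ F → ⟨ m , v ⟩ ∈ˢ F → u < v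
        below r p q = proj₁ (R-def _ _) (proj₁ (K-def _ _) r _ _ p q)
        composite : ∀ n → Ex λ u → Ex λ v → ⟨ n , u ⟩ ∈ˢ G × ⟨ u , v ⟩ ∈ˢ F
        composite n = value G-fun n >>= λ (u , p) → value F-fun u >>= λ (v , q) → η (u , η (v , p , q))
    monotone >>= λ where
      (inj₁ ascends) → do
        -- Along an ascending G the values of F increase strictly, so the n-th is at least n; z
        -- merely bounds the witnesses.
        let growth : ∀ n → Ex λ z → Ex λ u → u < z × Ex λ v → v < z × ⟨ n , u ⟩ ∈ˢ G × ⟨ u , v ⟩ ∈ˢ F × n ≤ v
            growth = induction-Σ₁ {2}
              (∃< v0 · ∃< v1 · (pair v3 v1 ∊ᵇ #0 ∧ᵇ pair v1 v0 ∊ᵇ #1 ∧ᵇ v3 ≺ᵇ v0 ⊕ 𝟏)) (G ▹ F ▹ ∅) ∅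
              (composite 0# >>= λ (u , h) → h >>= λ (v , p , q) →
                η (u + v + 1# , η (u , ≤-+ u v , η (v , ≤-+ʳ v u , p , q , 0≤))))
              (λ n z h → h >>= λ (u , _ , h′) → h′ >>= λ (v , _ , p , q , n≤v) →
                composite (n + 1#) >>= λ (u′ , h) → h >>= λ (v′ , p′ , q′) →
                η (u′ + v′ + 1# , η (u′ , ≤-+ u′ v′ , η (v′ , ≤-+ʳ v′ u′ , p′ , q′ ,
                  suc-≤ (≤-<-trans n≤v (below (ascends n (n + 1#) u u′ (≤-refl , p , p′)) q q′))))))
        z , h ← growth (x + 1#)
        u , _ , h′ ← h
        v , _ , p , q , x<v ← h′
        η (u , η (v , ≤-suc x<v , q))
      (inj₂ descends) → do
        u₀ , h ← composite 0#
        v₀ , p₀ , q₀ ← h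
        -- Along a descending G each step costs at least 1 out of v₀, which is impossible at step v₀
        -- + 1.
        let decay : ∀ n → Ex λ z → Ex λ u → u < z × Ex λ v → v < z × ⟨ n , u ⟩ ∈ˢ G × ⟨ u , v ⟩ ∈ˢ F × v + n ≤ v₀
            decay = induction-Σ₁ {2}
              (∃< v0 · ∃< v1 · (pair v3 v1 ∊ᵇ #0 ∧ᵇ pair v1 v0 ∊ᵇ #1 ∧ᵇ v0 ⊕ v3 ≺ᵇ v4 ⊕ 𝟏)) (G ▹ F ▹ ∅) (v₀ ▹ ∅)
              (η (u₀ + v₀ + 1# , η (u₀ , ≤-+ u₀ v₀ , η (v₀ , ≤-+ʳ v₀ u₀ , p₀ , q₀ , ≤-reflexive (+-zero v₀)))))
              (λ n z h → h >>= λ (u , _ , h′) → h′ >>= λ (v , _ , p , q , le) →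
                composite (n + 1#) >>= λ (u′ , h) → h >>= λ (v′ , p′ , q′) →
                <-difference (below (descends n (n + 1#) u u′ (≤-refl , p , p′)) q′ q) >>= λ (d , e) →
                η (u′ + v′ + 1# , η (u′ , ≤-+ u′ v′ , η (v′ , ≤-+ʳ v′ u′ , p′ , q′ ,
                  ≤-trans (≤-≐ (≤-+ (v′ + (n + 1#)) d)
                    (solve 3 (λ v n d → v :+ (n :+ con 1) :+ d := v :+ (d :+ con 1) :+ n) ≐-refl v′ n d
                      ∙ +-congʳ (≐-sym e))) le))))
        z , h ← decay (v₀ + 1#)
        u , _ , h′ ← h
        v , _ , p , q , le ← h′
        absurd (≤⇒≯ le (<-resp ≐-refl (+-assoc v v₀ 1#) (≤-+ʳ v₀ v)))

  -- `H` consists of the values larger than all earlier ones. For the Π₁ form, take any n with F(n)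
  -- > x: if x is a record, it is attained before n, so the search for its position is bounded.
  -- Unboundedness supplies such an n. Were a larger record attained before a smaller one, the
  -- smaller would not exceed all values preceding it.
  records : ∀ {F} → Function F → UnboundedValues F →
    Ex λ H → Unbounded H × (∀ x y → x ∈ˢ H → y ∈ˢ H → x < y →
      Ex λ n → Ex λ m → n < m × ⟨ n , x ⟩ ∈ˢ F × ⟨ m , y ⟩ ∈ˢ F)
  records {F} F-fun unbounded = do
    H , H-def ← comprehension-Δ₁ {1}
      (pair v0 v1 ∊ᵇ #0 ∧ᵇ (∀< v0 · ∃< v2 · pair v1 v0 ∊ᵇ #0))
      (~ᵇ (∃< v1 ⊕ 𝟏 · pair v1 v0 ∊ᵇ #0) ⇒ᵇ
        (∃< v0 · (pair v0 v2 ∊ᵇ #0 ∧ᵇ (∀< v0 · ∃< v3 · pair v1 v0 ∊ᵇ #0))))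
      (F ▹ ∅) ∅
      (λ x →
        (λ h n high → h >>= λ (k , p , record-at) → compare k n >>= λ where
          (inj₁ k<n)        → η (k , k<n , p , record-at)
          (inj₂ (inj₁ e))   → absurd (high (η (x , ≤-refl , related e ≐-refl p)))
          (inj₂ (inj₂ n<k)) → absurd (record-at n n<k >>= λ (y , y<x , q) → high (η (y , <⇒≤ y<x , q)))) ,
        (λ h → unbounded x >>= λ (n , t) → t >>= λ (y , x<y , p) →
          h n (λ low → low >>= λ (z , z≤x , q) → ≤⇒≯ z≤x (<-resp ≐-refl (functional F-fun p q) x<y)) >>=
          λ (k , _ , q , record-at) → η (k , q , record-at)))
    η (H
      , (λ x → do
          Y , Y-def ← comprehension {1} (~ᵇ (∃< v1 ⊕ 𝟏 · pair v1 v0 ∊ᵇ #0)) (F ▹ ∅) (x ▹ ∅)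
          n , t ← unbounded x
          y , x<y , p ← t
          -- The first position at which F exceeds x carries a record: all earlier values are at
          -- most x.
          m , m∈Y , first ← least (proj₂ (Y-def n) λ low → low >>= λ (z , z≤x , q) →
            ≤⇒≯ z≤x (<-resp ≐-refl (functional F-fun p q) x<y))
          w , q ← value F-fun m
          let x<w : x < w
              x<w = by-contradiction λ x≮w → proj₁ (Y-def m) m∈Y (η (w , ≮⇒≥ x≮w , q))
          η (w , x<w , proj₂ (H-def w) (η (m , q , λ k k<m → by-contradiction λ none →
            first k k<m (proj₂ (Y-def k) λ low → low >>= λ (z , z≤x , r) →
              none (η (z , ≤-<-trans z≤x x<w , r))))))
        )
      , λ x y x∈H y∈H x<y → do
          n , p , record-at ← proj₁ (H-def x) x∈H
          m , q , _ ← proj₁ (H-def y) y∈H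
          compare n m >>= λ where
            (inj₁ n<m)        → η (n , η (m , n<m , p , q))
            (inj₂ (inj₁ e))   → absurd (<⇒≢ x<y (functional F-fun p (related (≐-sym e) ≐-refl q)))
            (inj₂ (inj₂ m<n)) → record-at m m<n >>= λ (z , z<x , r) →
              absurd (<-asym x<y (<-resp (functional F-fun r q) ≐-refl z<x)))

  increasing-≥ : ∀ {F} → Function F → Increasing F → ∀ {n x} → ⟨ n , x ⟩ ∈ˢ F → n ≤ x
  increasing-≥ {F} F-fun F-inc {n} p = do
    y , q , n≤y ← induction-Σ₁ {1} (pair v1 v0 ∊ᵇ #0 ∧ᵇ v1 ≺ᵇ v0 ⊕ 𝟏) (F ▹ ∅) ∅
      (value F-fun 0# >>= λ (y , q) → η (y , q , 0≤))
      (λ m y (q , m≤y) → value F-fun (m + 1#) >>= λ (z , r) →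
        η (z , r , suc-≤ (≤-<-trans m≤y (F-inc m (m + 1#) y z ≤-refl q r)))) n
    ≤-≐ n≤y (functional F-fun q p)

  EM∧ADS⇒RT²₂ : ⟦ EM ⟧ ∅ ∅ → ⟦ ADS ⟧ ∅ ∅ → ⟦ RT²₂ ⟧ ∅ ∅
  EM∧ADS⇒RT²₂ em-principle ads C (C-codes , C-total) = do
    T , T-rel , T-def ← relation-comprehension {1}
      (v1 ≺ᵇ v0 ∧ᵇ pair (pair v1 v0) 𝟏 ∊ᵇ #0 ∨ᵇ v0 ≺ᵇ v1 ∧ᵇ pair (pair v0 v1) 𝟎 ∊ᵇ #0) (C ▹ ∅) ∅
    let T-up : ∀ {x y} → x < y → ⟨ x , y ⟩ ∈ˢ T → ⟨ ⟨ x , y ⟩ , 1# ⟩ ∈ˢ C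
        T-up x<y p = proj₁ (T-def _ _) p >>= λ where
          (inj₁ (_ , q))   → q
          (inj₂ (y<x , _)) → absurd (<-asym x<y y<x)
        T-down : ∀ {x y} → x < y → ⟨ y , x ⟩ ∈ˢ T → ⟨ ⟨ x , y ⟩ , 0# ⟩ ∈ˢ C
        T-down x<y p = proj₁ (T-def _ _) p >>= λ where
          (inj₁ (y<x , _)) → absurd (<-asym x<y y<x)
          (inj₂ (_ , q))   → q
        T-irreflexive : ∀ x → ⟨ x , x ⟩ ∈ˢ T → A
        T-irreflexive x p = proj₁ (T-def x x) p >>= λ where
          (inj₁ (x<x , _)) → <-irrefl x<x
          (inj₂ (x<x , _)) → <-irrefl x<x
        exclusive : ∀ {x y} → x < y → ⟨ x , y ⟩ ∈ˢ T → ⟨ y , x ⟩ ∈ˢ T → A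
        exclusive x<y p q = C-total _ _ x<y >>= λ (i , _ , u) →
          suc≢0ᴹ (0+ 1# ∙ u _ (T-up x<y p) ∙ ≐-sym (u _ (T-down x<y q)))
        directed : ∀ {x y} → x < y → M (⟨ x , y ⟩ ∈ˢ T ⊎ ⟨ y , x ⟩ ∈ˢ T)
        directed {x} {y} x<y = do
          i , p , _ ← C-total x y x<y
          x′ , h₁ ← C-codes _ p
          y′ , h₂ ← h₁
          i′ , _ , c , e ← h₂
          inj₁ i′≐0 ← c
            where inj₂ i′≐1 → η (inj₁ (proj₂ (T-def x y)
                    (η (inj₁ (x<y , related ≐-refl (proj₂ (⟨,⟩-injective e) ∙ i′≐1) p)))))
          η (inj₂ (proj₂ (T-def y x)
            (η (inj₂ (x<y , related ≐-refl (proj₂ (⟨,⟩-injective e) ∙ i′≐0) p)))))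
        T-total : ∀ x y → (x ≐ y → A) → M (⟨ x , y ⟩ ∈ˢ T ⊎ ⟨ y , x ⟩ ∈ˢ T)
        T-total x y x≢y = compare x y >>= λ where
          (inj₁ x<y)        → directed x<y
          (inj₂ (inj₁ e))   → absurd (x≢y e)
          (inj₂ (inj₂ y<x)) → directed y<x >>= λ { (inj₁ p) → η (inj₂ p) ; (inj₂ p) → η (inj₁ p) }
    X , X-infinite , T-trans ← em-principle T
      ( T-rel , T-irreflexive , λ x y x≢y → T-total x y x≢y , λ (p , q) → compare x y >>= λ where
          (inj₁ x<y)        → exclusive x<y p q
          (inj₂ (inj₁ e))   → x≢y e
          (inj₂ (inj₂ y<x)) → exclusive y<x q p )
    E , E-fun , E⊆X , E-inc ← enumeration X-infinite
    L , L-lin , L-def ← pullback-order T E-fun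
      (injective λ n m x y n<m p q e → <⇒≢ (E-inc n m x y n<m p q) e)
      T-irreflexive
      (λ n m k u v w p q r s t → T-trans u v w (E⊆X n u p , E⊆X m v q , E⊆X k w r) (s , t))
      T-total
    F , F-fun , monotone ← ads L L-lin
    let L-irreflexive = proj₁ (proj₂ L-lin)
        F-inj : Injective F
        F-inj = injective λ n m x y n<m p q e → monotone >>= λ where
          (inj₁ ascends)  → L-irreflexive x (related ≐-refl (≐-sym e) (ascends n m x y (n<m , p , q)))
          (inj₂ descends) → L-irreflexive x (related (≐-sym e) ≐-refl (descends n m x y (n<m , p , q)))
    I , I-infinite , I-records ← records F-fun (injection-unbounded ads F-fun F-inj)
    -- `E` increases, so an index never exceeds its value; bounding the index by the element makes
    -- the image of I under E Δ₀-definable.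
    H , H-def ← comprehension {2} (∃< v0 ⊕ 𝟏 · (pair v0 v1 ∊ᵇ #0 ∧ᵇ v0 ∊ᵇ #1)) (E ▹ I ▹ ∅) ∅
    let reflects-< : ∀ {n m x y} → ⟨ n , x ⟩ ∈ˢ E → ⟨ m , y ⟩ ∈ˢ E → x < y → n < m
        reflects-< {n} {m} p q x<y = compare n m >>= λ where
          (inj₁ n<m)        → n<m
          (inj₂ (inj₁ e))   → absurd (<⇒≢ x<y (functional E-fun p (related (≐-sym e) ≐-refl q)))
          (inj₂ (inj₂ m<n)) → absurd (<-asym x<y (E-inc _ _ _ _ m<n q p))
        -- For x < y in H the indices satisfy i < j, and being records they occur along F in this
        -- order. Numerical order and position thus agree, so the direction of monotonicity alone
        -- determines the colour.
        indices : ∀ {x y} → x ∈ˢ H → y ∈ˢ H → x < y → Ex λ i → Ex λ j → Ex λ n → Ex λ m →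
          ⟨ i , x ⟩ ∈ˢ E × ⟨ j , y ⟩ ∈ˢ E × n < m × ⟨ n , i ⟩ ∈ˢ F × ⟨ m , j ⟩ ∈ˢ F
        indices x∈H y∈H x<y = do
          i , _ , p , i∈I ← proj₁ (H-def _) x∈H
          j , _ , q , j∈I ← proj₁ (H-def _) y∈H
          n , h ← I-records i j i∈I j∈I (reflects-< p q x<y)
          m , n<m , r , s ← h
          η (i , η (j , η (n , η (m , p , q , n<m , r , s))))
    η (H
      , (λ x → do
          i , x<i , i∈I ← I-infinite x
          y , p ← value E-fun i
          let i≤y = increasing-≥ E-fun E-inc p
          η (y , <-≤-trans x<i i≤y , proj₂ (H-def y) (η (i , i≤y , p , i∈I))))
      , (do
          inj₁ ascends ← monotone
            where inj₂ descends → η (0# , λ x y (x∈H , y∈H , x<y) → do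
                    i , h₁ ← indices x∈H y∈H x<y
                    j , h₂ ← h₁
                    n , h₃ ← h₂
                    m , p , q , n<m , r , s ← h₃
                    T-down x<y (proj₁ (L-def j i) (descends n m i j (n<m , r , s)) y x q p))
          η (1# , λ x y (x∈H , y∈H , x<y) → do
            i , h₁ ← indices x∈H y∈H x<y
            j , h₂ ← h₁
            n , h₃ ← h₂
            m , p , q , n<m , r , s ← h₃
            T-up x<y (proj₁ (L-def i j) (ascends n m i j (n<m , r , s)) x y p q))))

-- With no set terms available, the existence of a set has to come from comprehension: falsum,
-- quantified both ways, defines the empty set.
RCA₀-inhabited : ∀ {Γ : List Sentence} → RCA₀ ∣ Γ ⊢ ∃ˢ (falsum ⇒ falsum)
RCA₀-inhabited = ∃ˢ-E
  (⇒-E (axiom (Δ₁-comp (ex bot) (all bot)))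
       (∀ᴺ-I (∧-I (⇒-I (raa (∃ᴺ-E (assume (there (here refl))) (assume (here refl)))))
                  (⇒-I (raa (∀ᴺ-E (assume (there (here refl))) 𝟎))))))
  (∃ˢ-I zero (⇒-I (assume (here refl))))

corollary1p13 : (RCA₀ + EM ⊢ RT²₂) ⇔ (RCA₀ + EM ⊢ ADS)
corollary1p13 = mk⇔
  (λ rt → ⇒-E (⇒-I (weaken (λ { (here e) → here e ; (there ()) })
            (completeness subst-RCA₀ RCA₀-inhabited {RT²₂ ∷ []} λ 𝔐 h → Principles.RT²₂⇒ADS 𝔐 (h (here refl))))) rt)
  (λ ads → ⇒-E (⇒-I
    (completeness subst-RCA₀ RCA₀-inhabited {ADS ∷ EM ∷ []} λ 𝔐 h →
      Principles.EM∧ADS⇒RT²₂ 𝔐 (h (there (here refl))) (h (here refl)))) ads)
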